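{- Let $G_0$ be a finite abelian group, let $G\leq G_0$ be a subgroup, let $\gamma,\delta\in G_0$, let $n\geq |G|$ be an integer, let $A\subseteq\mathbb Z$ be nonempty with $\gcd(A)=1$, and let $W$ be a finite sequence of integers with $\mathrm{supp}(W)=A$. Let $S$ be a sequence over $G_0$ all of whose terms lie in the coset $\gamma+G$, such that $A\cdot s\subseteq \delta+G$ for every $s\in\mathrm{supp}(S)$, and such that $|S|\geq n+\mathsf D_A(G)-1$. Then there exist a subgroup $H\leq G$, elements $\alpha\in\gamma+G$ and $\beta\in\delta+G$, and subsequences $S'\mid S$, $S''\mid S'$ and $S_0\mid S$ such that: (1) all terms of $S'$ and of $S''$ lie in $\alpha+H$, and $A\cdot s\subseteq \beta+H$ for all $s\in\mathrm{supp}(S')$; (2) $|S'|\geq \min\{|S|,\ |S|-(|G/H|-2)\}$; (3) $|S''|=|H|+\mathsf D_A(H)-1$; (4) $|H|\beta+H=\Sigma_{|H|}(W^{|H|},S'')$; (5) $\Sigma_n(W^n,S)=(n-|H|-r)\beta+\Sigma_{|H|+r}(W^{|H|+r},S_0)$, and this set is $H$-periodic (a union of $H$-cosets) and contains $n\beta$; (6) $S S'^{ -1}S''\mid S_0$ and $|S_0|=|H|+r+\mathsf D_A(H)+\mathsf D_A(G/H)-2\leq |H|+r+\mathsf D_A(G)-1$, where $r=|SS'^{ -1}|$ (the number of terms of $S$ not in $S'$) satisfies $r\leq\max\{0,\ |G/H|-2\}$.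
   Context: Sequences are finite multisets (elements of the free abelian monoid over a set), written multiplicatively; $|S|$ is the length, $\mathrm{supp}(S)$ the set of distinct terms, $T\mid S$ means $T$ is a subsequence (sub-multiset) of $S$, $ST^{ -1}$ denotes $S$ with the terms of $T$ removed, and $T_1T_2$ denotes concatenation. For $A\subseteq\mathbb Z$ and a group element $g$, $A\cdot g=\{ag: a\in A\}$. For a sequence $W$ of integers with support $A$ and a sequence $S$ over an abelian group, $\Sigma_k(W^k,S)$ is the set of all sums $\sum_{i=1}^k a_is_i$ where $s_1\cdots s_k$ is a subsequence of $S$ of length $k$ and $a_1,\dots,a_k\in A$ (each $a_i$ chosen freely from $A$); similarly $\Sigma(W^{|S|},S)$ is the set of all such sums $\sum_{i=1}^r a_is_i$ over nontrivial (nonempty) subsequences $s_1\cdots s_r$ of $S$ with $a_i\in A$. For a finite abelian group $G$, $\mathsf D_A(G)$ is the least integer $\ell$ such that every sequence over $G$ of length $\ell$ has a nontrivial subsequence $s_1\cdots s_r$ with $\sum_{i=1}^r a_is_i=0$ for some $a_i\in A$ (i.e. $0\in\Sigma(W^{\ell},S)$); $\mathsf D_A(G/H)$ is defined likewise for the quotient group. For $k\in\mathbb Z$ and $g$ a group element, $kg+H$ is the coset; a set $X$ is $H$-periodic if $X+H=X$. -}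

module Defs where

open import Level using (0ℓ)
open import Data.Nat as ℕ using (ℕ; zero; suc; NonZero)
open import Data.Nat.GCD using (gcd)
open import Data.Integer as ℤ using (ℤ; +_; -[1+_]; ∣_∣)
open import Data.List using (List; []; _∷_; length; filter; foldr)
open import Data.List.Relation.Unary.All using (All)
open import Data.List.Relation.Unary.Unique.Propositional using (Unique)
open import Data.List.Membership.Propositional using (_∈_)
open import Data.List.Membership.Propositional.Properties using (∈-filter⁺)
open import Data.List.Relation.Binary.Permutation.Propositional using (_↭_)
open import Data.List.Base using (_++_)
open import Data.Product using (Σ; ∃; _×_; _,_)
open import Relation.Nullary using (¬_)
open import Relation.Unary using (Pred; Decidable)
open import Relation.Binary.PropositionalEquality using (_≡_)
open import Algebra.Structures using (IsAbelianGroup)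

record FinAbGroup : Set₁ where
  field
    Carrier : Set
    _+_     : Carrier → Carrier → Carrier
    ε       : Carrier
    -_      : Carrier → Carrier
    isAbelianGroup : IsAbelianGroup _≡_ _+_ ε -_
    elems   : List Carrier
    complete : ∀ x → x ∈ elems
    unique  : Unique elems

gcdList : List ℤ → ℕ
gcdList = foldr (λ a g → gcd ∣ a ∣ g) 0

-- Multisets of elements of a type, represented by lists up to permutation.
-- T ⊑ S : T is a subsequence (sub-multiset) of S.

_⊑_ : {X : Set} → List X → List X → Set
T ⊑ S = ∃ λ U → (T ++ U) ↭ S

module FAG (𝔾 : FinAbGroup) where
  open FinAbGroup 𝔾 public

  _-_ : Carrier → Carrier → Carrier
  x - y = x + (- y)

  _×ℕ_ : ℕ → Carrier → Carrier
  zero  ×ℕ x = ε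
  suc k ×ℕ x = x + (k ×ℕ x)

  infixr 8 _·_
  _·_ : ℤ → Carrier → Carrier
  (+ k)    · x = k ×ℕ x
  -[1+ k ] · x = - (suc k ×ℕ x)

  record Subgroup : Set₁ where
    field
      mem    : Pred Carrier 0ℓ
      dec    : Decidable mem
      ε∈     : mem ε
      +-closed : ∀ {x y} → mem x → mem y → mem (x + y)
      ⁻¹-closed : ∀ {x} → mem x → mem (- x)
  open Subgroup public

  _≤G_ : Subgroup → Subgroup → Set
  H ≤G G = ∀ {x} → mem H x → mem G x

  card : Subgroup → ℕ
  card H = length (filter (dec H) elems)

  card-nz : (H : Subgroup) → NonZero (card H)
  card-nz H = nz (filter (dec H) elems) (∈-filter⁺ (dec H) (complete ε) (ε∈ H))
    where
    nz : (xs : List Carrier) → ε ∈ xs → NonZero (length xs)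
    nz (_ ∷ xs) _ = _

  -- index |G/H| = |G| / |H| (Lagrange)
  index : Subgroup → Subgroup → ℕ
  index G H = ℕ._/_ (card G) (card H) {{card-nz H}}

  InCoset : Carrier → Subgroup → Carrier → Set
  InCoset g H x = mem H (x - g)

  data WSum (W : List ℤ) : List Carrier → Carrier → Set where
    []  : WSum W [] ε
    _∷_ : ∀ {a t T x} → a ∈ W → WSum W T x → WSum W (t ∷ T) ((a · t) + x)

  Σₖ : ℕ → List ℤ → List Carrier → Pred Carrier 0ℓ
  Σₖ k W S x = ∃ λ T → T ⊑ S × length T ≡ k × WSum W T x

  DavProp : List ℤ → Subgroup → Pred Carrier 0ℓ → ℕ → Set
  DavProp W G Z ℓ = ∀ (S : List Carrier) → All (mem G) S → length S ≡ ℓ →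
    ∃ λ T → T ⊑ S × ¬ (T ≡ []) × ∃ λ x → WSum W T x × Z x

  IsDav : List ℤ → Subgroup → ℕ → Set
  IsDav W G ℓ = DavProp W G (λ x → x ≡ ε) ℓ
              × (∀ m → DavProp W G (λ x → x ≡ ε) m → ℓ ℕ.≤ m)

  -- ℓ = D_A(G/H): same, in the quotient G/H; a sequence over G/H is a
  -- sequence over G of coset representatives, and zero in G/H means in H
  IsDavQ : List ℤ → Subgroup → Subgroup → ℕ → Set
  IsDavQ W G H ℓ = DavProp W G (mem H) ℓ × (∀ m → DavProp W G (mem H) m → ℓ ℕ.≤ m)

  Periodic : Subgroup → Pred Carrier 0ℓ → Set
  Periodic H X = ∀ {x h} → mem H h → X x → X (x + h)

{-# OPTIONS --safe #-}

-- The sums of length |K| are controlled by greedy sumsets: adding the set A·s to a set X with stabiliser M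
-- enlarges X unless A·s lies in one coset of M.  Starting from K = G, such a pass over the terms of S lying in
-- a coset β + K either fills the whole coset, or ends with a proper subgroup M of K one of whose cosets contains
-- all but few of the terms; this descent stops at some K whose coset is filled.  The lengths come out right
-- because a subsequence can be extended by weighted zero-sums until fewer than D_A(K) terms remain, and an
-- overlong one can be shortened by at most h terms, h being the largest multiplicity (Kemperman–Scherk).
-- A second greedy pass over the remaining terms, now modulo K, produces H ≥ K such that few terms lie
-- outside of β + H and the coset of H is filled.  Modulo H only the terms outside β + H matter for Σ_n(S), and
-- the terms of S″ supply all of H, which gives the periodicity and the reduction to S₀.

module Submission where

open import Defs
open import Level using (0ℓ)
open import Data.Nat as ℕ using (ℕ; zero; suc; _≤_; _∸_; z≤n; s≤s) renaming (_+_ to infixl 6 _+ℕ_; _*_ to infixl 7 _*ℕ_)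
import Data.Nat.Properties as ℕₚ
open import Data.Nat.DivMod using (m*n/n≡m; /-monoˡ-≤)
open import Data.Nat.GCD using (gcd; gcd-GCD; module Bézout)
open import Data.Nat.Tactic.RingSolver using (solve-∀)
open import Data.Integer as ℤ using (ℤ; -[1+_]; ∣_∣)
import Data.Integer.Properties as ℤₚ
import Data.Integer.Tactic.RingSolver as ℤ-Solver
open import Data.Fin as Fin using (Fin)
open import Data.Vec as Vec using (Vec; []; _∷_; zipWith; replicate; lookup; allFin)
open import Data.Vec.N-ary using (N-ary; _$ⁿ_)
open import Data.List using (List; []; _∷_; length; _++_; map; filter; take; drop; cartesianProductWith)
import Data.List.Properties as List
open import Data.List.Membership.Propositional using (_∈_; find)
open import Data.List.Membership.Propositional.Properties using (∈-∃++; ∈-++⁻; ∈-++⁺ˡ; ∈-++⁺ʳ; ∈-map⁺; ∈-map⁻; ∈-filter⁺; ∈-filter⁻; ∈-cartesianProductWith⁺; ∈-cartesianProductWith⁻)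
open import Data.List.Relation.Unary.All as All using (All; []; _∷_)
import Data.List.Relation.Unary.All.Properties as Allₚ
open import Data.List.Relation.Unary.Any as Any using (Any; here; there)
open import Data.List.Relation.Unary.AllPairs using ([]; _∷_)
open import Data.List.Relation.Unary.Unique.Propositional using (Unique)
import Data.List.Relation.Unary.Unique.Propositional.Properties as Uniq
open import Data.List.Relation.Binary.Permutation.Propositional using (_↭_; prep; swap; ↭-refl; ↭-sym; ↭-trans; ↭-reflexive)
import Data.List.Relation.Binary.Permutation.Propositional as Perm
open import Data.List.Relation.Binary.Permutation.Propositional.Properties using (↭-length; ↭-empty-inv; ↭-map-inv; shift; ++⁺; ++⁺ˡ; ++⁺ʳ; ++-comm; ++-commutativeMonoid; ∈-resp-↭; All-resp-↭; filter-↭)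
open import Data.List.Relation.Ternary.Interleaving.Propositional using (Interleaving; []; consˡ; consʳ; toPermutation)
open import Data.Product using (Σ; ∃; _×_; _,_; proj₁; proj₂)
open import Data.Sum using (_⊎_; inj₁; inj₂)
open import Data.Empty using (⊥-elim)
open import Relation.Nullary using (¬_; Dec; yes; no)
open import Relation.Nullary.Decidable as Dec using (_×-dec_; _⊎-dec_; _→-dec_; ¬?)
open import Relation.Unary using (Pred; Decidable)
open import Relation.Unary.Properties using (∁?)
open import Relation.Binary.PropositionalEquality using (_≡_; _≢_; refl; sym; trans; cong; cong₂; subst; module ≡-Reasoning)
open import Algebra.Bundles using (AbelianGroup)
open import Algebra.Structures using (IsAbelianGroup)
import Algebra.Solver.CommutativeMonoid as CMSolver

-- A rejection by a greedy pass says that `A·s` lies in one coset of the stabiliser, but not in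
-- which. In the first descent a second scan settles this. Modulo the stabiliser `K₁` of the first
-- sumset a rejected term has a single multiple, so it is represented by the pair {0, a₀s - a₀g₀},
-- with `g₀` in the largest class of rejected terms modulo `K₁`. That class supplies neutral
-- padding, and its size bounds every multiplicity, as shortening requires. This descent bounds the
-- exceptional terms only by |G| - |K|, which is weaker than |G/H| - 2. Once `K` is filled, exact
-- lengths can be restored afterwards, so a term may be skipped and 0 joins every set. A rejected
-- term then satisfies `A·s ⊆ β + M` for the fixed β, and each of the o terms outside that coset
-- enlarges the sumset by a whole coset of `M`. One coset is present at the start and one coset of
-- `H` is missed at the end, so (o + 2)|M| ≤ |H|. This is the origin of the constant 2.

module ++-Solver {X : Set} = CMSolver (++-commutativeMonoid {A = X})

-- Linear arithmetic: l ≤ r is a sum of hypotheses and c the remaining slack.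
linear : ∀ {l r x y} c → l ≤ r → x +ℕ r +ℕ c ≡ y +ℕ l → x ≤ y
linear {l} {r} {x} {y} c l≤r eq = ℕₚ.+-cancelʳ-≤ r x y (ℕₚ.≤-trans (ℕₚ.m≤m+n (x +ℕ r) c)
  (ℕₚ.≤-trans (ℕₚ.≤-reflexive eq) (ℕₚ.+-monoʳ-≤ y l≤r)))

infixr 4 _⊞_
_⊞_ : ∀ {a b c d} → a ≤ b → c ≤ d → a +ℕ c ≤ b +ℕ d
_⊞_ = ℕₚ.+-mono-≤

-- Sublists, permutations and multisets

module _ {X : Set} where

  length-mono-⊆ : {xs ys : List X} → Unique xs → (∀ {x} → x ∈ xs → x ∈ ys) → length xs ≤ length ys
  length-mono-⊆ {[]} _ _ = z≤n
  length-mono-⊆ {x ∷ xs} u@(_ ∷ uxs) sub with ∈-∃++ (sub (here refl))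
  ... | as , bs , refl = ℕₚ.≤-trans (s≤s (length-mono-⊆ uxs sub′))
      (ℕₚ.≤-reflexive (sym (↭-length (shift x as bs))))
    where
    sub′ : ∀ {y} → y ∈ xs → y ∈ as ++ bs
    sub′ y∈ with ∈-resp-↭ (shift x as bs) (sub (there y∈))
    ... | here refl = ⊥-elim (Uniq.Unique[x∷xs]⇒x∉xs u y∈)
    ... | there y∈′ = y∈′

  ⊑-refl : {S : List X} → S ⊑ S
  ⊑-refl {S} = [] , ↭-reflexive (List.++-identityʳ S)

  ⊑-reflexive : {S T : List X} → T ↭ S → T ⊑ S
  ⊑-reflexive {T = T} p = [] , ↭-trans (↭-reflexive (List.++-identityʳ T)) p

  ⊑-trans : {R S T : List X} → R ⊑ S → S ⊑ T → R ⊑ T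
  ⊑-trans {R} (U , p) (V , q) = U ++ V , ↭-trans (↭-reflexive (sym (List.++-assoc R U V))) (↭-trans (++⁺ʳ V p) q)

  ⊑-++ˡ : (S T : List X) → S ⊑ (S ++ T)
  ⊑-++ˡ S T = T , ↭-refl

  ⊑-++ʳ : (S T : List X) → T ⊑ (S ++ T)
  ⊑-++ʳ S T = S , ++-comm T S

  ⊑-++⁺ : {A B C D : List X} → A ⊑ B → C ⊑ D → (A ++ C) ⊑ (B ++ D)
  ⊑-++⁺ {A} {B} {C} {D} (U , p) (V , q) = U ++ V , ↭-trans
    (solve 4 (λ a u c v → (a ⊕ c) ⊕ (u ⊕ v) ⊜ (a ⊕ u) ⊕ (c ⊕ v)) ↭-refl A U C V) (++⁺ p q)
    where open ++-Solver

  ⊑-length : {S T : List X} → T ⊑ S → length T ≤ length S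
  ⊑-length {S} {T} (U , p) = ℕₚ.≤-trans (ℕₚ.m≤m+n (length T) (length U))
    (ℕₚ.≤-reflexive (trans (sym (List.length-++ T)) (↭-length p)))

  ⊑-∈ : {S T : List X} → T ⊑ S → ∀ {x} → x ∈ T → x ∈ S
  ⊑-∈ (U , p) x∈ = ∈-resp-↭ p (∈-++⁺ˡ x∈)

  take-⊑ : ∀ m (S : List X) → take m S ⊑ S
  take-⊑ m S = drop m S , ↭-reflexive (List.take++drop≡id m S)

  length-split : {A B C : List X} → (A ++ B) ↭ C → length A +ℕ length B ≡ length C
  length-split {A} p = trans (sym (List.length-++ A)) (↭-length p)

  length-take-≤ : ∀ {m} (S : List X) → m ≤ length S → length (take m S) ≡ m
  length-take-≤ {m} S m≤ = trans (List.length-take m S) (ℕₚ.m≤n⇒m⊓n≡m m≤)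

  interleave-++ : (T U : List X) → Interleaving T U (T ++ U)
  interleave-++ [] [] = []
  interleave-++ [] (x ∷ U) = consʳ (interleave-++ [] U)
  interleave-++ (x ∷ T) U = consˡ (interleave-++ T U)

  -- A subsequence in the sense of `⊑` is given by a permutation, which offers nothing to recurse
  -- on. An interleaving follows the order of the ambient list, and this lemma transports one along
  -- the permutation.
  interleave-resp-↭ : {T U S S′ : List X} → S ↭ S′ → Interleaving T U S →
    ∃ λ T′ → ∃ λ U′ → T ↭ T′ × U ↭ U′ × Interleaving T′ U′ S′
  interleave-resp-↭ Perm.refl i = _ , _ , ↭-refl , ↭-refl , i
  interleave-resp-↭ (prep x p) (consˡ i) with interleave-resp-↭ p i
  ... | _ , _ , t , u , j = _ , _ , prep x t , u , consˡ j
  interleave-resp-↭ (prep x p) (consʳ i) with interleave-resp-↭ p i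
  ... | _ , _ , t , u , j = _ , _ , t , prep x u , consʳ j
  interleave-resp-↭ (swap x y p) (consˡ (consˡ i)) with interleave-resp-↭ p i
  ... | _ , _ , t , u , j = _ , _ , swap x y t , u , consˡ (consˡ j)
  interleave-resp-↭ (swap x y p) (consˡ (consʳ i)) with interleave-resp-↭ p i
  ... | _ , _ , t , u , j = _ , _ , prep x t , prep y u , consʳ (consˡ j)
  interleave-resp-↭ (swap x y p) (consʳ (consˡ i)) with interleave-resp-↭ p i
  ... | _ , _ , t , u , j = _ , _ , prep y t , prep x u , consˡ (consʳ j)
  interleave-resp-↭ (swap x y p) (consʳ (consʳ i)) with interleave-resp-↭ p i
  ... | _ , _ , t , u , j = _ , _ , t , swap x y u , consʳ (consʳ j)
  interleave-resp-↭ (Perm.trans p q) i with interleave-resp-↭ p i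
  ... | _ , _ , t , u , j with interleave-resp-↭ q j
  ... | _ , _ , t′ , u′ , k = _ , _ , ↭-trans t t′ , ↭-trans u u′ , k

  ⊑⇒interleaving : {T S : List X} → T ⊑ S → ∃ λ T′ → ∃ λ U → T ↭ T′ × Interleaving T′ U S
  ⊑⇒interleaving {T} (U , p) with interleave-resp-↭ p (interleave-++ T U)
  ... | T′ , U′ , t , _ , i = T′ , U′ , t , i

  interleaving⇒⊑ : {T U S : List X} → Interleaving T U S → T ⊑ S
  interleaving⇒⊑ i = _ , ↭-sym (toPermutation i)

  ⊑-++-split : (A : List X) {B T : List X} → T ⊑ (A ++ B) →
    ∃ λ T₁ → ∃ λ T₂ → T ↭ T₁ ++ T₂ × T₁ ⊑ A × T₂ ⊑ B
  ⊑-++-split A {B} T⊑ with ⊑⇒interleaving T⊑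
  ... | T′ , U , t , i with go A i
    where
    go : ∀ A {T U} → Interleaving T U (A ++ B) → ∃ λ T₁ → ∃ λ T₂ → T ≡ T₁ ++ T₂ × T₁ ⊑ A × T₂ ⊑ B
    go [] i = [] , _ , refl , ⊑-refl , interleaving⇒⊑ i
    go (a ∷ A) (consˡ i) with go A i
    ... | T₁ , T₂ , e , (V , p) , s₂ = a ∷ T₁ , T₂ , cong (a ∷_) e , (V , prep a p) , s₂
    go (a ∷ A) (consʳ i) with go A i
    ... | T₁ , T₂ , e , (V , p) , s₂ = T₁ , T₂ , e , (a ∷ V , ↭-trans (shift a T₁ V) (prep a p)) , s₂
  ... | T₁ , T₂ , e , s₁ , s₂ = T₁ , T₂ , ↭-trans t (↭-reflexive e) , s₁ , s₂

  filter-∁-↭ : {P : Pred X 0ℓ} (P? : Decidable P) (S : List X) → (filter P? S ++ filter (∁? P?) S) ↭ S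
  filter-∁-↭ P? [] = ↭-refl
  filter-∁-↭ P? (x ∷ S) with P? x
  ... | yes _ = prep x (filter-∁-↭ P? S)
  ... | no _ = ↭-trans (shift x (filter P? S) (filter (∁? P?) S)) (prep x (filter-∁-↭ P? S))

  length-filter-mono : {P Q : Pred X 0ℓ} (P? : Decidable P) (Q? : Decidable Q) → (∀ {x} → P x → Q x) →
    ∀ S → length (filter P? S) ≤ length (filter Q? S)
  length-filter-mono P? Q? f [] = z≤n
  length-filter-mono P? Q? f (x ∷ S) with P? x | Q? x
  ... | yes _ | yes _ = s≤s (length-filter-mono P? Q? f S)
  ... | yes p | no ¬q = ⊥-elim (¬q (f p))
  ... | no _ | yes _ = ℕₚ.m≤n⇒m≤1+n (length-filter-mono P? Q? f S)
  ... | no _ | no _ = length-filter-mono P? Q? f S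

  opaque
    argmax : (f : X → ℕ) {xs : List X} → 1 ≤ length xs → ∃ λ m → m ∈ xs × (∀ {y} → y ∈ xs → f y ≤ f m)
    argmax f {x ∷ []} _ = x , here refl , λ { (here refl) → ℕₚ.≤-refl }
    argmax f {x ∷ xs@(_ ∷ _)} _ with argmax f {xs} (s≤s z≤n)
    ... | m , m∈ , max with f x ℕₚ.≤? f m
    ... | yes le = m , there m∈ , λ { (here refl) → le ; (there y∈) → max y∈ }
    ... | no nle = x , here refl , λ { (here refl) → ℕₚ.≤-refl ; (there y∈) → ℕₚ.≤-trans (max y∈) (ℕₚ.≰⇒≥ nle) }

  map-++⁻ : {Y : Set} (f : X → Y) (T : List Y) {U : List Y} (V : List X) → T ++ U ≡ map f V →
    ∃ λ T′ → ∃ λ U′ → T ≡ map f T′ × T′ ++ U′ ≡ V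
  map-++⁻ f [] V e = [] , V , refl , refl
  map-++⁻ f (t ∷ T) (v ∷ V) e with List.∷-injective e
  ... | t≡ , e′ with map-++⁻ f T V e′
  ... | T′ , U′ , e₁ , e₂ = v ∷ T′ , U′ , cong₂ _∷_ t≡ e₁ , cong (v ∷_) e₂

  ⊑-map⁻ : {Y : Set} (f : X → Y) {S : List X} {T : List Y} → T ⊑ map f S →
    ∃ λ T′ → T ≡ map f T′ × T′ ⊑ S
  ⊑-map⁻ f {S} {T} (U , p) with ↭-map-inv f (↭-sym p)
  ... | V , e , q with map-++⁻ f T V e
  ... | T′ , U′ , e₁ , e₂ = T′ , e₁ , U′ , ↭-sym (↭-trans q (↭-reflexive (sym e₂)))

  ∈⇒length : {x : X} {xs : List X} → x ∈ xs → 1 ≤ length xs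
  ∈⇒length {xs = _ ∷ _} _ = s≤s z≤n

  length⇒∈ : {xs : List X} → 1 ≤ length xs → ∃ λ x → x ∈ xs
  length⇒∈ {x ∷ _} _ = x , here refl

  ∈-∃↭ : {x : X} {xs : List X} → x ∈ xs → ∃ λ ys → (x ∷ ys) ↭ xs
  ∈-∃↭ {xs = _ ∷ xs} (here refl) = xs , ↭-refl
  ∈-∃↭ {x} {y ∷ xs} (there x∈) with ∈-∃↭ x∈
  ... | ys , p = y ∷ ys , ↭-trans (swap x y ↭-refl) (prep y p)

-- Arithmetic in the group

module Proof (𝔾 : FinAbGroup) where

  open FAG 𝔾 renaming (_+_ to infixl 6 _+_; -_ to infix 8 -_; _-_ to infixl 6 _-_) public
  open IsAbelianGroup isAbelianGroup public using (assoc; comm; identityˡ; identityʳ; inverseˡ; inverseʳ)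

  abelianGroup : AbelianGroup 0ℓ 0ℓ
  abelianGroup = record { isAbelianGroup = isAbelianGroup }

  open import Algebra.Properties.AbelianGroup abelianGroup using (∙-cancelʳ)
  import Algebra.Properties.CommutativeSemigroup (AbelianGroup.commutativeSemigroup abelianGroup) as CS

  -- Decision procedure for abelian groups: an expression e is represented by the vectors of its
  -- positive and negative coefficients, so that ⟦ e ⟧ + neg e = pos e.

  data Expr (n : ℕ) : Set where
    var : Fin n → Expr n
    𝟘   : Expr n
    _⊕_ : Expr n → Expr n → Expr n
    ⊖_  : Expr n → Expr n

  infixl 6 _⊕_ _⊝_
  infix 8 ⊖_

  _⊝_ : ∀ {n} → Expr n → Expr n → Expr n
  e ⊝ f = e ⊕ (⊖ f)

  ⟦_⟧ : ∀ {n} → Expr n → Vec Carrier n → Carrier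
  ⟦ var i ⟧ ρ = lookup ρ i
  ⟦ 𝟘 ⟧ ρ = ε
  ⟦ e ⊕ f ⟧ ρ = ⟦ e ⟧ ρ + ⟦ f ⟧ ρ
  ⟦ ⊖ e ⟧ ρ = - ⟦ e ⟧ ρ

  ×ℕ-homo-+ : ∀ m n x → (m +ℕ n) ×ℕ x ≡ m ×ℕ x + n ×ℕ x
  ×ℕ-homo-+ zero n x = sym (identityˡ _)
  ×ℕ-homo-+ (suc m) n x = trans (cong (x +_) (×ℕ-homo-+ m n x)) (sym (assoc _ _ _))

  ⟦_⟧ᵛ : ∀ {n} → Vec ℕ n → Vec Carrier n → Carrier
  ⟦ [] ⟧ᵛ [] = ε
  ⟦ k ∷ v ⟧ᵛ (x ∷ ρ) = k ×ℕ x + ⟦ v ⟧ᵛ ρ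

  ⟦⟧ᵛ-+ : ∀ {n} (u v : Vec ℕ n) ρ → ⟦ zipWith _+ℕ_ u v ⟧ᵛ ρ ≡ ⟦ u ⟧ᵛ ρ + ⟦ v ⟧ᵛ ρ
  ⟦⟧ᵛ-+ [] [] [] = sym (identityˡ ε)
  ⟦⟧ᵛ-+ (k ∷ u) (l ∷ v) (x ∷ ρ) = trans (cong₂ _+_ (×ℕ-homo-+ k l x) (⟦⟧ᵛ-+ u v ρ)) (CS.interchange _ _ _ _)

  ⟦⟧ᵛ-0 : ∀ {n} (ρ : Vec Carrier n) → ⟦ replicate n 0 ⟧ᵛ ρ ≡ ε
  ⟦⟧ᵛ-0 [] = refl
  ⟦⟧ᵛ-0 (x ∷ ρ) = trans (identityˡ _) (⟦⟧ᵛ-0 ρ)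

  unit : ∀ {n} → Fin n → Vec ℕ n
  unit Fin.zero = 1 ∷ replicate _ 0
  unit (Fin.suc i) = 0 ∷ unit i

  ⟦⟧ᵛ-unit : ∀ {n} (i : Fin n) ρ → ⟦ unit i ⟧ᵛ ρ ≡ lookup ρ i
  ⟦⟧ᵛ-unit Fin.zero (x ∷ ρ) = trans (cong₂ _+_ (identityʳ x) (⟦⟧ᵛ-0 ρ)) (identityʳ x)
  ⟦⟧ᵛ-unit (Fin.suc i) (x ∷ ρ) = trans (identityˡ _) (⟦⟧ᵛ-unit i ρ)

  pos neg : ∀ {n} → Expr n → Vec ℕ n
  pos (var i) = unit i
  pos 𝟘 = replicate _ 0
  pos (e ⊕ f) = zipWith _+ℕ_ (pos e) (pos f)
  pos (⊖ e) = neg e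
  neg (var i) = replicate _ 0
  neg 𝟘 = replicate _ 0
  neg (e ⊕ f) = zipWith _+ℕ_ (neg e) (neg f)
  neg (⊖ e) = pos e

  ⟦⟧-pos-neg : ∀ {n} (e : Expr n) ρ → ⟦ e ⟧ ρ + ⟦ neg e ⟧ᵛ ρ ≡ ⟦ pos e ⟧ᵛ ρ
  ⟦⟧-pos-neg (var i) ρ = trans (cong (lookup ρ i +_) (⟦⟧ᵛ-0 ρ)) (trans (identityʳ _) (sym (⟦⟧ᵛ-unit i ρ)))
  ⟦⟧-pos-neg 𝟘 ρ = identityˡ _
  ⟦⟧-pos-neg (e ⊕ f) ρ = begin
    ⟦ e ⟧ ρ + ⟦ f ⟧ ρ + ⟦ neg (e ⊕ f) ⟧ᵛ ρ                       ≡⟨ cong (⟦ e ⟧ ρ + ⟦ f ⟧ ρ +_) (⟦⟧ᵛ-+ (neg e) (neg f) ρ) ⟩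
    ⟦ e ⟧ ρ + ⟦ f ⟧ ρ + (⟦ neg e ⟧ᵛ ρ + ⟦ neg f ⟧ᵛ ρ)            ≡⟨ CS.interchange _ _ _ _ ⟩
    (⟦ e ⟧ ρ + ⟦ neg e ⟧ᵛ ρ) + (⟦ f ⟧ ρ + ⟦ neg f ⟧ᵛ ρ)          ≡⟨ cong₂ _+_ (⟦⟧-pos-neg e ρ) (⟦⟧-pos-neg f ρ) ⟩
    ⟦ pos e ⟧ᵛ ρ + ⟦ pos f ⟧ᵛ ρ                                  ≡⟨ sym (⟦⟧ᵛ-+ (pos e) (pos f) ρ) ⟩
    ⟦ pos (e ⊕ f) ⟧ᵛ ρ                                           ∎
    where open ≡-Reasoning
  ⟦⟧-pos-neg (⊖ e) ρ = begin
    - ⟦ e ⟧ ρ + ⟦ pos e ⟧ᵛ ρ                       ≡⟨ cong (- ⟦ e ⟧ ρ +_) (sym (⟦⟧-pos-neg e ρ)) ⟩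
    - ⟦ e ⟧ ρ + (⟦ e ⟧ ρ + ⟦ neg e ⟧ᵛ ρ)           ≡⟨ sym (assoc _ _ _) ⟩
    (- ⟦ e ⟧ ρ + ⟦ e ⟧ ρ) + ⟦ neg e ⟧ᵛ ρ           ≡⟨ cong (_+ ⟦ neg e ⟧ᵛ ρ) (inverseˡ _) ⟩
    ε + ⟦ neg e ⟧ᵛ ρ                               ≡⟨ identityˡ _ ⟩
    ⟦ neg e ⟧ᵛ ρ                                   ∎
    where open ≡-Reasoning

  infix 4 _≐_
  _≐_ : ∀ {n} → Expr n → Expr n → Expr n × Expr n
  _≐_ = _,_

  -- Comparing `pos e + neg f` with `pos f + neg e` tests equality in the free abelian group without
  -- any cancellation. For a concrete identity both vectors are closed, so the side condition is
  -- `refl`.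
  abel : ∀ {n} (eq : N-ary n (Expr n) (Expr n × Expr n)) (ρ : Vec Carrier n) →
    let (e , f) = eq $ⁿ Vec.map var (allFin n) in
    zipWith _+ℕ_ (pos e) (neg f) ≡ zipWith _+ℕ_ (pos f) (neg e) → ⟦ e ⟧ ρ ≡ ⟦ f ⟧ ρ
  abel {n} eq ρ same = ∙-cancelʳ (⟦ neg e ⟧ᵛ ρ + ⟦ neg f ⟧ᵛ ρ) _ _ (begin
    ⟦ e ⟧ ρ + (⟦ neg e ⟧ᵛ ρ + ⟦ neg f ⟧ᵛ ρ)   ≡⟨ move e f ⟩
    ⟦ zipWith _+ℕ_ (pos e) (neg f) ⟧ᵛ ρ       ≡⟨ cong (λ v → ⟦ v ⟧ᵛ ρ) same ⟩
    ⟦ zipWith _+ℕ_ (pos f) (neg e) ⟧ᵛ ρ       ≡⟨ sym (move f e) ⟩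
    ⟦ f ⟧ ρ + (⟦ neg f ⟧ᵛ ρ + ⟦ neg e ⟧ᵛ ρ)   ≡⟨ cong (⟦ f ⟧ ρ +_) (comm _ _) ⟩
    ⟦ f ⟧ ρ + (⟦ neg e ⟧ᵛ ρ + ⟦ neg f ⟧ᵛ ρ)   ∎)
    where
    open ≡-Reasoning
    e = proj₁ (eq $ⁿ Vec.map var (allFin n))
    f = proj₂ (eq $ⁿ Vec.map var (allFin n))
    move : ∀ e f → ⟦ e ⟧ ρ + (⟦ neg e ⟧ᵛ ρ + ⟦ neg f ⟧ᵛ ρ) ≡ ⟦ zipWith _+ℕ_ (pos e) (neg f) ⟧ᵛ ρ
    move e f = trans (sym (assoc _ _ _)) (trans (cong (_+ ⟦ neg f ⟧ᵛ ρ) (⟦⟧-pos-neg e ρ)) (sym (⟦⟧ᵛ-+ (pos e) (neg f) ρ)))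

  -- Finite subsets, their sizes and stabilisers

  mem-resp : (H : Subgroup) {x y : Carrier} → x ≡ y → mem H x → mem H y
  mem-resp H refl m = m

  mem-- : (H : Subgroup) {x y : Carrier} → mem H x → mem H y → mem H (x - y)
  mem-- H p q = +-closed H p (⁻¹-closed H q)

  _≟_ : (x y : Carrier) → Dec (x ≡ y)
  x ≟ y = go unique (complete x) (complete y)
    where
    go : ∀ {xs} → Unique xs → x ∈ xs → y ∈ xs → Dec (x ≡ y)
    go _ (here refl) (here refl) = yes refl
    go (n ∷ _) (here refl) (there q) = no λ { refl → All.lookup n q refl }
    go (n ∷ _) (there p) (here refl) = no λ { refl → All.lookup n p refl }
    go (_ ∷ u) (there p) (there q) = go u p q

  record FinSet : Set₁ where
    field
      holds  : Pred Carrier 0ℓ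
      holds? : Decidable holds
  open FinSet

  infix 4 _∈ₛ_ _⊆ₛ_
  _∈ₛ_ : Carrier → FinSet → Set
  x ∈ₛ Y = holds Y x

  _⊆ₛ_ : FinSet → FinSet → Set
  X ⊆ₛ Y = ∀ {x} → x ∈ₛ X → x ∈ₛ Y

  elements : FinSet → List Carrier
  elements Y = filter (holds? Y) elems

  size : FinSet → ℕ
  size Y = length (elements Y)

  ⟪_⟫ : Subgroup → FinSet
  ⟪ H ⟫ = record { holds = mem H ; holds? = dec H }

  ⟨ε⟩ : FinSet
  ⟨ε⟩ = record { holds = _≡ ε ; holds? = _≟ ε }

  elements-unique : ∀ Y → Unique (elements Y)
  elements-unique Y = Uniq.filter⁺ (holds? Y) unique

  ∈-elements : ∀ Y {x} → x ∈ₛ Y → x ∈ elements Y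
  ∈-elements Y = ∈-filter⁺ (holds? Y) (complete _)

  elements-∈ : ∀ Y {x} → x ∈ elements Y → x ∈ₛ Y
  elements-∈ Y x∈ = proj₂ (∈-filter⁻ (holds? Y) {xs = elems} x∈)

  length≤size : ∀ {xs} Y → Unique xs → (∀ {x} → x ∈ xs → x ∈ₛ Y) → length xs ≤ size Y
  length≤size Y u sub = length-mono-⊆ u (λ x∈ → ∈-elements Y (sub x∈))

  size-mono : ∀ X Y → X ⊆ₛ Y → size X ≤ size Y
  size-mono X Y sub = length≤size Y (elements-unique X) (λ x∈ → sub (elements-∈ X x∈))

  size-extend : ∀ {xs} X Y → Unique xs → (∀ {x} → x ∈ xs → ¬ x ∈ₛ X) → (∀ {x} → x ∈ xs → x ∈ₛ Y) → X ⊆ₛ Y →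
    length xs +ℕ size X ≤ size Y
  size-extend {xs} X Y u out xs⊆ X⊆ = subst (_≤ size Y) (List.length-++ xs)
    (length≤size Y (Uniq.++⁺ u (elements-unique X) (λ (p , q) → out p (elements-∈ X q))) sub)
    where
    sub : ∀ {x} → x ∈ xs ++ elements X → x ∈ₛ Y
    sub x∈ with ∈-++⁻ xs x∈
    ... | inj₁ p = xs⊆ p
    ... | inj₂ q = X⊆ (elements-∈ X q)

  size-nonempty : ∀ Y {x} → x ∈ₛ Y → 1 ≤ size Y
  size-nonempty Y {x} x∈ = length≤size {x ∷ []} Y ([] ∷ []) λ { (here refl) → x∈ }

  size-full : ∀ X Y → X ⊆ₛ Y → size Y ≤ size X → Y ⊆ₛ X
  size-full X Y X⊆Y le {y} y∈ with holds? X y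
  ... | yes p = p
  ... | no ¬p = ⊥-elim (ℕₚ.<⇒≱ (size-extend {y ∷ []} X Y ([] ∷ []) (λ { (here refl) → ¬p }) (λ { (here refl) → y∈ }) X⊆Y) le)

  +-injectiveˡ : ∀ c {x y} → x + c ≡ y + c → x ≡ y
  +-injectiveˡ c = ∙-cancelʳ c _ _

  -- Periodicity puts the coset `y + M` inside `Y`, and outside `X` since `y` itself is outside.
  size-coset : ∀ (M : Subgroup) X Y → X ⊆ₛ Y → (∀ {x h} → mem M h → x ∈ₛ X → x + h ∈ₛ X) →
    (∀ {x h} → mem M h → x ∈ₛ Y → x + h ∈ₛ Y) → ∀ {y} → y ∈ₛ Y → ¬ y ∈ₛ X → card M +ℕ size X ≤ size Y
  size-coset M X Y X⊆Y perX perY {y} y∈Y y∉X =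
    subst (λ k → k +ℕ size X ≤ size Y) (List.length-map (_+ y) (elements ⟪ M ⟫))
      (size-extend {map (_+ y) (elements ⟪ M ⟫)} X Y (Uniq.map⁺ (+-injectiveˡ y) (elements-unique ⟪ M ⟫)) out ins X⊆Y)
    where
    ins : ∀ {x} → x ∈ map (_+ y) (elements ⟪ M ⟫) → x ∈ₛ Y
    ins x∈ with ∈-map⁻ (_+ y) x∈
    ... | h , h∈ , refl = subst (_∈ₛ Y) (comm y h) (perY (elements-∈ ⟪ M ⟫ h∈) y∈Y)
    out : ∀ {x} → x ∈ map (_+ y) (elements ⟪ M ⟫) → ¬ x ∈ₛ X
    out x∈ x∈X with ∈-map⁻ (_+ y) x∈
    ... | h , h∈ , refl = y∉X (subst (_∈ₛ X) (abel (λ y h → h ⊕ y ⊝ h ≐ y) (y ∷ h ∷ []) refl)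
            (perX (⁻¹-closed M (elements-∈ ⟪ M ⟫ h∈)) x∈X))

  -- Requiring both implications makes closure under negation immediate; with one of them it would
  -- need a counting argument.
  stab : FinSet → Subgroup
  stab Y = record
    { mem = λ h → ∀ x → (x ∈ₛ Y → x + h ∈ₛ Y) × (x + h ∈ₛ Y → x ∈ₛ Y)
    ; dec = λ h → Dec.map′ (λ a x → All.lookup a (complete x)) (λ f → All.tabulate λ {x} _ → f x)
        (All.all? (λ x → (holds? Y x →-dec holds? Y (x + h)) ×-dec (holds? Y (x + h) →-dec holds? Y x)) elems)
    ; ε∈ = λ x → subst (_∈ₛ Y) (sym (identityʳ x)) , subst (_∈ₛ Y) (identityʳ x)
    ; +-closed = λ {h} {k} p q x →
          (λ m → subst (_∈ₛ Y) (assoc x h k) (proj₁ (q (x + h)) (proj₁ (p x) m)))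
        , (λ m → proj₂ (p x) (proj₂ (q (x + h)) (subst (_∈ₛ Y) (sym (assoc x h k)) m)))
    ; ⁻¹-closed = λ {h} p x →
          (λ m → proj₂ (p (x - h)) (subst (_∈ₛ Y) (back x h) m))
        , (λ m → subst (_∈ₛ Y) (sym (back x h)) (proj₁ (p (x - h)) m))
    }
    where
    back : ∀ x h → x ≡ x - h + h
    back x h = abel (λ x h → x ≐ x ⊝ h ⊕ h) (x ∷ h ∷ []) refl

  stab-+ : ∀ Y {h x} → mem (stab Y) h → x ∈ₛ Y → x + h ∈ₛ Y
  stab-+ Y p = proj₁ (p _)

  stab≤ : ∀ Y (H : Subgroup) {y} → y ∈ₛ Y → Y ⊆ₛ ⟪ H ⟫ → stab Y ≤G H
  stab≤ Y H {y} y∈ Y⊆H {h} p = mem-resp H (abel (λ y h → y ⊕ h ⊝ y ≐ h) (y ∷ h ∷ []) refl)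
    (mem-- H (Y⊆H (stab-+ Y p y∈)) (Y⊆H y∈))

  _⊕ₛ_ : FinSet → List Carrier → FinSet
  Y ⊕ₛ B = record { holds = λ z → Any (λ b → z - b ∈ₛ Y) B ; holds? = λ z → Any.any? (λ b → holds? Y (z - b)) B }

  ⊕ₛ-intro : ∀ Y {B y b} → b ∈ B → y ∈ₛ Y → y + b ∈ₛ Y ⊕ₛ B
  ⊕ₛ-intro Y {y = y} {b} b∈ y∈ =
    Any.map (λ { refl → subst (_∈ₛ Y) (abel (λ y b → y ≐ y ⊕ b ⊝ b) (y ∷ b ∷ []) refl) y∈ }) b∈

  ⊕ₛ-elim : ∀ Y {B z} → z ∈ₛ Y ⊕ₛ B → ∃ λ b → b ∈ B × z - b ∈ₛ Y
  ⊕ₛ-elim Y {b ∷ _} (here p) = b , here refl , p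
  ⊕ₛ-elim Y (there q) with ⊕ₛ-elim Y q
  ... | b , b∈ , p = b , there b∈ , p

  stab-⊕ₛ : ∀ Y B → stab Y ≤G stab (Y ⊕ₛ B)
  stab-⊕ₛ Y B {h} p x =
      Any.map (λ {b} m → subst (_∈ₛ Y) (eq b) (stab-+ Y p m))
    , Any.map (λ {b} m → proj₂ (p (x - b)) (subst (_∈ₛ Y) (sym (eq b)) m))
    where
    eq : ∀ b → x - b + h ≡ x + h - b
    eq b = abel (λ x b h → x ⊝ b ⊕ h ≐ x ⊕ h ⊝ b) (x ∷ b ∷ h ∷ []) refl

  translate : FinSet → Carrier → FinSet
  translate Y c = record { holds = λ z → z - c ∈ₛ Y ; holds? = λ z → holds? Y (z - c) }

  translate-∈ : ∀ Y c {y} → y ∈ₛ Y → y + c ∈ₛ translate Y c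
  translate-∈ Y c {y} = subst (_∈ₛ Y) (abel (λ y c → y ≐ y ⊕ c ⊝ c) (y ∷ c ∷ []) refl)

  size-translate : ∀ Y c → size Y ≤ size (translate Y c)
  size-translate Y c = subst (_≤ size (translate Y c)) (List.length-map (_+ c) (elements Y))
    (length≤size (translate Y c) (Uniq.map⁺ (+-injectiveˡ c) (elements-unique Y)) ins)
    where
    ins : ∀ {x} → x ∈ map (_+ c) (elements Y) → x ∈ₛ translate Y c
    ins x∈ with ∈-map⁻ (_+ c) x∈
    ... | y , y∈ , refl = translate-∈ Y c (elements-∈ Y y∈)

  translate⊆⊕ₛ : ∀ Y {B b} → b ∈ B → translate Y b ⊆ₛ Y ⊕ₛ B
  translate⊆⊕ₛ Y b∈ m = Any.map (λ { refl → m }) b∈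

  -- Each translate of `Y` by an element of `B` lies in `Y ⊕ₛ B` and already has |Y| elements, so
  -- all these translates are equal to `Y ⊕ₛ B` and to each other.
  ⊕ₛ-stationary : ∀ Y B → size (Y ⊕ₛ B) ≤ size Y → ∀ {b b′} → b ∈ B → b′ ∈ B → mem (stab Y) (b - b′)
  ⊕ₛ-stationary Y B le {b} {b′} b∈ b′∈ x =
      move b∈ b′∈
    , (λ m → subst (_∈ₛ Y) (abel (λ x b b′ → x ⊕ (b ⊝ b′) ⊕ (b′ ⊝ b) ≐ x) (x ∷ b ∷ b′ ∷ []) refl) (move b′∈ b∈ m))
    where
    move : ∀ {b b′ x} → b ∈ B → b′ ∈ B → x ∈ₛ Y → x + (b - b′) ∈ₛ Y
    move {b} {b′} {x} b∈ b′∈ m = subst (_∈ₛ Y) (assoc x b (- b′))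
      (size-full (translate Y b′) (Y ⊕ₛ B) (translate⊆⊕ₛ Y b′∈) (ℕₚ.≤-trans le (size-translate Y b′)) (⊕ₛ-intro Y b∈ m))

  -- Selections and greedy sumsets

  -- The family `B` is left open because several are needed: centred weighted multiples, the same
  -- with 0 adjoined, the pairs {0, ψ t}, and the singletons {ψ t}.
  data Sel (B : Carrier → List Carrier) : List Carrier → Carrier → Set where
    []  : Sel B [] ε
    _∷_ : ∀ {b t T x} → b ∈ B t → Sel B T x → Sel B (t ∷ T) (b + x)

  Sel-resp-≡ : ∀ {B T x y} → x ≡ y → Sel B T x → Sel B T y
  Sel-resp-≡ refl s = s

  Sel-↭ : ∀ {B T T′ x} → T ↭ T′ → Sel B T x → Sel B T′ x
  Sel-↭ Perm.refl s = s
  Sel-↭ (prep _ p) (b ∷ s) = b ∷ Sel-↭ p s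
  Sel-↭ (swap _ _ p) (_∷_ {b = b} b∈ (_∷_ {b = c} {x = x} c∈ s)) =
    Sel-resp-≡ (abel (λ b c x → c ⊕ (b ⊕ x) ≐ b ⊕ (c ⊕ x)) (b ∷ c ∷ x ∷ []) refl) (c∈ ∷ (b∈ ∷ Sel-↭ p s))
  Sel-↭ (Perm.trans p q) s = Sel-↭ q (Sel-↭ p s)

  Sel-++ : ∀ {B T U x y} → Sel B T x → Sel B U y → Sel B (T ++ U) (x + y)
  Sel-++ [] s = Sel-resp-≡ (sym (identityˡ _)) s
  Sel-++ (b ∷ r) s = Sel-resp-≡ (sym (assoc _ _ _)) (b ∷ Sel-++ r s)

  Sel-++⁻ : ∀ {B} T {U z} → Sel B (T ++ U) z → ∃ λ x → ∃ λ y → Sel B T x × Sel B U y × z ≡ x + y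
  Sel-++⁻ [] s = ε , _ , [] , s , sym (identityˡ _)
  Sel-++⁻ (t ∷ T) (b ∷ s) with Sel-++⁻ T s
  ... | x , y , r , r′ , refl = _ , y , b ∷ r , r′ , sym (assoc _ _ _)

  Sel-mem : (H : Subgroup) → ∀ {B T x} → (∀ {t b} → t ∈ T → b ∈ B t → mem H b) → Sel B T x → mem H x
  Sel-mem H f [] = ε∈ H
  Sel-mem H f (b ∷ s) = +-closed H (f (here refl) b) (Sel-mem H (λ t∈ → f (there t∈)) s)

  -- Choosing the adjoined ε means leaving the term out, so optional terms become a genuine
  -- subsequence.
  Sel-ε∷⁻ : ∀ {B T x} → Sel (λ t → ε ∷ B t) T x → ∃ λ U → ∃ λ C → (U ++ C) ↭ T × Sel B U x
  Sel-ε∷⁻ [] = [] , [] , ↭-refl , []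
  Sel-ε∷⁻ (_∷_ {t = t} (here refl) s) with Sel-ε∷⁻ s
  ... | U , C , p , r = U , t ∷ C , ↭-trans (shift t U C) (prep t p) , Sel-resp-≡ (sym (identityˡ _)) r
  Sel-ε∷⁻ (_∷_ {t = t} (there b) s) with Sel-ε∷⁻ s
  ... | U , C , p , r = t ∷ U , C , prep t p , b ∷ r

  module _ (B : Carrier → List Carrier) where

    sumset : FinSet → List Carrier → FinSet
    sumset Y [] = Y
    sumset Y (t ∷ T) = sumset (Y ⊕ₛ B t) T

    sumset-intro : ∀ Y T {y x} → y ∈ₛ Y → Sel B T x → y + x ∈ₛ sumset Y T
    sumset-intro Y [] y∈ [] = subst (_∈ₛ Y) (sym (identityʳ _)) y∈
    sumset-intro Y (t ∷ T) y∈ (b ∷ s) = subst (_∈ₛ sumset (Y ⊕ₛ B t) T) (assoc _ _ _)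
      (sumset-intro (Y ⊕ₛ B t) T (⊕ₛ-intro Y b y∈) s)

    sumset-elim : ∀ Y T {z} → z ∈ₛ sumset Y T → ∃ λ y → ∃ λ x → y ∈ₛ Y × Sel B T x × z ≡ y + x
    sumset-elim Y [] z∈ = _ , ε , z∈ , [] , sym (identityʳ _)
    sumset-elim Y (t ∷ T) z∈ with sumset-elim (Y ⊕ₛ B t) T z∈
    ... | y , x , y∈ , s , refl with ⊕ₛ-elim Y y∈
    ... | b , b∈ , m = y - b , b + x , m , b∈ ∷ s , abel (λ y x b → y ⊕ x ≐ y ⊝ b ⊕ (b ⊕ x)) (y ∷ x ∷ b ∷ []) refl

    stab-sumset : ∀ Y T → stab Y ≤G stab (sumset Y T)
    stab-sumset Y [] p = p
    stab-sumset Y (t ∷ T) p = stab-sumset (Y ⊕ₛ B t) T (λ x → stab-⊕ₛ Y (B t) p x)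

    sumset⊆ : (H : Subgroup) → ∀ Y T → Y ⊆ₛ ⟪ H ⟫ → (∀ {t b} → t ∈ T → b ∈ B t → mem H b) → sumset Y T ⊆ₛ ⟪ H ⟫
    sumset⊆ H Y T Y⊆ B⊆ z∈ with sumset-elim Y T z∈
    ... | y , x , y∈ , s , refl = +-closed H (Y⊆ y∈) (Sel-mem H B⊆ s)

    -- A greedy pass through L keeps in R the terms that enlarge the sumset; since stabilisers only
    -- grow along the way, each rejected term stays inside a coset of the final stabiliser.
    opaque
      scan : ∀ Y L → ∃ λ R → ∃ λ E → (R ++ E) ↭ L × length R +ℕ size Y ≤ size (sumset Y R)
        × (∀ {e b b′} → e ∈ E → b ∈ B e → b′ ∈ B e → mem (stab (sumset Y R)) (b - b′))
      scan Y [] = [] , [] , ↭-refl , ℕₚ.≤-refl , λ ()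
      scan Y (t ∷ L) with size (Y ⊕ₛ B t) ℕₚ.≤? size Y
      ... | yes le with scan Y L
      ... | R , E , p , le′ , st = R , t ∷ E , ↭-trans (shift t R E) (prep t p) , le′ , λ
          { (here refl) b b′ x → stab-sumset Y R (λ x → ⊕ₛ-stationary Y (B t) le b b′ x) x
          ; (there e) b b′ x → st e b b′ x }
      scan Y (t ∷ L) | no nle with scan (Y ⊕ₛ B t) L
      ... | R , E , p , le′ , st = t ∷ R , E , prep t p
          , ℕₚ.≤-trans (ℕₚ.≤-trans (ℕₚ.≤-reflexive (sym (ℕₚ.+-suc (length R) (size Y)))) (ℕₚ.+-monoʳ-≤ (length R) (ℕₚ.≰⇒> nle))) le′
          , λ e b b′ x → st e b b′ x

  -- The Kemperman-Scherk theorem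

  open import Data.List.Membership.DecPropositional _≟_ using (_∈?_)

  -- Kemperman–Scherk: if 0 ∈ Y ∩ B has only the trivial representation in Y + B, then
  -- |Y + B| ≥ |Y| + |B| − 1.  The Dyson transform Y ∪ (B + e), B ∩ (Y − e) preserves the hypothesis.
  scherk : ∀ n Y B → Unique B → length B ≤ n → ε ∈ₛ Y → ε ∈ B → (∀ {y} → y ∈ₛ Y → - y ∈ B → y ≡ ε) →
    size Y +ℕ length B ≤ suc (size (Y ⊕ₛ B))
  scherk zero Y [] _ _ _ () _
  scherk (suc n) Y B uB le ε∈Y ε∈B triv
    with Any.any? (λ e → Any.any? (λ b → ¬? (holds? Y (b + e))) B) (elements Y)
  -- Now `B + Y ⊆ Y`, so `Y + b = Y` for each `b ∈ B`. As 0 ∈ Y, also -b ∈ Y, and triviality gives b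
  -- = 0. Hence `B` has only one element.
  ... | no none = ℕₚ.≤-trans (ℕₚ.+-mono-≤ (ℕₚ.≤-trans (size-translate Y ε) (size-mono (translate Y ε) (Y ⊕ₛ B) (translate⊆⊕ₛ Y ε∈B)))
        (length-mono-⊆ {ys = ε ∷ []} uB λ b∈ → here (b≡ε b∈))) (ℕₚ.≤-reflexive (ℕₚ.+-comm _ 1))
    where
    closed : ∀ {b e} → b ∈ B → e ∈ₛ Y → b + e ∈ₛ Y
    closed {b} {e} b∈ e∈ with holds? Y (b + e)
    ... | yes p = p
    ... | no ¬p = ⊥-elim (none (Any.map (λ { refl → Any.map (λ { refl → ¬p }) b∈ }) (∈-elements Y e∈)))
    b≡ε : ∀ {b} → b ∈ B → b ≡ ε
    b≡ε {b} b∈ = trans (sym (abel (λ b → ⊖ (⊖ b) ≐ b) (b ∷ []) refl))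
      (trans (cong -_ (triv -b∈Y (subst (_∈ B) (abel (λ b → b ≐ ⊖ (⊖ b)) (b ∷ []) refl) b∈))) (abel (⊖ 𝟘 ≐ 𝟘) [] refl))
      where
      -b∈Y : - b ∈ₛ Y
      -b∈Y = subst (_∈ₛ Y) (identityˡ (- b)) (size-full (translate Y b) Y
        (λ {z} m → subst (_∈ₛ Y) (abel (λ b z → b ⊕ (z ⊝ b) ≐ z) (b ∷ z ∷ []) refl) (closed b∈ m)) (size-translate Y b) ε∈Y)
  ... | yes some with find some
  ... | e , e∈′ , bad = linear 0 (ih ⊞ sub ⊞ grow ⊞ ℕₚ.≤-reflexive (sym (length-split {A = filter P? B} (filter-∁-↭ P? B)))) (arith (size Y) (length B) (size (Y ⊕ₛ B)) (size (Y′ ⊕ₛ B′)) (size Y′) (length B′) (length B″))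
    where
    arith : ∀ y b s s′ y′ b′ b″ → y +ℕ b +ℕ (suc s′ +ℕ (s +ℕ (y′ +ℕ (b′ +ℕ b″)))) +ℕ 0
      ≡ suc s +ℕ (y′ +ℕ b′ +ℕ (s′ +ℕ (b″ +ℕ y +ℕ b)))
    arith = solve-∀
    e∈ : e ∈ₛ Y
    e∈ = elements-∈ Y e∈′
    P? : Decidable (λ b → b + e ∈ₛ Y)
    P? b = holds? Y (b + e)
    B′ B″ : List Carrier
    B′ = filter P? B
    B″ = filter (∁? P?) B
    Y′ : FinSet
    Y′ = record { holds = λ z → z ∈ₛ Y ⊎ z - e ∈ B ; holds? = λ z → holds? Y z ⊎-dec (z - e) ∈? B }
    cancel : ∀ b → b + e - e ≡ b
    cancel b = abel (λ b e → b ⊕ e ⊝ e ≐ b) (b ∷ e ∷ []) refl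
    grow : length B″ +ℕ size Y ≤ size Y′
    grow = subst (λ k → k +ℕ size Y ≤ size Y′) (List.length-map (_+ e) B″)
      (size-extend Y Y′ (Uniq.map⁺ (+-injectiveˡ e) (Uniq.filter⁺ (∁? P?) uB)) out ins inj₁)
      where
      out : ∀ {x} → x ∈ map (_+ e) B″ → ¬ x ∈ₛ Y
      out x∈ with ∈-map⁻ (_+ e) x∈
      ... | b , b∈ , refl = proj₂ (∈-filter⁻ (∁? P?) {xs = B} b∈)
      ins : ∀ {x} → x ∈ map (_+ e) B″ → x ∈ₛ Y′
      ins x∈ with ∈-map⁻ (_+ e) x∈
      ... | b , b∈ , refl = inj₂ (subst (_∈ B) (sym (cancel b)) (proj₁ (∈-filter⁻ (∁? P?) {xs = B} b∈)))
    sub : size (Y′ ⊕ₛ B′) ≤ size (Y ⊕ₛ B)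
    sub = size-mono (Y′ ⊕ₛ B′) (Y ⊕ₛ B) λ {z} z∈ → go (⊕ₛ-elim Y′ z∈)
      where
      go : ∀ {z} → (∃ λ b → b ∈ B′ × z - b ∈ₛ Y′) → z ∈ₛ Y ⊕ₛ B
      go {z} (b , b∈ , inj₁ m) = translate⊆⊕ₛ Y (proj₁ (∈-filter⁻ P? {xs = B} b∈)) m
      go {z} (b , b∈ , inj₂ m) = subst (_∈ₛ Y ⊕ₛ B) (abel (λ z b e → b ⊕ e ⊕ (z ⊝ b ⊝ e) ≐ z) (z ∷ b ∷ e ∷ []) refl)
        (⊕ₛ-intro Y m (proj₂ (∈-filter⁻ P? {xs = B} b∈)))
    ih : size Y′ +ℕ length B′ ≤ suc (size (Y′ ⊕ₛ B′))
    ih = scherk n Y′ B′ (Uniq.filter⁺ P? uB) (ℕₚ.≤-pred (ℕₚ.≤-trans (List.filter-notAll P? B bad) le)) (inj₁ ε∈Y)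
      (∈-filter⁺ P? ε∈B (subst (_∈ₛ Y) (sym (identityˡ e)) e∈)) triv′
      where
      triv′ : ∀ {y} → y ∈ₛ Y′ → - y ∈ B′ → y ≡ ε
      triv′ (inj₁ m) q = triv m (proj₁ (∈-filter⁻ P? {xs = B} q))
      -- Here -y + e ∈ Y, while its negative y - e lies in `B`. Triviality gives y = e; then e ∈ Y
      -- and -e ∈ B give e = 0.
      triv′ {y} (inj₂ m) q with ∈-filter⁻ P? {xs = B} q
      ... | -y∈B , -y+e∈Y = trans y≡e (triv e∈ (subst (λ u → - u ∈ B) y≡e -y∈B))
        where
        -y+e≡ε : - y + e ≡ ε
        -y+e≡ε = triv -y+e∈Y (subst (_∈ B) (abel (λ y e → y ⊝ e ≐ ⊖ (⊖ y ⊕ e)) (y ∷ e ∷ []) refl) m)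
        y≡e : y ≡ e
        y≡e = trans (abel (λ y e → y ≐ e ⊝ (⊖ y ⊕ e)) (y ∷ e ∷ []) refl)
          (trans (cong (λ u → e - u) -y+e≡ε) (abel (λ e → e ⊝ 𝟘 ≐ e) (e ∷ []) refl))

  -- Short subsequences with sum in a given set

  module _ (ψ : Carrier → Carrier) where

    total : List Carrier → Carrier
    total [] = ε
    total (t ∷ T) = ψ t + total T

    total-++ : ∀ T U → total (T ++ U) ≡ total T + total U
    total-++ [] U = sym (identityˡ _)
    total-++ (t ∷ T) U = trans (cong (ψ t +_) (total-++ T U)) (sym (assoc _ _ _))

    total-↭ : ∀ {T U} → T ↭ U → total T ≡ total U
    total-↭ Perm.refl = refl
    total-↭ (prep t p) = cong (ψ t +_) (total-↭ p)
    total-↭ (swap s t p) = trans (cong (λ u → ψ s + (ψ t + u)) (total-↭ p))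
      (abel (λ s t u → s ⊕ (t ⊕ u) ≐ t ⊕ (s ⊕ u)) (ψ s ∷ ψ t ∷ _ ∷ []) refl)
    total-↭ (Perm.trans p q) = trans (total-↭ p) (total-↭ q)

    multiplicity : Carrier → List Carrier → ℕ
    multiplicity c U = length (filter (λ s → ψ s ≟ c) U)

    multiplicity-split : ∀ c A {B U} → (A ++ B) ↭ U → multiplicity c A +ℕ multiplicity c B ≡ multiplicity c U
    multiplicity-split c A {B} p = trans (sym (trans (cong length (List.filter-++ (λ s → ψ s ≟ c) A B)) (List.length-++ (filter (λ s → ψ s ≟ c) A))))
      (↭-length (filter-↭ (λ s → ψ s ≟ c) p))

    ∈⇒multiplicity : ∀ {c B} → c ∈ map ψ B → 1 ≤ multiplicity c B
    ∈⇒multiplicity {c} {B} c∈ with ∈-map⁻ ψ c∈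
    ... | b , b∈ , refl = ∈⇒length (∈-filter⁺ (λ s → ψ s ≟ c) b∈ refl)

    -- `B` takes one term for each value. Every value left over in `C` occurs in `B` too, so passing
    -- to `C` lowers each positive multiplicity by one.
    layer : ∀ U → ∃ λ B → ∃ λ C → (B ++ C) ↭ U × Unique (map ψ B) × (∀ {c} → 1 ≤ multiplicity c C → c ∈ map ψ B)
    layer [] = [] , [] , ↭-refl , [] , λ ()
    layer (x ∷ U) with layer U
    ... | B , C , p , u , f with ψ x ∈? map ψ B
    ... | yes x∈ = B , x ∷ C , ↭-trans (shift x B C) (prep x p) , u , f′
      where
      f′ : ∀ {c} → 1 ≤ multiplicity c (x ∷ C) → c ∈ map ψ B
      f′ {c} q with ψ x ≟ c
      ... | yes refl = x∈
      ... | no _ = f q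
    ... | no x∉ = x ∷ B , C , prep x p , Allₚ.¬Any⇒All¬ _ x∉ ∷ u , λ q → there (f q)

    -- Applying Scherk's theorem once per layer of distinct values.
    opaque
      short-representation : (H : Subgroup) → ∀ h Y U → ε ∈ₛ Y → Y ⊆ₛ ⟪ H ⟫ → (∀ {t} → t ∈ U → mem H (ψ t)) →
        (∀ c → multiplicity c U ≤ h) →
        (∃ λ T → ∃ λ C → (T ++ C) ↭ U × 1 ≤ length T × length T ≤ h × total T ∈ₛ Y) ⊎ size Y +ℕ length U ≤ card H
      short-representation H zero Y [] ε∈Y Y⊆ _ _ = inj₂ (ℕₚ.≤-trans (ℕₚ.≤-reflexive (ℕₚ.+-identityʳ _)) (size-mono Y ⟪ H ⟫ Y⊆))
      short-representation H zero Y (x ∷ U) ε∈Y Y⊆ U⊆ m =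
        ⊥-elim (ℕₚ.<⇒≱ (∈⇒multiplicity {ψ x} {x ∷ U} (here refl)) (m (ψ x)))
      short-representation H (suc h) Y U ε∈Y Y⊆ U⊆ m with layer U
      ... | B , C , p , u , f with Any.any? (λ b → holds? Y (ψ b)) B
      ... | yes hit with find hit
      ... | b , b∈ , q with ∈-∃↭ b∈
      ... | B′ , r = inj₁ (b ∷ [] , B′ ++ C , ↭-trans (++⁺ʳ C r) p , s≤s z≤n , s≤s z≤n , subst (_∈ₛ Y) (sym (identityʳ (ψ b))) q)
      short-representation H (suc h) Y U ε∈Y Y⊆ U⊆ m | B , C , p , u , f | no miss
        with short-representation H h Y₁ C ε∈₁ Y₁⊆ (λ t∈ → U⊆ (∈-resp-↭ p (∈-++⁺ʳ B t∈))) m₁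
        where
        N : List Carrier
        N = map (λ b → - ψ b) B
        -- A total landing in `Y₁` lands in `Y` either as it is or after adding one term of `B`.
        -- Each layer therefore lengthens `T` by at most one term.
        Y₁ : FinSet
        Y₁ = Y ⊕ₛ (ε ∷ N)
        ε∈₁ : ε ∈ₛ Y₁
        ε∈₁ = here (subst (_∈ₛ Y) (abel (𝟘 ≐ 𝟘 ⊝ 𝟘) [] refl) ε∈Y)
        N⊆ : ∀ {c} → c ∈ ε ∷ N → mem H c
        N⊆ (here refl) = ε∈ H
        N⊆ (there c∈) with ∈-map⁻ (λ b → - ψ b) c∈
        ... | b , b∈ , refl = ⁻¹-closed H (U⊆ (∈-resp-↭ p (∈-++⁺ˡ b∈)))
        Y₁⊆ : Y₁ ⊆ₛ ⟪ H ⟫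
        Y₁⊆ {z} z∈ with ⊕ₛ-elim Y z∈
        ... | c , c∈ , y∈ = mem-resp H (abel (λ z c → z ⊝ c ⊕ c ≐ z) (z ∷ c ∷ []) refl) (+-closed H (Y⊆ y∈) (N⊆ c∈))
        m₁ : ∀ c → multiplicity c C ≤ h
        m₁ c with multiplicity c C in eq
        ... | zero = z≤n
        ... | suc k = ℕₚ.≤-pred (ℕₚ.≤-trans (ℕₚ.+-monoˡ-≤ (suc k) (∈⇒multiplicity (f (subst (1 ≤_) (sym eq) (s≤s z≤n)))))
              (ℕₚ.≤-trans (ℕₚ.≤-reflexive (trans (cong (multiplicity c B +ℕ_) (sym eq)) (multiplicity-split c B p))) (m c)))
      ... | inj₁ (T , D , q , ne , sh , t∈) = inj₁ (back (⊕ₛ-elim Y t∈))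
        where
        back : (∃ λ c → c ∈ ε ∷ map (λ b → - ψ b) B × total T - c ∈ₛ Y) →
          ∃ λ T → ∃ λ C → (T ++ C) ↭ U × 1 ≤ length T × length T ≤ suc h × total T ∈ₛ Y
        back (_ , here refl , y∈) = T , D ++ B , ↭-trans (solve 3 (λ t d b → t ∙ (d ∙ b) ⊜ b ∙ (t ∙ d)) ↭-refl T D B) (↭-trans (++⁺ˡ B q) p)
            , ne , ℕₚ.m≤n⇒m≤1+n sh , subst (_∈ₛ Y) (abel (λ t → t ⊝ 𝟘 ≐ t) (total T ∷ []) refl) y∈
          where open ++-Solver renaming (_⊕_ to _∙_)
        back (_ , there c∈ , y∈) with ∈-map⁻ (λ b → - ψ b) c∈
        ... | b , b∈ , refl with ∈-∃↭ b∈
        ... | B′ , r = b ∷ T , D ++ B′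
            , ↭-trans (solve 4 (λ b t d b′ → (b ∙ t) ∙ (d ∙ b′) ⊜ (b ∙ b′) ∙ (t ∙ d)) ↭-refl (b ∷ []) T D B′)
                (↭-trans (++⁺ r q) p)
            , s≤s z≤n , s≤s sh , subst (_∈ₛ Y) (abel (λ t b → t ⊝ ⊖ b ≐ b ⊕ t) (total T ∷ ψ b ∷ []) refl) y∈
          where open ++-Solver renaming (_⊕_ to _∙_)
      -- Since no `ψ b` is in `Y`, 0 has only the trivial representation in `Y + ({0} ∪ −ψ(B))`, and
      -- this set has at least |Y| + |B| elements.
      ... | inj₂ le = inj₂ (linear 0 (le ⊞ grow ⊞ ℕₚ.≤-reflexive (sym (length-split {A = B} {C} p)))
          (arith (size Y) (length U) (card H) (length C) (size (Y ⊕ₛ (ε ∷ N))) (length B)))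
        where
        N : List Carrier
        N = map (λ b → - ψ b) B
        arith : ∀ y u k c s b → y +ℕ u +ℕ (k +ℕ (suc s +ℕ (b +ℕ c))) +ℕ 0 ≡ k +ℕ (s +ℕ c +ℕ (y +ℕ suc b +ℕ u))
        arith = solve-∀
        -‿inj : ∀ {x y} → - x ≡ - y → x ≡ y
        -‿inj {x} {y} e = trans (abel (λ x → x ≐ ⊖ (⊖ x)) (x ∷ []) refl) (trans (cong -_ e) (abel (λ y → ⊖ (⊖ y) ≐ y) (y ∷ []) refl))
        not-ε : ∀ {b} → b ∈ B → ψ b ≢ ε
        not-ε b∈ e = miss (Any.map (λ { refl → subst (_∈ₛ Y) (sym e) ε∈Y }) b∈)
        ε∉N : ¬ ε ∈ N
        ε∉N q with ∈-map⁻ (λ b → - ψ b) q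
        ... | b , b∈ , e = not-ε b∈ (-‿inj (trans (sym e) (abel (𝟘 ≐ ⊖ 𝟘) [] refl)))
        triv : ∀ {y} → y ∈ₛ Y → - y ∈ ε ∷ N → y ≡ ε
        triv y∈ (here e) = -‿inj (trans e (abel (𝟘 ≐ ⊖ 𝟘) [] refl))
        triv y∈ (there q) with ∈-map⁻ (λ b → - ψ b) q
        ... | b , b∈ , e = ⊥-elim (miss (Any.map (λ { refl → subst (_∈ₛ Y) (-‿inj e) y∈ }) b∈))
        grow : size Y +ℕ suc (length B) ≤ suc (size (Y ⊕ₛ (ε ∷ N)))
        grow = subst (λ k → size Y +ℕ suc k ≤ suc (size (Y ⊕ₛ (ε ∷ N)))) (List.length-map (λ b → - ψ b) B)
          (scherk (suc (length N)) Y (ε ∷ N) (Allₚ.¬Any⇒All¬ _ ε∉N ∷ subst Unique (sym (List.map-∘ B)) (Uniq.map⁺ -‿inj u)) ℕₚ.≤-refl ε∈Y (here refl) triv)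

  -- Integer multiples and gcds

  ×ℕ-distribˡ-- : ∀ k x y → k ×ℕ (x - y) ≡ k ×ℕ x - k ×ℕ y
  ×ℕ-distribˡ-- zero x y = abel (𝟘 ≐ 𝟘 ⊝ 𝟘) [] refl
  ×ℕ-distribˡ-- (suc k) x y = trans (cong (x - y +_) (×ℕ-distribˡ-- k x y))
    (abel (λ x y u v → x ⊝ y ⊕ (u ⊝ v) ≐ (x ⊕ u) ⊝ (y ⊕ v)) (x ∷ y ∷ k ×ℕ x ∷ k ×ℕ y ∷ []) refl)

  ·-distribˡ-- : ∀ a x y → a · (x - y) ≡ (a · x) - (a · y)
  ·-distribˡ-- (ℤ.+ k) x y = ×ℕ-distribˡ-- k x y
  ·-distribˡ-- -[1+ k ] x y = trans (cong -_ (×ℕ-distribˡ-- (suc k) x y))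
    (abel (λ u v → ⊖ (u ⊝ v) ≐ ⊖ u ⊝ ⊖ v) (suc k ×ℕ x ∷ suc k ×ℕ y ∷ []) refl)

  module _ (H : Subgroup) where

    mem-×ℕ : ∀ k {x} → mem H x → mem H (k ×ℕ x)
    mem-×ℕ zero p = ε∈ H
    mem-×ℕ (suc k) p = +-closed H p (mem-×ℕ k p)

    mem-* : ∀ k l {x} → mem H (l ×ℕ x) → mem H ((k *ℕ l) ×ℕ x)
    mem-* zero l p = ε∈ H
    mem-* (suc k) l {x} p = mem-resp H (sym (×ℕ-homo-+ l (k *ℕ l) x)) (+-closed H p (mem-* k l p))

    mem-difference : ∀ m k {x} → mem H ((m +ℕ k) ×ℕ x) → mem H (k ×ℕ x) → mem H (m ×ℕ x)
    mem-difference m k {x} p q = mem-resp H (trans (cong (_- k ×ℕ x) (×ℕ-homo-+ m k x))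
      (abel (λ u v → u ⊕ v ⊝ v ≐ u) (m ×ℕ x ∷ k ×ℕ x ∷ []) refl)) (mem-- H p q)

    mem-gcd : ∀ m n {x} → mem H (m ×ℕ x) → mem H (n ×ℕ x) → mem H (gcd m n ×ℕ x)
    mem-gcd m n {x} p q with Bézout.identity (gcd-GCD m n)
    ... | Bézout.+- u v eq = mem-difference (gcd m n) (v *ℕ n) (mem-resp H (cong (_×ℕ x) (sym eq)) (mem-* u m p)) (mem-* v n q)
    ... | Bézout.-+ u v eq = mem-difference (gcd m n) (u *ℕ m) (mem-resp H (cong (_×ℕ x) (sym eq)) (mem-* v n q)) (mem-* u m p)

    mem-∣∣ : ∀ a {x} → mem H (a · x) → mem H (∣ a ∣ ×ℕ x)
    mem-∣∣ (ℤ.+ k) p = p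
    mem-∣∣ -[1+ k ] {x} p = mem-resp H (abel (λ u → ⊖ (⊖ u) ≐ u) (suc k ×ℕ x ∷ []) refl) (⁻¹-closed H p)

    mem-gcdList : ∀ W {x} → (∀ a → a ∈ W → mem H (a · x)) → mem H (gcdList W ×ℕ x)
    mem-gcdList [] f = ε∈ H
    mem-gcdList (a ∷ W) f = mem-gcd ∣ a ∣ (gcdList W) (mem-∣∣ a (f a (here refl))) (mem-gcdList W (λ b b∈ → f b (there b∈)))

  -- Exhaustive search

  -- The negative case must return a sequence: comparing Davenport constants of a subgroup and a
  -- quotient concatenates two concrete zero-sum free sequences.
  counterexample : {P : Pred (List Carrier) 0ℓ} → Decidable P → ∀ ℓ →
    (∀ S → length S ≡ ℓ → P S) ⊎ (∃ λ S → length S ≡ ℓ × ¬ P S)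
  counterexample P? zero with P? []
  ... | yes p = inj₁ λ { [] _ → p }
  ... | no ¬p = inj₂ ([] , refl , ¬p)
  counterexample {P} P? (suc ℓ) with go elems
    where
    go : ∀ xs → (∀ {x} → x ∈ xs → ∀ S → length S ≡ ℓ → P (x ∷ S)) ⊎ (∃ λ S → length S ≡ suc ℓ × ¬ P S)
    go [] = inj₁ λ ()
    go (x ∷ xs) with counterexample (λ S → P? (x ∷ S)) ℓ
    ... | inj₂ (S , e , ¬p) = inj₂ (x ∷ S , cong suc e , ¬p)
    ... | inj₁ f with go xs
    ... | inj₂ c = inj₂ c
    ... | inj₁ g = inj₁ λ { (here refl) → f ; (there x∈) → g x∈ }
  ... | inj₁ f = inj₁ λ { (x ∷ S) e → f (complete x) S (ℕₚ.suc-injective e) }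
  ... | inj₂ c = inj₂ c

  least : {P : Pred ℕ 0ℓ} → Decidable P → ∀ n → P n → ∃ λ m → P m × (∀ k → P k → m ≤ k)
  least P? zero p = 0 , p , λ _ _ → z≤n
  least P? (suc n) p with P? 0
  ... | yes p₀ = 0 , p₀ , λ _ _ → z≤n
  ... | no ¬p₀ with least (λ k → P? (suc k)) n p
  ... | m , q , min = suc m , q , λ { zero r → ⊥-elim (¬p₀ r) ; (suc k) r → s≤s (min k r) }

  -- Weighted sums and Davenport constants

  module Weights (W : List ℤ) where

    -- Centring at β sends a term with `A·t ⊆ β + K` into `K` itself, at the price of displacing a
    -- sum of k terms by kβ.
    vals : Carrier → Carrier → List Carrier
    vals β t = map (λ a → (a · t) - β) W

    ∈-vals : ∀ {β t a} → a ∈ W → (a · t) - β ∈ vals β t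
    ∈-vals = ∈-map⁺ _

    Inside : Subgroup → Carrier → Carrier → Set
    Inside K β s = ∀ a → a ∈ W → mem K ((a · s) - β)

    Inside? : ∀ K β → Decidable (Inside K β)
    Inside? K β s = Dec.map′ (λ A a a∈ → All.lookup A a∈) (λ f → All.tabulate λ {a} → f a)
      (All.all? (λ a → dec K ((a · s) - β)) W)

    vals-Inside : ∀ K {β s b} → Inside K β s → b ∈ vals β s → mem K b
    vals-Inside K ins b∈ with ∈-map⁻ _ b∈
    ... | a , a∈ , refl = ins a a∈

    WSum⇒Sel : ∀ β {T x} → WSum W T x → Sel (vals β) T (x - length T ×ℕ β)
    WSum⇒Sel β [] = Sel-resp-≡ (abel (𝟘 ≐ 𝟘 ⊝ 𝟘) [] refl) []
    WSum⇒Sel β (_∷_ {a} {t} {T} {x} a∈ s) =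
      Sel-resp-≡ (abel (λ u β x k → u ⊝ β ⊕ (x ⊝ k) ≐ u ⊕ x ⊝ (β ⊕ k)) ((a · t) ∷ β ∷ x ∷ length T ×ℕ β ∷ []) refl)
        (∈-vals a∈ ∷ WSum⇒Sel β s)

    Sel⇒WSum : ∀ β {T x} → Sel (vals β) T x → WSum W T (x + length T ×ℕ β)
    Sel⇒WSum β [] = subst (WSum W []) (sym (identityˡ ε)) []
    Sel⇒WSum β (_∷_ {t = t} {T} {x} b∈ s) with ∈-map⁻ _ b∈
    ... | a , a∈ , refl = subst (WSum W (t ∷ T))
        (abel (λ u β x k → u ⊕ (x ⊕ k) ≐ u ⊝ β ⊕ x ⊕ (β ⊕ k)) ((a · t) ∷ β ∷ x ∷ length T ×ℕ β ∷ []) refl) (a∈ ∷ Sel⇒WSum β s)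

    WSum-↭ : ∀ {T T′ x} → T ↭ T′ → WSum W T x → WSum W T′ x
    WSum-↭ {T} {T′} {x} p s = subst (WSum W T′) (trans (cong (λ k → x - length T ×ℕ ε + k ×ℕ ε) (sym (↭-length p)))
        (abel (λ x k → x ⊝ k ⊕ k ≐ x) (x ∷ length T ×ℕ ε ∷ []) refl))
      (Sel⇒WSum ε (Sel-↭ p (WSum⇒Sel ε s)))

    ZeroSum : Pred Carrier 0ℓ → Pred (List Carrier) 0ℓ
    ZeroSum Z S = ∃ λ T → T ⊑ S × ¬ (T ≡ []) × ∃ λ x → WSum W T x × Z x

    ZeroSum-mono : ∀ {Z S S′} → S ⊑ S′ → ZeroSum Z S → ZeroSum Z S′
    ZeroSum-mono S⊑ (T , T⊑ , r) = T , ⊑-trans T⊑ S⊑ , r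

    -- Only order-preserving subsequences are listed, so completeness is stated for interleavings
    -- and transferred to `⊑` afterwards.
    choices : List Carrier → List (List Carrier × Carrier)
    choices [] = ([] , ε) ∷ []
    choices (s ∷ S) = choices S ++ cartesianProductWith (λ a (T , x) → s ∷ T , (a · s) + x) W (choices S)

    choices-sound : ∀ S {T x} → (T , x) ∈ choices S → T ⊑ S × WSum W T x
    choices-sound [] (here refl) = ⊑-refl , []
    choices-sound (s ∷ S) c∈ with ∈-++⁻ (choices S) c∈
    ... | inj₁ p with choices-sound S p
    ... | T⊑ , w = ⊑-trans T⊑ (⊑-++ʳ (s ∷ []) S) , w
    choices-sound (s ∷ S) c∈ | inj₂ q with ∈-cartesianProductWith⁻ (λ a (T , x) → s ∷ T , (a · s) + x) W (choices S) q
    ... | a , _ , a∈ , r , refl with choices-sound S r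
    ... | (U , p) , w = (U , prep s p) , a∈ ∷ w

    choices-complete : ∀ S {T U x} → Interleaving T U S → WSum W T x → (T , x) ∈ choices S
    choices-complete [] [] [] = here refl
    choices-complete (s ∷ S) (consˡ i) (a∈ ∷ w) = ∈-++⁺ʳ (choices S)
      (∈-cartesianProductWith⁺ (λ a (T , x) → s ∷ T , (a · s) + x) a∈ (choices-complete S i w))
    choices-complete (s ∷ S) (consʳ i) w = ∈-++⁺ˡ (choices-complete S i w)

    empty? : (T : List Carrier) → Dec (T ≡ [])
    empty? [] = yes refl
    empty? (_ ∷ _) = no λ ()

    ZeroSum? : ∀ {Z} → Decidable Z → Decidable (ZeroSum Z)
    ZeroSum? {Z} Z? S = Dec.map′ to from (Any.any? (λ (T , x) → ¬? (empty? T) ×-dec Z? x) (choices S))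
      where
      to : Any (λ (T , x) → ¬ (T ≡ []) × Z x) (choices S) → ZeroSum Z S
      to q with find q
      ... | (T , x) , c∈ , ne , z with choices-sound S c∈
      ... | T⊑ , w = T , T⊑ , ne , x , w , z
      from : ZeroSum Z S → Any (λ (T , x) → ¬ (T ≡ []) × Z x) (choices S)
      from (T , T⊑ , ne , x , w , z) with ⊑⇒interleaving T⊑
      ... | T′ , U , p , i = Any.map (λ { refl → ne′ , z }) (choices-complete S i (WSum-↭ p w))
        where
        ne′ : ¬ (T′ ≡ [])
        ne′ refl = ne (↭-empty-inv p)

    opaque
      DavProp-decide : ∀ G {Z} → Decidable Z → ∀ ℓ → DavProp W G Z ℓ ⊎ (∃ λ S → All (mem G) S × length S ≡ ℓ × ¬ ZeroSum Z S)
      DavProp-decide G Z? ℓ with counterexample (λ S → All.all? (dec G) S →-dec ZeroSum? Z? S) ℓ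
      ... | inj₁ f = inj₁ λ S a e → f S e a
      ... | inj₂ (S , e , ¬p) with All.all? (dec G) S
      ... | yes a = inj₂ (S , a , e , λ z → ¬p λ _ → z)
      ... | no ¬a = ⊥-elim (¬p λ a → ⊥-elim (¬a a))

    opaque
      -- A known valid length `D` bounds the search. In every application it is D_A(G) of the
      -- largest group, which stays valid for subgroups and for quotients.
      davenport : ∀ G {Z} → Decidable Z → ∀ D → DavProp W G Z D → ∃ λ ℓ → DavProp W G Z ℓ × (∀ m → DavProp W G Z m → ℓ ≤ m)
      davenport G {Z} Z? = least dec-Dav
        where
        dec-Dav : Decidable (DavProp W G Z)
        dec-Dav ℓ with DavProp-decide G Z? ℓ
        ... | inj₁ p = yes p
        ... | inj₂ (S , a , e , ¬z) = no λ p → ¬z (p S a e)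

    DavProp-≥ : ∀ {G Z ℓ} → DavProp W G Z ℓ → ∀ S → All (mem G) S → ℓ ≤ length S → ZeroSum Z S
    DavProp-≥ {ℓ = ℓ} dav S a le = ZeroSum-mono (take-⊑ ℓ S) (dav (take ℓ S) (Allₚ.take⁺ ℓ a) (length-take-≤ S le))

    DavProp-weaken : ∀ {G H Z Z′ ℓ} → H ≤G G → (∀ {x} → Z x → Z′ x) → DavProp W G Z ℓ → DavProp W H Z′ ℓ
    DavProp-weaken H≤G f dav S a e with dav S (All.map H≤G a) e
    ... | T , T⊑ , ne , x , w , z = T , T⊑ , ne , x , w , f z

    DavProp-pos : ∀ {G Z ℓ} → DavProp W G Z ℓ → ∃ λ d → ℓ ≡ suc d
    DavProp-pos {ℓ = zero} dav with dav [] [] refl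
    ... | [] , _ , ne , _ = ⊥-elim (ne refl)
    ... | _ ∷ _ , T⊑ , _ with ⊑-length T⊑
    ... | ()
    DavProp-pos {ℓ = suc d} dav = d , refl

    -- A zero-sum free sequence over K followed by one that is zero-sum free modulo K is zero-sum free.
    davenport-quotient : ∀ H K {dH dK dQ} → K ≤G H → IsDav W H dH → IsDav W K dK → IsDavQ W H K dQ → dK +ℕ dQ ≤ suc dH
    davenport-quotient H K {dH} {dK} {dQ} K≤H (davH , _) (davK , minK) (davQ , minQ) with DavProp-pos {K} {_≡ ε} davK | DavProp-pos {H} {mem K} davQ
    ... | k , refl | q , refl with DavProp-decide K (_≟ ε) k | DavProp-decide H (dec K) q
    ... | inj₁ p | _ = ⊥-elim (ℕₚ.1+n≰n (minK k p))
    ... | inj₂ _ | inj₁ p = ⊥-elim (ℕₚ.1+n≰n (minQ q p))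
    ... | inj₂ (S , aS , eS , ¬S) | inj₂ (S′ , aS′ , eS′ , ¬S′) = subst (_≤ suc dH) (sym (cong suc (ℕₚ.+-suc k q)))
        (s≤s (ℕₚ.≰⇒> λ le → no-zero (DavProp-≥ {G = H} davH (S ++ S′) (Allₚ.++⁺ (All.map K≤H aS) aS′)
          (ℕₚ.≤-trans le (ℕₚ.≤-reflexive (sym (trans (List.length-++ S) (cong₂ _+ℕ_ eS eS′))))))))
      where
      no-zero : ¬ ZeroSum (_≡ ε) (S ++ S′)
      no-zero (T , T⊑ , ne , x , w , x≡ε) with ⊑-++-split S T⊑
      ... | T₁ , T₂ , p , s₁ , s₂ with Sel-++⁻ T₁ (WSum⇒Sel ε (WSum-↭ p w))
      ... | y , z , sy , sz , e with empty? T₂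
      ... | yes refl = ¬S (T₁ , s₁ , (λ { refl → ne (↭-empty-inv p) }) , x , WSum-↭ (↭-trans p (↭-reflexive (List.++-identityʳ T₁))) w , x≡ε)
      -- The whole sum is 0 and its part over `T₁` lies in `K`, so the nonempty `T₂` would be a
      -- zero-sum modulo `K`.
      ... | no ne₂ = ¬S′ (T₂ , s₂ , ne₂ , _ , Sel⇒WSum ε sz , z∈K)
        where
        kε : ∀ k → k ×ℕ ε ≡ ε
        kε zero = refl
        kε (suc k) = trans (identityˡ _) (kε k)
        y∈K : mem K y
        y∈K = Sel-mem K (λ t∈ b∈ → vals-mem (All.lookup aS (⊑-∈ s₁ t∈)) b∈) sy
          where
          ·-mem : ∀ a {t} → mem K t → mem K (a · t)
          ·-mem (ℤ.+ k) m = mem-×ℕ K k m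
          ·-mem -[1+ k ] m = ⁻¹-closed K (mem-×ℕ K (suc k) m)
          vals-mem : ∀ {t b} → mem K t → b ∈ vals ε t → mem K b
          vals-mem {t} m b∈ with ∈-map⁻ _ b∈
          ... | a , _ , refl = mem-- K (·-mem a m) (ε∈ K)
        z∈K : mem K (z + length T₂ ×ℕ ε)
        z∈K = mem-resp K (begin
          - y                                                     ≡⟨ abel (λ y z → ⊖ y ≐ z ⊕ 𝟘 ⊝ (y ⊕ z)) (y ∷ z ∷ []) refl ⟩
          z + ε - (y + z)                                         ≡⟨ cong₂ (λ u v → z + u - v) (sym (kε (length T₂))) (sym e) ⟩
          z + length T₂ ×ℕ ε - (x - length (T₁ ++ T₂) ×ℕ ε)       ≡⟨ cong₂ (λ u v → z + length T₂ ×ℕ ε - (u - v)) x≡ε (kε (length (T₁ ++ T₂))) ⟩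
          z + length T₂ ×ℕ ε - (ε - ε)                            ≡⟨ abel (λ u → u ⊝ (𝟘 ⊝ 𝟘) ≐ u) (z + length T₂ ×ℕ ε ∷ []) refl ⟩
          z + length T₂ ×ℕ ε                                      ∎) (⁻¹-closed K y∈K)
          where open ≡-Reasoning

  -- Sums of prescribed length

  module Extension (W : List ℤ) (a₀ : ℤ) (a₀∈W : a₀ ∈ W) where
    open Weights W

    Sums : Carrier → ℕ → List Carrier → Pred Carrier 0ℓ
    Sums β k S z = ∃ λ T → T ⊑ S × length T ≡ k × Sel (vals β) T z

    Sums-mono : ∀ {β k S S′ z} → S ⊑ S′ → Sums β k S z → Sums β k S′ z
    Sums-mono S⊑ (T , T⊑ , r) = T , ⊑-trans T⊑ S⊑ , r

    Sel-total : ∀ β T → Sel (vals β) T (total (λ t → (a₀ · t) - β) T)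
    Sel-total β [] = []
    Sel-total β (t ∷ T) = ∈-vals a₀∈W ∷ Sel-total β T

    total-mem : ∀ (K : Subgroup) ψ {T} → (∀ {t} → t ∈ T → mem K (ψ t)) → mem K (total ψ T)
    total-mem K ψ {[]} f = ε∈ K
    total-mem K ψ {t ∷ T} f = +-closed K (f (here refl)) (total-mem K ψ (λ t∈ → f (there t∈)))

    -- Davenport constants concern terms in the group, whereas the terms here lie in a coset of α.
    -- The identity a(t - α) = (at - β) - (aα - β) makes the passage harmless, because aα - β ∈ K.
    shifted-sum : ∀ K {α β} → Inside K β α → ∀ T {x} → WSum W (map (_- α) T) x → ∃ λ y → Sel (vals β) T y × mem K (y - x)
    shifted-sum K ins [] [] = ε , [] , mem-- K (ε∈ K) (ε∈ K)
    shifted-sum K {α} {β} ins (t ∷ T) (_∷_ {a} {x = x} a∈ w) with shifted-sum K ins T w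
    ... | y , s , m = (a · t) - β + y , ∈-vals a∈ ∷ s , mem-resp K (trans
        (abel (λ p q b x y → p ⊝ b ⊕ (y ⊝ x) ≐ q ⊝ b ⊕ y ⊝ (q ⊝ p ⊕ x)) ((a · α) ∷ (a · t) ∷ β ∷ x ∷ y ∷ []) refl)
        (cong (λ u → (a · t) - β + y - (u + x)) (sym (·-distribˡ-- a t α)))) (+-closed K (ins a a∈) m)

    module _ (H K : Subgroup) {e : ℕ} (dav : DavProp W H (mem K) (suc e)) {α β : Carrier} (ins : Inside K β α) where

      -- Adding weighted zero-sum subsequences modulo K until at most e terms are left over.
      opaque
        extend : ∀ n U C {u} → length C ≤ n → All (λ s → mem H (s - α)) C → Sel (vals β) U u →
          ∃ λ U′ → ∃ λ C′ → ∃ λ u′ → (U′ ++ C′) ↭ (U ++ C) × length C′ ≤ e × Sel (vals β) U′ u′ × mem K (u′ - u)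
        extend n U C {u} le aC s with length C ℕₚ.≤? e
        ... | yes small = U , C , u , ↭-refl , small , s , mem-resp K (sym (inverseʳ u)) (ε∈ K)
        extend zero U [] le aC s | no big = ⊥-elim (big z≤n)
        extend (suc n) U C {u} le aC s | no big
          with DavProp-≥ {G = H} dav (map (_- α) C) (Allₚ.map⁺ aC) (ℕₚ.≤-trans (ℕₚ.≰⇒> big) (ℕₚ.≤-reflexive (sym (List.length-map (_- α) C))))
        ... | T , T⊑ , ne , x , w , x∈K with ⊑-map⁻ (_- α) T⊑
        ... | [] , refl , _ = ⊥-elim (ne refl)
        ... | t ∷ T′ , refl , (C′ , p) with shifted-sum K ins (t ∷ T′) w
        ... | y , sy , m with extend n (U ++ t ∷ T′) C′ shorter (Allₚ.++⁻ʳ (t ∷ T′) (All-resp-↭ (↭-sym p) aC)) (Sel-++ s sy)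
          where
          shorter : length C′ ≤ n
          shorter = ℕₚ.≤-pred (ℕₚ.≤-trans (s≤s (ℕₚ.m≤n+m (length C′) (length T′)))
            (ℕₚ.≤-trans (ℕₚ.≤-reflexive (length-split {A = t ∷ T′} p)) le))
        ... | U″ , C″ , u″ , q , small , s″ , m″ = U″ , C″ , u″
            , ↭-trans q (↭-trans (↭-reflexive (List.++-assoc U (t ∷ T′) C′)) (++⁺ˡ U p)) , small , s″
            , mem-resp K (abel (λ u u″ x y → u″ ⊝ (u ⊕ y) ⊕ (y ⊝ x ⊕ x) ≐ u″ ⊝ u) (u ∷ u″ ∷ x ∷ y ∷ []) refl)
                (+-closed K m″ (+-closed K m x∈K))

      sums-of-extension : ∀ {N P Q O U C u z} → (∀ {y} → mem K y → Sums β (card K) P y) → All (Inside K β) Q →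
        All (λ s → mem H (s - α)) O → card K +ℕ length O ≤ N → N +ℕ e ≤ card K +ℕ length Q +ℕ length O →
        (U ++ C) ↭ O → Sel (vals β) U u → mem K (z - u) → Sums β N (P ++ (Q ++ O)) z
      sums-of-extension {N} {P} {Q} {O} {U} {C} {u} {z} full aQ aO room enough p s m
        with extend (length C) U C ℕₚ.≤-refl (Allₚ.++⁻ʳ U (All-resp-↭ (↭-sym p) aO)) s
      ... | U′ , C′ , u′ , q , small , s′ , m′ = combine (full rest∈K)
        where
        k = N ∸ (card K +ℕ length U′)
        lenO : length U′ +ℕ length C′ ≡ length O
        lenO = trans (length-split {A = U′} q) (↭-length p)
        fits : card K +ℕ length U′ ≤ N
        fits = linear (length C′) (room ⊞ ℕₚ.≤-reflexive lenO) (arith (card K) (length U′) (length C′) N (length O))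
          where
          arith : ∀ K u c N o → K +ℕ u +ℕ (N +ℕ o) +ℕ c ≡ N +ℕ (K +ℕ o +ℕ (u +ℕ c))
          arith = solve-∀
        k-eq : k +ℕ (card K +ℕ length U′) ≡ N
        k-eq = ℕₚ.m∸n+n≡m fits
        k≤ : k ≤ length Q
        k≤ = linear 0 (enough ⊞ small ⊞ ℕₚ.≤-reflexive k-eq ⊞ ℕₚ.≤-reflexive (sym lenO))
          (arith k (length Q) N e (card K) (length O) (length U′) (length C′))
          where
          arith : ∀ k q N e K o u c → k +ℕ (K +ℕ q +ℕ o +ℕ (e +ℕ (N +ℕ (u +ℕ c)))) +ℕ 0
            ≡ q +ℕ (N +ℕ e +ℕ (c +ℕ (k +ℕ (K +ℕ u) +ℕ o)))
          arith = solve-∀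
        Q₀ = take k Q
        q₀ = total (λ t → (a₀ · t) - β) Q₀
        q₀∈K : mem K q₀
        q₀∈K = total-mem K _ λ t∈ → All.lookup (Allₚ.take⁺ k aQ) t∈ a₀ a₀∈W
        rest∈K : mem K (z - u - (u′ - u) - q₀)
        rest∈K = mem-- K (mem-- K m m′) q₀∈K
        combine : Sums β (card K) P (z - u - (u′ - u) - q₀) → Sums β N (P ++ (Q ++ O)) z
        combine (T , T⊑ , len , sT) = T ++ (Q₀ ++ U′)
          , ⊑-++⁺ T⊑ (⊑-++⁺ (take-⊑ k Q) (C′ , ↭-trans q p))
          , trans (List.length-++ T) (trans (cong₂ _+ℕ_ len (trans (List.length-++ Q₀) (cong (_+ℕ length U′) (length-take-≤ Q k≤))))
              (trans (arith (card K) k (length U′)) k-eq))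
          , Sel-resp-≡ (abel (λ z u u′ q → z ⊝ u ⊝ (u′ ⊝ u) ⊝ q ⊕ (q ⊕ u′) ≐ z) (z ∷ u ∷ u′ ∷ q₀ ∷ []) refl)
              (Sel-++ sT (Sel-++ (Sel-total β Q₀) s′))
          where
          arith : ∀ K k u → K +ℕ (k +ℕ u) ≡ k +ℕ (K +ℕ u)
          arith = solve-∀

    sums-mod : ∀ K {β N S R z} → All (Inside K β) S → Sums β N (S ++ R) z →
      ∃ λ U → ∃ λ C → ∃ λ u → (U ++ C) ↭ R × Sel (vals β) U u × mem K (z - u)
    sums-mod K {S = S} aS (T , T⊑ , _ , s) with ⊑-++-split S T⊑
    ... | T₁ , T₂ , p , s₁ , (C , q) with Sel-++⁻ T₁ (Sel-↭ p s)
    ... | x , y , sx , sy , refl = T₂ , C , y , q , sy , mem-resp K (abel (λ x y → x ≐ x ⊕ y ⊝ y) (x ∷ y ∷ []) refl)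
        (Sel-mem K (λ t∈ b∈ → vals-Inside K (All.lookup aS (⊑-∈ s₁ t∈)) b∈) sx)

  -- Counting the terms outside a stabiliser

  escapes? : ∀ X Y → (∃ λ z → z ∈ₛ X × ¬ z ∈ₛ Y) ⊎ (X ⊆ₛ Y)
  escapes? X Y = cases (Any.any? (λ z → ¬? (holds? Y z)) (elements X))
    where
    cases : Dec (Any (λ z → ¬ z ∈ₛ Y) (elements X)) → (∃ λ z → z ∈ₛ X × ¬ z ∈ₛ Y) ⊎ (X ⊆ₛ Y)
    cases (yes some) with find some
    ... | z , z∈ , z∉ = inj₁ (z , elements-∈ X z∈ , z∉)
    cases (no none) = inj₂ covered
      where
      covered : X ⊆ₛ Y
      covered {z} z∈ with holds? Y z
      ... | yes p = p
      ... | no ¬p = ⊥-elim (none (Any.map (λ { refl → ¬p }) (∈-elements X z∈)))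

  module _ (B : Carrier → List Carrier) (ε∈B : ∀ t → ε ∈ B t) where

    ⊆⊕ₛ : ∀ Y t → Y ⊆ₛ Y ⊕ₛ B t
    ⊆⊕ₛ Y t {x} x∈ = subst (_∈ₛ Y ⊕ₛ B t) (identityʳ x) (⊕ₛ-intro Y (ε∈B t) x∈)

    ⊕ₛ-periodic : ∀ M Y {C} → (∀ {x h} → mem M h → x ∈ₛ Y → x + h ∈ₛ Y) → ∀ {x h} → mem M h → x ∈ₛ Y ⊕ₛ C → x + h ∈ₛ Y ⊕ₛ C
    ⊕ₛ-periodic M Y per {x} {h} h∈ = Any.map λ {b} m →
      subst (_∈ₛ Y) (abel (λ x b h → x ⊝ b ⊕ h ≐ x ⊕ h ⊝ b) (x ∷ b ∷ h ∷ []) refl) (per h∈ m)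

    module _ (M : Subgroup) {In : Pred Carrier 0ℓ} (In? : Decidable In) (in-M : ∀ t → (∀ {b} → b ∈ B t → mem M b) → In t) where

      -- As 0 ∈ B t, a term that leaves the partial sumset unchanged has `B t` inside its
      -- stabiliser, hence inside `M`. A term outside therefore enlarges the sumset, and by a whole
      -- coset since all partial sumsets are `M`-periodic.
      count-outside : ∀ Y T → (∀ {x h} → mem M h → x ∈ₛ Y → x + h ∈ₛ Y) → stab (sumset B Y T) ≤G M →
        length (filter (∁? In?) T) *ℕ card M +ℕ size Y ≤ size (sumset B Y T)
      count-outside Y [] per st = ℕₚ.≤-refl
      count-outside Y (t ∷ T) per st with In? t | count-outside (Y ⊕ₛ B t) T (⊕ₛ-periodic M Y per) st
      ... | yes _ | ih = ℕₚ.≤-trans (ℕₚ.+-monoʳ-≤ (length (filter (∁? In?) T) *ℕ card M) (size-mono Y (Y ⊕ₛ B t) (⊆⊕ₛ Y t))) ih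
      ... | no out | ih with escapes? (Y ⊕ₛ B t) Y
      ... | inj₁ (z , z∈ , z∉) = linear 0 (ih ⊞ size-coset M Y (Y ⊕ₛ B t) (⊆⊕ₛ Y t) per (⊕ₛ-periodic M Y per) z∈ z∉)
          (arith (card M) (length (filter (∁? In?) T) *ℕ card M) (size Y) (size (Y ⊕ₛ B t)) (size (sumset B (Y ⊕ₛ B t) T)))
        where
        arith : ∀ m o y y₁ f → m +ℕ o +ℕ y +ℕ (f +ℕ y₁) +ℕ 0 ≡ f +ℕ (o +ℕ y₁ +ℕ (m +ℕ y))
        arith = solve-∀
      ... | inj₂ back = ⊥-elim (out (in-M t λ {b} b∈ → st (stab-sumset B (Y ⊕ₛ B t) T (stab-⊕ₛ Y (B t)
          (mem-resp (stab Y) (abel (λ b → b ⊝ 𝟘 ≐ b) (b ∷ []) refl)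
            (⊕ₛ-stationary Y (B t) (size-mono (Y ⊕ₛ B t) Y back) b∈ (ε∈B t)))))))

    stab-sumset-subgroup : ∀ K T → K ≤G stab (sumset B ⟪ K ⟫ T)
    stab-sumset-subgroup K T {h} h∈ = stab-sumset B ⟪ K ⟫ T λ x →
      (λ m → +-closed K m h∈) , λ m → mem-resp K (abel (λ x h → x ⊕ h ⊝ h ≐ x) (x ∷ h ∷ []) refl) (mem-- K m h∈)

    opaque
      -- The partial sumsets starting from `K` need not be periodic modulo the final stabiliser.
      -- Starting from that stabiliser instead gives the same final set, and it contributes the
      -- extra summand.
      count-outside-stab : ∀ K T {In : Pred Carrier 0ℓ} (In? : Decidable In) →
        (∀ t → (∀ {b} → b ∈ B t → mem (stab (sumset B ⟪ K ⟫ T)) b) → In t) →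
        length (filter (∁? In?) T) *ℕ card (stab (sumset B ⟪ K ⟫ T)) +ℕ card (stab (sumset B ⟪ K ⟫ T)) ≤ size (sumset B ⟪ K ⟫ T)
      count-outside-stab K T In? in-M = ℕₚ.≤-trans
        (count-outside M In? in-M ⟪ M ⟫ T (λ h∈ x∈ → +-closed M x∈ h∈)
          (λ h∈ x → (λ m → to (proj₁ (h∈ x) (from m))) , (λ m → to (proj₂ (h∈ x) (from m)))))
        (size-mono (sumset B ⟪ M ⟫ T) (sumset B ⟪ K ⟫ T) to)
        where
        M : Subgroup
        M = stab (sumset B ⟪ K ⟫ T)
        to : sumset B ⟪ M ⟫ T ⊆ₛ sumset B ⟪ K ⟫ T
        to z∈ with sumset-elim B ⟪ M ⟫ T z∈
        ... | m , x , m∈ , s , refl = subst (_∈ₛ sumset B ⟪ K ⟫ T) (abel (λ m x → 𝟘 ⊕ x ⊕ m ≐ m ⊕ x) (m ∷ x ∷ []) refl)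
          (stab-+ (sumset B ⟪ K ⟫ T) m∈ (sumset-intro B ⟪ K ⟫ T (ε∈ K) s))
        from : sumset B ⟪ K ⟫ T ⊆ₛ sumset B ⟪ M ⟫ T
        from z∈ with sumset-elim B ⟪ K ⟫ T z∈
        ... | m , x , m∈ , s , refl = sumset-intro B ⟪ M ⟫ T (stab-sumset-subgroup K T m∈) s

  -- Terms of `A` are preferred; the last clause records that `B` is touched only when `A` is
  -- exhausted.
  distribute : ∀ m (A B : List Carrier) → m ≤ length A +ℕ length B →
    ∃ λ A₁ → ∃ λ A₂ → ∃ λ B₁ → ∃ λ B₂ → (A₁ ++ A₂) ↭ A × (B₁ ++ B₂) ↭ B × length A₁ +ℕ length B₁ ≡ m
      × (length B₁ ≡ 0 ⊎ length A₁ ≡ length A)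
  distribute m A B le with m ℕₚ.≤? length A
  ... | yes m≤ = take m A , drop m A , [] , B , ↭-reflexive (List.take++drop≡id m A) , ↭-refl
      , trans (ℕₚ.+-identityʳ _) (length-take-≤ A m≤) , inj₁ refl
  ... | no m≰ = A , [] , take (m ∸ length A) B , drop (m ∸ length A) B , ↭-reflexive (List.++-identityʳ A)
      , ↭-reflexive (List.take++drop≡id (m ∸ length A) B)
      , trans (cong (length A +ℕ_) (length-take-≤ B (ℕₚ.m≤n+o⇒m∸n≤o m (length A) le))) (ℕₚ.m+[n∸m]≡n (ℕₚ.≰⇒≥ m≰)) , inj₂ refl

  -- r = 0 or r ≤ |G/H| − 2, written without division.
  Few : Subgroup → Subgroup → ℕ → Set
  Few G H r = r ≡ 0 ⊎ (r +ℕ 2) *ℕ card H ≤ card G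

  -- Orders and indices

  card-pos : ∀ H → 1 ≤ card H
  card-pos H = size-nonempty ⟪ H ⟫ (ε∈ H)

  card-mono : ∀ {H G} → H ≤G G → card H ≤ card G
  card-mono {H} {G} H≤G = size-mono ⟪ H ⟫ ⟪ G ⟫ H≤G

  few⇒room : ∀ {G H r} → H ≤G G → Few G H r → r +ℕ card H ≤ card G
  few⇒room {G} {H} H≤G (inj₁ refl) = card-mono {H} {G} H≤G
  few⇒room {G} {H} {r} _ (inj₂ le) = linear (card H) (le ⊞ ℕₚ.*-monoʳ-≤ r (card-pos H)) (arith r (card H) (card G))
    where
    arith : ∀ r h g → r +ℕ h +ℕ (g +ℕ r *ℕ h) +ℕ h ≡ g +ℕ ((r +ℕ 2) *ℕ h +ℕ r *ℕ 1)
    arith = solve-∀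

  -- When (r + 2)|H| ≤ |G|, (o + 2)|M| + r|M| ≤ |H| + r|H| ≤ |G|, so the constant 2 does not
  -- accumulate along the descent. The case r = 0 is separate because the descent starts at `H = G`,
  -- where 2|H| ≤ |G| fails.
  few-step : ∀ {G H M r o} → H ≤G G → M ≤G H → Few G H r → o *ℕ card M +ℕ card M +ℕ card M ≤ card H → Few G M (o +ℕ r)
  few-step {G} {H} {M} {o = o} H≤G M≤H (inj₁ refl) le = inj₂ (linear 0 (le ⊞ card-mono {H} {G} H≤G) (arith o (card M) (card H) (card G)))
    where
    arith : ∀ o m h g → (o +ℕ 0 +ℕ 2) *ℕ m +ℕ (h +ℕ g) +ℕ 0 ≡ g +ℕ (o *ℕ m +ℕ m +ℕ m +ℕ h)
    arith = solve-∀
  few-step {G} {H} {M} {r} {o} H≤G M≤H (inj₂ few) le = inj₂ (linear (card H) (le ⊞ few ⊞ ℕₚ.*-monoʳ-≤ r (card-mono {M} {H} M≤H))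
      (arith o r (card M) (card H) (card G)))
    where
    arith : ∀ o r m h g → (o +ℕ r +ℕ 2) *ℕ m +ℕ (h +ℕ (g +ℕ r *ℕ h)) +ℕ h ≡ g +ℕ (o *ℕ m +ℕ m +ℕ m +ℕ ((r +ℕ 2) *ℕ h +ℕ r *ℕ m))
    arith = solve-∀

  ℤ-minus : ∀ {a} m c → a ≡ m +ℕ c → ℤ.+ a ℤ.- ℤ.+ c ≡ ℤ.+ m
  ℤ-minus m c refl = cancel (ℤ.+ m) (ℤ.+ c)
    where
    cancel : ∀ i j → i ℤ.+ j ℤ.- j ≡ i
    cancel = ℤ-Solver.solve-∀

  index-slack : ∀ G H {r} → (r +ℕ 2) *ℕ card H ≤ card G → ∃ λ t → index G H ≡ r +ℕ t +ℕ 2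
  index-slack G H {r} le = index G H ∸ (r +ℕ 2) , trans (sym (ℕₚ.m∸n+n≡m r+2≤)) (arith (index G H ∸ (r +ℕ 2)) r)
    where
    r+2≤ : r +ℕ 2 ≤ index G H
    r+2≤ = ℕₚ.≤-trans (ℕₚ.≤-reflexive (sym (m*n/n≡m (r +ℕ 2) (card H) {{card-nz H}}))) (/-monoˡ-≤ (card H) {{card-nz H}} le)
    arith : ∀ t r → t +ℕ (r +ℕ 2) ≡ r +ℕ t +ℕ 2
    arith = solve-∀

  module WeightedSums (W : List ℤ) (a₀ : ℤ) (a₀∈W : a₀ ∈ W) (gcd≡1 : gcdList W ≡ 1) where
    open Weights W public
    open Extension W a₀ a₀∈W public

    -- This is where gcd A = 1 enters.
    mem-primitive : ∀ H {x y} → (∀ a → a ∈ W → mem H ((a · x) - (a · y))) → mem H (x - y)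
    mem-primitive H {x} {y} f = mem-resp H (trans (cong (_×ℕ (x - y)) gcd≡1) (identityʳ _))
      (mem-gcdList H W λ a a∈ → mem-resp H (sym (·-distribˡ-- a x y)) (f a a∈))

    Inside⇒mem : ∀ H {β x y} → Inside H β x → Inside H β y → mem H (x - y)
    Inside⇒mem H {β} {x} {y} p q = mem-primitive H λ a a∈ → mem-resp H
      (abel (λ u v β → u ⊝ β ⊝ (v ⊝ β) ≐ u ⊝ v) ((a · x) ∷ (a · y) ∷ β ∷ []) refl) (mem-- H (p a a∈) (q a a∈))

    Inside-recenter : ∀ H {β β′ x} → mem H (β′ - β) → Inside H β x → Inside H β′ x
    Inside-recenter H {β} {β′} {x} m p a a∈ = mem-resp H
      (abel (λ u β β′ → u ⊝ β ⊝ (β′ ⊝ β) ≐ u ⊝ β′) ((a · x) ∷ β ∷ β′ ∷ []) refl) (mem-- H (p a a∈) m)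

    Sel-recenter : ∀ {β} β′ {T x} → Sel (vals β) T x → Sel (vals β′) T (x - length T ×ℕ (β′ - β))
    Sel-recenter β′ [] = Sel-resp-≡ (abel (𝟘 ≐ 𝟘 ⊝ 𝟘) [] refl) []
    Sel-recenter {β} β′ (_∷_ {t = t} {T} {x} b∈ s) with ∈-map⁻ _ b∈
    ... | a , a∈ , refl = Sel-resp-≡
        (abel (λ u β β′ x k → u ⊝ β′ ⊕ (x ⊝ k) ≐ u ⊝ β ⊕ x ⊝ (β′ ⊝ β ⊕ k)) ((a · t) ∷ β ∷ β′ ∷ x ∷ length T ×ℕ (β′ - β) ∷ []) refl)
        (∈-vals a∈ ∷ Sel-recenter β′ s)

    -- Filling a subgroup with sums of exactly |K| terms

    -- The sequence `P` has three parts with different roles: `R₁` is always used in full and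
    -- produces `X`; `Z` is padding, neutral modulo `K₁`; from `V` a subsequence is chosen that
    -- reaches the right class modulo `K₁`. The `K₁`-periodic set `X` absorbs the remaining error.
    module Fill (K K₁ : Subgroup) (X : FinSet) (β g₀ : Carrier) (R₁ E₁ Z₀ R₂ E₂ : List Carrier)
      (E₁-split : (Z₀ ++ (R₂ ++ E₂)) ↭ E₁) (insE₁ : ∀ {t} → t ∈ E₁ → Inside K β t) (g₀∈ : g₀ ∈ E₁)
      (E₁-single : ∀ {e a a′} → e ∈ E₁ → a ∈ W → a′ ∈ W → mem K₁ ((a · e) - (a′ · e)))
      (X⊆K : X ⊆ₛ ⟪ K ⟫) (X-sums : ∀ {x} → x ∈ₛ X → Sel (vals β) R₁ x)
      (X-periodic : ∀ {x h} → mem K₁ h → x ∈ₛ X → x + h ∈ₛ X) (k<X : suc (length R₁) ≤ size X)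
      (Z₀∈K₁ : ∀ {t} → t ∈ Z₀ → mem K₁ ((a₀ · t) - (a₀ · g₀)))
      (heavy : ∀ c → multiplicity (λ t → (a₀ · t) - (a₀ · g₀)) c E₁ ≤ length Z₀)
      {d : ℕ} (davK : DavProp W K (_≡ ε) (suc d)) (long : card K +ℕ d ≤ length R₁ +ℕ length E₁)
      (R-small : suc (length R₁ +ℕ length R₂) ≤ card K) where

      k = length R₁
      β₀ = a₀ · g₀

      ψ : Carrier → Carrier
      ψ s = (a₀ · s) - β₀

      ψ∈K : ∀ {t} → t ∈ E₁ → mem K (ψ t)
      ψ∈K {t} t∈ = mem-resp K (abel (λ u v β → u ⊝ β ⊝ (v ⊝ β) ≐ u ⊝ v) ((a₀ · t) ∷ β₀ ∷ β ∷ []) refl)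
        (mem-- K (insE₁ t∈ a₀ a₀∈W) (insE₁ g₀∈ a₀ a₀∈W))

      β₀-β∈K : mem K (β₀ - β)
      β₀-β∈K = insE₁ g₀∈ a₀ a₀∈W

      X≤K : size X ≤ card K
      X≤K = size-mono X ⟪ K ⟫ X⊆K

      -- The cap keeps `R₁`, `Z` and `R₂` within the |K| + d terms of `P`, as `R₁` and `R₂` together
      -- have fewer than |K| terms.
      h = length Z₀ ℕ.⊓ suc d
      Z = take h Z₀
      room : k +ℕ h +ℕ length R₂ ≤ card K +ℕ d
      room = linear 0 (R-small ⊞ ℕₚ.m⊓n≤n (length Z₀) (suc d)) (arith k h (length R₂) (card K) d)
        where
        arith : ∀ k h r K d → k +ℕ h +ℕ r +ℕ (K +ℕ suc d) +ℕ 0 ≡ K +ℕ d +ℕ (suc (k +ℕ r) +ℕ h)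
        arith = solve-∀
      j = card K +ℕ d ∸ (k +ℕ h +ℕ length R₂)
      spare = E₂ ++ drop h Z₀
      V = R₂ ++ take j spare
      P = R₁ ++ (Z ++ V)

      Z-length : length Z ≡ h
      Z-length = length-take-≤ Z₀ (ℕₚ.m⊓n≤m (length Z₀) (suc d))

      j-eq : j +ℕ (k +ℕ h +ℕ length R₂) ≡ card K +ℕ d
      j-eq = ℕₚ.m∸n+n≡m room

      all-split : ((R₁ ++ (Z ++ R₂)) ++ spare) ↭ (R₁ ++ E₁)
      all-split = ↭-trans (solve 5 (λ r z s e w → (r ∙ (z ∙ s)) ∙ (e ∙ w) ⊜ r ∙ ((z ∙ w) ∙ (s ∙ e))) ↭-refl R₁ Z R₂ E₂ (drop h Z₀))
        (↭-trans (++⁺ˡ R₁ (++⁺ʳ (R₂ ++ E₂) (↭-reflexive (List.take++drop≡id h Z₀)))) (++⁺ˡ R₁ E₁-split))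
        where open ++-Solver renaming (_⊕_ to _∙_)

      chosen-length : length (R₁ ++ (Z ++ R₂)) ≡ k +ℕ h +ℕ length R₂
      chosen-length = trans (List.length-++ R₁) (trans (cong (k +ℕ_) (trans (List.length-++ Z) (cong (_+ℕ length R₂) Z-length)))
        (sym (ℕₚ.+-assoc k h (length R₂))))

      j≤spare : j ≤ length spare
      j≤spare = linear 0 (long ⊞ ℕₚ.≤-reflexive j-eq ⊞ ℕₚ.≤-reflexive (sym (trans (length-split {A = R₁ ++ (Z ++ R₂)} all-split) (List.length-++ R₁)))
          ⊞ ℕₚ.≤-reflexive chosen-length)
        (arith j (length spare) (card K +ℕ d) (k +ℕ length E₁) (length (R₁ ++ (Z ++ R₂))) (k +ℕ h +ℕ length R₂))
        where
        arith : ∀ j s c q l m → j +ℕ (q +ℕ (c +ℕ (l +ℕ s +ℕ m))) +ℕ 0 ≡ s +ℕ (c +ℕ (j +ℕ m +ℕ (q +ℕ l)))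
        arith = solve-∀

      V-length : k +ℕ h +ℕ length V ≡ card K +ℕ d
      V-length = trans (cong (k +ℕ h +ℕ_) (trans (List.length-++ R₂) (cong (length R₂ +ℕ_) (length-take-≤ spare j≤spare))))
        (trans (arith k h (length R₂) j) j-eq)
        where
        arith : ∀ k h r j → k +ℕ h +ℕ (r +ℕ j) ≡ j +ℕ (k +ℕ h +ℕ r)
        arith = solve-∀

      P-length : length P ≡ card K +ℕ d
      P-length = trans (trans (List.length-++ R₁) (cong (k +ℕ_) (trans (List.length-++ Z) (cong (_+ℕ length V) Z-length))))
        (trans (sym (ℕₚ.+-assoc k h (length V))) V-length)

      P-split : (P ++ drop j spare) ↭ (R₁ ++ E₁)
      P-split = ↭-trans (solve 5 (λ r z s e w → (r ∙ (z ∙ (s ∙ e))) ∙ w ⊜ (r ∙ (z ∙ s)) ∙ (e ∙ w)) ↭-refl R₁ Z R₂ (take j spare) (drop j spare))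
        (↭-trans (++⁺ˡ (R₁ ++ (Z ++ R₂)) (↭-reflexive (List.take++drop≡id j spare))) all-split)
        where open ++-Solver renaming (_⊕_ to _∙_)

      V⊑E₁ : V ⊑ E₁
      V⊑E₁ = Z ++ drop j spare , ↭-trans
        (solve 4 (λ s e z w → (s ∙ e) ∙ (z ∙ w) ⊜ z ∙ (s ∙ (e ∙ w))) ↭-refl R₂ (take j spare) Z (drop j spare))
        (↭-trans (++⁺ˡ Z (++⁺ˡ R₂ (↭-reflexive (List.take++drop≡id j spare))))
        (↭-trans (solve 4 (λ z s e w → z ∙ (s ∙ (e ∙ w)) ⊜ (z ∙ w) ∙ (s ∙ e)) ↭-refl Z R₂ E₂ (drop h Z₀))
        (↭-trans (++⁺ʳ (R₂ ++ E₂) (↭-reflexive (List.take++drop≡id h Z₀))) E₁-split)))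
        where open ++-Solver renaming (_⊕_ to _∙_)

      multiplicity≤ : ∀ c {U} → U ⊑ E₁ → multiplicity ψ c U ≤ length Z₀
      multiplicity≤ c {U} (C , p) = ℕₚ.≤-trans (ℕₚ.m≤m+n _ (multiplicity ψ c C))
        (ℕₚ.≤-trans (ℕₚ.≤-reflexive (multiplicity-split ψ c U p)) (heavy c))

      -- While U is too long, Scherk's theorem lets us drop at most h of its terms at the cost of
      -- moving x inside X.  Overlong U forces h ≤ d, hence h = |Z₀| bounds all multiplicities.
      shrink : ∀ n U C {x} → length U ≤ n → (U ++ C) ↭ V → x ∈ₛ X → card K ≤ k +ℕ h +ℕ length U →
        ∃ λ U′ → ∃ λ C′ → ∃ λ x′ → (U′ ++ C′) ↭ V × x′ ∈ₛ X × card K ≤ k +ℕ h +ℕ length U′ × k +ℕ length U′ ≤ card K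
          × x′ + total ψ U′ ≡ x + total ψ U
      shrink n U C {x} le p x∈ low with k +ℕ length U ℕₚ.≤? card K
      ... | yes ok = U , C , x , p , x∈ , low , ok , refl
      shrink zero [] C le p x∈ low | no over =
        ⊥-elim (over (ℕₚ.≤-trans (ℕₚ.≤-reflexive (ℕₚ.+-identityʳ k)) (ℕₚ.≤-trans (ℕₚ.n≤1+n k) (ℕₚ.≤-trans k<X X≤K))))
      shrink (suc n) U C {x} le p x∈ low | no over
        with short-representation ψ K h (translate X (- x)) U ε∈′ ⊆K′ (λ t∈ → ψ∈K (⊑-∈ U⊑E₁ t∈)) mult
        where
        U⊑E₁ : U ⊑ E₁
        U⊑E₁ = ⊑-trans (C , p) V⊑E₁
        ε∈′ : ε - (- x) ∈ₛ X
        ε∈′ = subst (_∈ₛ X) (abel (λ x → x ≐ 𝟘 ⊝ ⊖ x) (x ∷ []) refl) x∈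
        ⊆K′ : translate X (- x) ⊆ₛ ⟪ K ⟫
        ⊆K′ {w} m = mem-resp K (abel (λ w x → w ⊝ ⊖ x ⊝ x ≐ w) (w ∷ x ∷ []) refl) (mem-- K (X⊆K m) (X⊆K x∈))
        h<d : suc h ≤ d
        h<d = linear (length C) (ℕₚ.≰⇒> over ⊞ ℕₚ.≤-reflexive V-length ⊞ ℕₚ.≤-reflexive (length-split {A = U} p))
          (arith h d k (length U) (length C) (length V) (card K))
          where
          arith : ∀ h d k u c v K → suc h +ℕ (k +ℕ u +ℕ (K +ℕ d +ℕ v)) +ℕ c ≡ d +ℕ (suc K +ℕ (k +ℕ h +ℕ v +ℕ (u +ℕ c)))
          arith = solve-∀
        Z₀≤h : length Z₀ ≤ h
        Z₀≤h with ℕₚ.⊓-sel (length Z₀) (suc d)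
        ... | inj₁ e = ℕₚ.≤-reflexive (sym e)
        ... | inj₂ e = ⊥-elim (ℕₚ.1+n≰n (ℕₚ.≤-trans (ℕₚ.≤-trans (ℕₚ.n≤1+n (suc d)) (s≤s (ℕₚ.≤-reflexive (sym e)))) h<d))
        mult : ∀ c → multiplicity ψ c U ≤ h
        mult c = ℕₚ.≤-trans (multiplicity≤ c U⊑E₁) Z₀≤h
      -- This says |X| + |U| ≤ |K|, although |X| exceeds |R₁| and `U` is overlong, that is |R₁| +
      -- |U| > |K|.
      ... | inj₂ small = ⊥-elim (ℕₚ.1+n≰n {card K} (linear 1 (small ⊞ size-translate X (- x) ⊞ k<X ⊞ ℕₚ.≰⇒> over)
          (arith (card K) (size X) (size (translate X (- x))) (length U) k)))
        where
        arith : ∀ K x y u k → suc K +ℕ (K +ℕ (y +ℕ (x +ℕ (k +ℕ u)))) +ℕ 1 ≡ K +ℕ (y +ℕ u +ℕ (x +ℕ (suc k +ℕ suc K)))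
        arith = solve-∀
      ... | inj₁ (T , U₁ , q , T≥1 , T≤h , x₁∈) with shrink n U₁ (T ++ C) shorter
          (↭-trans (solve 3 (λ t u c → u ∙ (t ∙ c) ⊜ (t ∙ u) ∙ c) ↭-refl T U₁ C) (↭-trans (++⁺ʳ C q) p)) x₁∈ low₁
        where
        open ++-Solver renaming (_⊕_ to _∙_)
        shorter : length U₁ ≤ n
        shorter = linear 0 (T≥1 ⊞ le ⊞ ℕₚ.≤-reflexive (length-split {A = T} q)) (arith (length T) (length U₁) (length U) n)
          where
          arith : ∀ t u₁ u n → u₁ +ℕ (t +ℕ (suc n +ℕ u)) +ℕ 0 ≡ n +ℕ (1 +ℕ (u +ℕ (t +ℕ u₁)))
          arith = solve-∀
        -- An overlong `U` loses at most h terms, so the shortfall can still be padded from `Z`.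
        low₁ : card K ≤ k +ℕ h +ℕ length U₁
        low₁ = linear 1 (ℕₚ.≰⇒> over ⊞ T≤h ⊞ ℕₚ.≤-reflexive (sym (length-split {A = T} q)))
          (arith (card K) k h (length U₁) (length U) (length T))
          where
          arith : ∀ K k h u₁ u t → K +ℕ (k +ℕ u +ℕ (h +ℕ (t +ℕ u₁))) +ℕ 1 ≡ k +ℕ h +ℕ u₁ +ℕ (suc K +ℕ (t +ℕ u))
          arith = solve-∀
      ... | U′ , C′ , x′ , p′ , x′∈ , low′ , ok , e = U′ , C′ , x′ , p′ , x′∈ , low′ , ok , trans e
          (trans (abel (λ t x u → t ⊝ ⊖ x ⊕ u ≐ x ⊕ (t ⊕ u)) (total ψ T ∷ x ∷ total ψ U₁ ∷ []) refl)
            (cong (_+_ x) (trans (sym (total-++ ψ T U₁)) (total-↭ ψ q))))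

      Sel-mod-K₁ : ∀ {T u} → (∀ {t} → t ∈ T → t ∈ E₁) → Sel (vals β₀) T u → mem K₁ (u - total ψ T)
      Sel-mod-K₁ T⊆ [] = mem-- K₁ (ε∈ K₁) (ε∈ K₁)
      Sel-mod-K₁ T⊆ (_∷_ {t = t} {T} {x} b∈ s) with ∈-map⁻ _ b∈
      ... | a , a∈ , refl = mem-resp K₁
          (abel (λ u v β x y → u ⊝ v ⊕ (x ⊝ y) ≐ u ⊝ β ⊕ x ⊝ (v ⊝ β ⊕ y)) ((a · t) ∷ (a₀ · t) ∷ β₀ ∷ x ∷ total ψ T ∷ []) refl)
          (+-closed K₁ (E₁-single (T⊆ (here refl)) a∈ a₀∈W) (Sel-mod-K₁ (λ t∈ → T⊆ (there t∈)) s))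

      full : (∀ {z} → mem K z → ∃ λ x → ∃ λ u → x ∈ₛ X × Sel (λ t → ε ∷ ψ t ∷ []) R₂ u × z ≡ x + u) → ∀ {y} → mem K y → Sums β₀ (card K) P y
      full covers {y} y∈K = start (covers (+-closed K y∈K (mem-×ℕ K k β₀-β∈K)))
        where
        -- The k terms of `R₁` were summed with centre β and the target uses centre β₀; `z` is the
        -- target corrected for this.
        z = y + k ×ℕ (β₀ - β)

        finish : ∀ {U C x} → (U ++ C) ↭ V → x ∈ₛ X → card K ≤ k +ℕ h +ℕ length U → k +ℕ length U ≤ card K →
          mem K₁ (z - (x + total ψ U)) → Sums β₀ (card K) P y
        finish {U} {C} {x} p x∈ low high m = assemble
          where
          i = card K ∸ (k +ℕ length U)
          i-eq : i +ℕ (k +ℕ length U) ≡ card K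
          i-eq = ℕₚ.m∸n+n≡m high
          i≤Z : i ≤ length Z
          i≤Z = linear 0 (low ⊞ ℕₚ.≤-reflexive i-eq ⊞ ℕₚ.≤-reflexive (sym Z-length)) (arith i (length Z) k h (length U) (card K))
            where
            arith : ∀ i z k h u K → i +ℕ (k +ℕ h +ℕ u +ℕ (K +ℕ z)) +ℕ 0 ≡ z +ℕ (K +ℕ (i +ℕ (k +ℕ u) +ℕ h))
            arith = solve-∀
          Zᵢ = take i Z
          Zᵢ⊑Z₀ : Zᵢ ⊑ Z₀
          Zᵢ⊑Z₀ = ⊑-trans (take-⊑ i Z) (take-⊑ h Z₀)
          Zᵢ∈K₁ : mem K₁ (total ψ Zᵢ)
          Zᵢ∈K₁ = total-mem K₁ ψ λ t∈ → Z₀∈K₁ (⊑-∈ Zᵢ⊑Z₀ t∈)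
          -- The correction lies in `K₁`, the stabiliser under which `X` is periodic, so the sum
          -- becomes exact with the same number of terms.
          x′ = x + (z - (x + total ψ U) - total ψ Zᵢ)
          x′∈X : x′ ∈ₛ X
          x′∈X = X-periodic (mem-- K₁ m Zᵢ∈K₁) x∈
          assemble : Sums β₀ (card K) P y
          assemble = R₁ ++ (Zᵢ ++ U)
            , ⊑-++⁺ {A = R₁} {R₁} ⊑-refl (⊑-++⁺ {A = Zᵢ} {Z} {U} {V} (take-⊑ i Z) (C , p))
            , trans (List.length-++ R₁) (trans (cong (k +ℕ_) (trans (List.length-++ Zᵢ) (cong (_+ℕ length U) (length-take-≤ Z i≤Z))))
                (trans (arith k i (length U)) i-eq))
            , Sel-resp-≡ sum-eq (Sel-++ (Sel-recenter β₀ (X-sums x′∈X)) (Sel-++ (Sel-total β₀ Zᵢ) (Sel-total β₀ U)))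
            where
            arith : ∀ k i u → k +ℕ (i +ℕ u) ≡ i +ℕ (k +ℕ u)
            arith = solve-∀
            sum-eq : x′ - k ×ℕ (β₀ - β) + (total ψ Zᵢ + total ψ U) ≡ y
            sum-eq = abel (λ x y θ u v → x ⊕ (y ⊕ θ ⊝ (x ⊕ u) ⊝ v) ⊝ θ ⊕ (v ⊕ u) ≐ y)
                (x ∷ y ∷ k ×ℕ (β₀ - β) ∷ total ψ U ∷ total ψ Zᵢ ∷ []) refl

        start : (∃ λ x → ∃ λ u → x ∈ₛ X × Sel (λ t → ε ∷ ψ t ∷ []) R₂ u × z ≡ x + u) → Sums β₀ (card K) P y
        start (x , u , x∈ , s , z≡) with Sel-ε∷⁻ s
        ... | U₀ , C₀ , p₀ , s₀ with extend K K₁ {d} (DavProp-weaken {K} {K} {_≡ ε} {mem K₁} (λ m → m) (λ { refl → ε∈ K₁ }) davK) {g₀} {β₀}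
            (λ a a∈ → E₁-single g₀∈ a∈ a₀∈W) (length (C₀ ++ take j spare)) U₀ (C₀ ++ take j spare) ℕₚ.≤-refl
            (All.tabulate λ t∈ → Inside⇒mem K (insE₁ (⊑-∈ V⊑E₁ (∈-resp-↭ split₀ (∈-++⁺ʳ U₀ t∈)))) (insE₁ g₀∈)) (weights s₀)
          where
          weights : ∀ {T u} → Sel (λ t → ψ t ∷ []) T u → Sel (vals β₀) T u
          weights [] = []
          weights (here refl ∷ s) = ∈-vals a₀∈W ∷ weights s
          split₀ : (U₀ ++ (C₀ ++ take j spare)) ↭ V
          split₀ = ↭-trans (↭-reflexive (sym (List.++-assoc U₀ C₀ _))) (++⁺ʳ (take j spare) p₀)
        ... | U₁ , C₁ , u₁ , p₁ , small , s₁ , m₁ with shrink (length U₁) U₁ C₁ ℕₚ.≤-refl split₁ x∈ low₁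
          where
          split₁ : (U₁ ++ C₁) ↭ V
          split₁ = ↭-trans p₁ (↭-trans (↭-reflexive (sym (List.++-assoc U₀ C₀ _))) (++⁺ʳ (take j spare) p₀))
          low₁ : card K ≤ k +ℕ h +ℕ length U₁
          low₁ = linear 0 (small ⊞ ℕₚ.≤-reflexive (sym (length-split {A = U₁} split₁)) ⊞ ℕₚ.≤-reflexive (sym V-length))
            (arith (card K) k h (length U₁) (length C₁) d (length V))
            where
            arith : ∀ K k h u c d v → K +ℕ (d +ℕ (u +ℕ c +ℕ (k +ℕ h +ℕ v))) +ℕ 0 ≡ k +ℕ h +ℕ u +ℕ (c +ℕ (v +ℕ (K +ℕ d)))
            arith = solve-∀
        ... | U₂ , C₂ , x₂ , p₂ , x₂∈ , low₂ , high₂ , e₂ = finish {U₂} {C₂} p₂ x₂∈ low₂ high₂ (mem-resp K₁ eq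
            (⁻¹-closed K₁ (+-closed K₁ m₁ (⁻¹-closed K₁ (Sel-mod-K₁ (λ t∈ → ⊑-∈ V⊑E₁ (⊑-∈ (C₁ , split₁) t∈)) s₁)))))
          where
          split₁ : (U₁ ++ C₁) ↭ V
          split₁ = ↭-trans p₁ (↭-trans (↭-reflexive (sym (List.++-assoc U₀ C₀ _))) (++⁺ʳ (take j spare) p₀))
          eq : - (u₁ - u + - (u₁ - total ψ U₁)) ≡ z - (x₂ + total ψ U₂)
          eq = trans (abel (λ u u₁ t x → ⊖ (u₁ ⊝ u ⊕ ⊖ (u₁ ⊝ t)) ≐ x ⊕ u ⊝ (x ⊕ t)) (u ∷ u₁ ∷ total ψ U₁ ∷ x ∷ []) refl)
            (cong₂ _-_ (sym z≡) (sym e₂))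

    class-size : Subgroup → List Carrier → Carrier → ℕ
    class-size K E g = length (filter (λ s → dec K ((a₀ · s) - (a₀ · g))) E)

    -- Terms with equal ψ-value are congruent modulo `K`, so they lie in one class, and the class of
    -- `g` is largest.
    multiplicity≤class-size : ∀ K E g → (∀ {t} → t ∈ E → class-size K E t ≤ class-size K E g) →
      ∀ c → multiplicity (λ t → (a₀ · t) - (a₀ · g)) c E ≤ class-size K E g
    multiplicity≤class-size K E g max c = cases (Any.any? (λ t → ψ t ≟ c) E)
      where
      ψ : Carrier → Carrier
      ψ t = (a₀ · t) - (a₀ · g)
      attained : (∃ λ t → t ∈ E × ψ t ≡ c) → multiplicity ψ c E ≤ class-size K E g
      attained (t , t∈ , e) = ℕₚ.≤-trans
        (length-filter-mono (λ s → ψ s ≟ c) (λ s → dec K ((a₀ · s) - (a₀ · t)))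
          (λ {s} e′ → mem-resp K (trans (sym (inverseʳ (ψ t))) (trans (cong (_- ψ t) (trans e (sym e′)))
            (abel (λ u v β → u ⊝ β ⊝ (v ⊝ β) ≐ u ⊝ v) ((a₀ · s) ∷ (a₀ · t) ∷ (a₀ · g) ∷ []) refl))) (ε∈ K)) E)
        (max t∈)
      cases : Dec (Any (λ t → ψ t ≡ c) E) → multiplicity ψ c E ≤ class-size K E g
      cases (no none) = ℕₚ.≤-trans (ℕₚ.≤-reflexive (cong length (List.filter-none (λ t → ψ t ≟ c) (Allₚ.¬Any⇒All¬ E none)))) z≤n
      cases (yes some) = attained (find some)

    -- Two greedy scans: filled or concentrated

    module Greedy (K : Subgroup) {β : Carrier} {Q : List Carrier} (insQ : All (Inside K β) Q)
      {d : ℕ} (davK : DavProp W K (_≡ ε) (suc d)) (long : card K +ℕ d ≤ length Q) where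

      scan₁ = scan (vals β) ⟨ε⟩ Q
      R₁ = proj₁ scan₁
      E₁ = proj₁ (proj₂ scan₁)
      Q-split : (R₁ ++ E₁) ↭ Q
      Q-split = proj₁ (proj₂ (proj₂ scan₁))
      k = length R₁

      X : FinSet
      X = sumset (vals β) ⟨ε⟩ R₁

      K₁ : Subgroup
      K₁ = stab X

      k<X : suc k ≤ size X
      k<X = ℕₚ.≤-trans (ℕₚ.≤-trans (ℕₚ.≤-reflexive (ℕₚ.+-comm 1 k)) (ℕₚ.+-monoʳ-≤ k (size-nonempty ⟨ε⟩ refl)))
        (proj₁ (proj₂ (proj₂ (proj₂ scan₁))))

      E₁-single : ∀ {e a a′} → e ∈ E₁ → a ∈ W → a′ ∈ W → mem K₁ ((a · e) - (a′ · e))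
      E₁-single {e} {a} {a′} e∈ a∈ a′∈ = mem-resp K₁
        (abel (λ u v β → u ⊝ β ⊝ (v ⊝ β) ≐ u ⊝ v) ((a · e) ∷ (a′ · e) ∷ β ∷ []) refl)
        (proj₂ (proj₂ (proj₂ (proj₂ scan₁))) e∈ (∈-vals a∈) (∈-vals a′∈))

      insR₁ : ∀ {t} → t ∈ R₁ → Inside K β t
      insR₁ t∈ = All.lookup insQ (∈-resp-↭ Q-split (∈-++⁺ˡ t∈))
      insE₁ : ∀ {t} → t ∈ E₁ → Inside K β t
      insE₁ t∈ = All.lookup insQ (∈-resp-↭ Q-split (∈-++⁺ʳ R₁ t∈))

      X⊆K : X ⊆ₛ ⟪ K ⟫
      X⊆K = sumset⊆ (vals β) K ⟨ε⟩ R₁ (λ { refl → ε∈ K }) (λ t∈ → vals-Inside K (insR₁ t∈))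

      X-inhabited : ∃ λ x → x ∈ₛ X
      X-inhabited = _ , sumset-intro (vals β) ⟨ε⟩ R₁ refl (Sel-total β R₁)

      X≤K : size X ≤ card K
      X≤K = size-mono X ⟪ K ⟫ X⊆K

      Q-length : k +ℕ length E₁ ≡ length Q
      Q-length = length-split {A = R₁} Q-split

      E₁-nonempty : 1 ≤ length E₁
      E₁-nonempty = linear d (long ⊞ X≤K ⊞ k<X ⊞ ℕₚ.≤-reflexive (sym Q-length))
        (arith (length E₁) d (card K) (length Q) (size X) k)
        where
        arith : ∀ e d K q x k → 1 +ℕ (q +ℕ (K +ℕ (x +ℕ (k +ℕ e)))) +ℕ d ≡ e +ℕ (K +ℕ d +ℕ (x +ℕ (suc k +ℕ q)))
        arith = solve-∀

      heaviest = argmax (class-size K₁ E₁) {E₁} E₁-nonempty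
      g₀ = proj₁ heaviest
      g₀∈ : g₀ ∈ E₁
      g₀∈ = proj₁ (proj₂ heaviest)
      β₀ = a₀ · g₀

      ψ : Carrier → Carrier
      ψ s = (a₀ · s) - β₀

      class? : Decidable (λ s → mem K₁ (ψ s))
      class? s = dec K₁ (ψ s)

      Z₀ = filter class? E₁
      N  = filter (∁? class?) E₁

      scan₂ = scan (λ t → ε ∷ ψ t ∷ []) X N
      R₂ = proj₁ scan₂
      E₂ = proj₁ (proj₂ scan₂)
      N-split : (R₂ ++ E₂) ↭ N
      N-split = proj₁ (proj₂ (proj₂ scan₂))

      Y : FinSet
      Y = sumset (λ t → ε ∷ ψ t ∷ []) X R₂

      E₁-split : (Z₀ ++ (R₂ ++ E₂)) ↭ E₁
      E₁-split = ↭-trans (++⁺ˡ Z₀ N-split) (filter-∁-↭ class? E₁)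

      Q-split₂ : (R₁ ++ (Z₀ ++ (R₂ ++ E₂))) ↭ Q
      Q-split₂ = ↭-trans (++⁺ˡ R₁ E₁-split) Q-split

      R₂⊑E₁ : R₂ ⊑ E₁
      R₂⊑E₁ = ⊑-trans (E₂ , N-split) (⊑-trans (⊑-++ʳ Z₀ N) (⊑-reflexive (filter-∁-↭ class? E₁)))
      E₂⊑E₁ : E₂ ⊑ E₁
      E₂⊑E₁ = ⊑-trans (⊑-trans (⊑-++ʳ R₂ E₂) (⊑-reflexive N-split)) (⊑-trans (⊑-++ʳ Z₀ N) (⊑-reflexive (filter-∁-↭ class? E₁)))

      Y-large : suc (k +ℕ length R₂) ≤ size Y
      Y-large = linear 0 (k<X ⊞ proj₁ (proj₂ (proj₂ (proj₂ scan₂)))) (arith k (length R₂) (size X) (size Y))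
        where
        arith : ∀ k r x y → suc (k +ℕ r) +ℕ (x +ℕ y) +ℕ 0 ≡ y +ℕ (suc k +ℕ (r +ℕ x))
        arith = solve-∀

      ψ∈K : ∀ {t} → t ∈ E₁ → mem K (ψ t)
      ψ∈K {t} t∈ = mem-resp K (abel (λ u v β → u ⊝ β ⊝ (v ⊝ β) ≐ u ⊝ v) ((a₀ · t) ∷ β₀ ∷ β ∷ []) refl)
        (mem-- K (insE₁ t∈ a₀ a₀∈W) (insE₁ g₀∈ a₀ a₀∈W))

      Y⊆K : Y ⊆ₛ ⟪ K ⟫
      Y⊆K = sumset⊆ (λ t → ε ∷ ψ t ∷ []) K X R₂ X⊆K λ
        { t∈ (here refl) → ε∈ K ; t∈ (there (here refl)) → ψ∈K (⊑-∈ R₂⊑E₁ t∈) }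

      Y≤K : size Y ≤ card K
      Y≤K = size-mono Y ⟪ K ⟫ Y⊆K

      β₀-β∈K : mem K (β₀ - β)
      β₀-β∈K = insE₁ g₀∈ a₀ a₀∈W

      M : Subgroup
      M = stab Y

      M≤K : M ≤G K
      M≤K = stab≤ Y K (sumset-intro (λ t → ε ∷ ψ t ∷ []) X R₂ (proj₂ X-inhabited) (zeros R₂)) Y⊆K
        where
        zeros : ∀ T → Sel (λ t → ε ∷ ψ t ∷ []) T (total (λ _ → ε) T)
        zeros [] = []
        zeros (t ∷ T) = here refl ∷ zeros T

      E₁-Inside : ∀ {s} → s ∈ E₁ → mem M (ψ s) → Inside M β₀ s
      E₁-Inside {s} s∈ m a a∈ = mem-resp M (abel (λ u v β → u ⊝ v ⊕ (v ⊝ β) ≐ u ⊝ β) ((a · s) ∷ (a₀ · s) ∷ β₀ ∷ []) refl)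
        (+-closed M (λ x → stab-sumset _ X R₂ (λ y → E₁-single s∈ a∈ a₀∈W y) x) m)

      -- Terms of `Z₀` are congruent to `g₀` already modulo `K₁ ≤ M`, and rejection by the second
      -- scan puts ψ of a term of `E₂` into `M`. Moreover |Y| > |R₁| + |R₂|, while `Y` misses a
      -- whole coset of `M` in `K`.
      stuck : ∀ {z} → mem K z → ¬ z ∈ₛ Y →
        All (Inside M β₀) (Z₀ ++ E₂) × ((Z₀ ++ E₂) ++ (R₁ ++ R₂)) ↭ Q × suc (length (R₁ ++ R₂) +ℕ card M) ≤ card K
      stuck z∈K z∉Y = Allₚ.++⁺
          (All.tabulate λ s∈ → E₁-Inside (proj₁ (∈-filter⁻ class? {xs = E₁} s∈))
            (λ x → stab-sumset _ X R₂ (proj₂ (∈-filter⁻ class? {xs = E₁} s∈)) x))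
          (All.tabulate λ {s} s∈ → E₁-Inside (⊑-∈ E₂⊑E₁ s∈) (mem-resp M (abel (λ u → u ⊝ 𝟘 ≐ u) (ψ s ∷ []) refl)
            (proj₂ (proj₂ (proj₂ (proj₂ scan₂))) s∈ (there (here refl)) (here refl))))
        , ↭-trans (solve 4 (λ z e r s → (z ∙ e) ∙ (r ∙ s) ⊜ r ∙ (z ∙ (s ∙ e))) ↭-refl Z₀ E₂ R₁ R₂) Q-split₂
        , linear 0 (Y-large ⊞ size-coset M Y ⟪ K ⟫ Y⊆K (stab-+ Y) (λ h∈ x∈ → +-closed K x∈ (M≤K h∈)) z∈K z∉Y
              ⊞ ℕₚ.≤-reflexive (List.length-++ R₁))
            (arith (length (R₁ ++ R₂)) (card M) (card K) (size Y) k (length R₂))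
        where
        open ++-Solver renaming (_⊕_ to _∙_)
        arith : ∀ o m K y k r → suc (o +ℕ m) +ℕ (y +ℕ (K +ℕ (k +ℕ r))) +ℕ 0 ≡ K +ℕ (suc (k +ℕ r) +ℕ (m +ℕ y +ℕ o))
        arith = solve-∀

      X-sums : ∀ {x} → x ∈ₛ X → Sel (vals β) R₁ x
      X-sums x∈ = strip (sumset-elim (vals β) ⟨ε⟩ R₁ x∈)
        where
        strip : ∀ {x} → (∃ λ u → ∃ λ w → u ≡ ε × Sel (vals β) R₁ w × x ≡ u + w) → Sel (vals β) R₁ x
        strip (_ , w , refl , s , e) = Sel-resp-≡ (trans (sym (identityˡ w)) (sym e)) s

      module F = Fill K K₁ X β g₀ R₁ E₁ Z₀ R₂ E₂ E₁-split insE₁ g₀∈ E₁-single X⊆K X-sums (stab-+ X) k<X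
        (λ t∈ → proj₂ (∈-filter⁻ class? {xs = E₁} t∈)) (multiplicity≤class-size K₁ E₁ g₀ (proj₂ (proj₂ heaviest)))
        davK (ℕₚ.≤-trans long (ℕₚ.≤-reflexive (sym Q-length))) (ℕₚ.≤-trans Y-large Y≤K)

    Full : Subgroup → Carrier → List Carrier → Set
    Full K β P = ∀ {y} → mem K y → Sums β (card K) P y

    record Filled (K : Subgroup) (β : Carrier) (Q : List Carrier) (d : ℕ) : Set where
      field
        β₀       : Carrier
        β₀-β∈K   : mem K (β₀ - β)
        P rest   : List Carrier
        P-split  : (P ++ rest) ↭ Q
        P-length : length P ≡ card K +ℕ d
        P-full   : Full K β₀ P

    -- The strict bound `few` makes |M| < |K|, so the descent ends; it also lets the exceptional
    -- terms of successive steps telescope.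
    record Concentrated (K : Subgroup) (β : Carrier) (Q : List Carrier) : Set₁ where
      field
        M        : Subgroup
        M≤K      : M ≤G K
        β₀       : Carrier
        β₀-β∈K   : mem K (β₀ - β)
        Q′ O′    : List Carrier
        Q-split  : (Q′ ++ O′) ↭ Q
        inside   : All (Inside M β₀) Q′
        few      : suc (length O′ +ℕ card M) ≤ card K

    opaque
      dichotomy : ∀ K {β Q d} → All (Inside K β) Q → DavProp W K (_≡ ε) (suc d) → card K +ℕ d ≤ length Q →
        Filled K β Q d ⊎ Concentrated K β Q
      dichotomy K {β} {Q} {d} insQ davK long = cases (escapes? ⟪ K ⟫ Y)
        where
        open Greedy K insQ davK long
        cases : (∃ λ z → mem K z × ¬ z ∈ₛ Y) ⊎ (⟪ K ⟫ ⊆ₛ Y) → Filled K β Q d ⊎ Concentrated K β Q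
        cases (inj₁ (z , z∈ , z∉)) = conclude (stuck z∈ z∉)
          where
          conclude : All (Inside M β₀) (Z₀ ++ E₂) × ((Z₀ ++ E₂) ++ (R₁ ++ R₂)) ↭ Q × suc (length (R₁ ++ R₂) +ℕ card M) ≤ card K →
            Filled K β Q d ⊎ Concentrated K β Q
          conclude (ins , p , few) = inj₂ record
            { M = M ; M≤K = M≤K ; β₀ = β₀ ; β₀-β∈K = β₀-β∈K ; Q′ = Z₀ ++ E₂ ; O′ = R₁ ++ R₂ ; Q-split = p ; inside = ins ; few = few }
        cases (inj₂ K⊆Y) = inj₁ record
          { β₀ = β₀ ; β₀-β∈K = β₀-β∈K ; P = F.P ; rest = drop F.j F.spare ; P-split = ↭-trans F.P-split Q-split
          ; P-length = F.P-length ; P-full = F.full λ z∈ → sumset-elim (λ t → ε ∷ ψ t ∷ []) X R₂ (K⊆Y z∈) }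

    -- First descent: finding a filled subgroup

    module Concentration (G : Subgroup) {dG : ℕ} (davG : DavProp W G (_≡ ε) dG) {S : List Carrier} (long : card G +ℕ dG ≤ suc (length S)) where

      record Core (β : Carrier) : Set₁ where
        field
          K        : Subgroup
          K≤G      : K ≤G G
          β₀       : Carrier
          β₀-β∈G   : mem G (β₀ - β)
          P Q O    : List Carrier
          S-split  : ((P ++ Q) ++ O) ↭ S
          inside   : All (Inside K β₀) (P ++ Q)
          few      : length O +ℕ card K ≤ card G
          dK       : ℕ
          isDavK   : IsDav W K dK
          P-length : suc (length P) ≡ card K +ℕ dK
          P-full   : Full K β₀ P

      opaque
        core : ∀ n K → card K ≤ n → K ≤G G → ∀ {β β₁ Q O} → mem G (β₁ - β) → (Q ++ O) ↭ S → All (Inside K β₁) Q →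
          length O +ℕ card K ≤ card G → Core β
        core zero K le _ _ _ _ _ = ⊥-elim (ℕₚ.<⇒≱ (size-nonempty ⟪ K ⟫ (ε∈ K)) le)
        core (suc n) K le K≤G {β} {β₁} {Q} {O} m p ins few
          with davenport K (_≟ ε) dG (DavProp-weaken {G} {K} {_≡ ε} {_≡ ε} K≤G (λ e → e) davG)
        ... | dK , davK , minK with DavProp-pos {K} {_≡ ε} davK
        ... | d , refl with dichotomy K ins davK enough
          where
          -- At most |G| - |K| terms have been set aside and D_A(K) ≤ D_A(G), so the hypothesis on
          -- |S| for `G` passes to `Q` and `K`.
          enough : card K +ℕ d ≤ length Q
          enough = linear 0 (long ⊞ few ⊞ minK dG (DavProp-weaken {G} {K} {_≡ ε} {_≡ ε} K≤G (λ e → e) davG)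
              ⊞ ℕₚ.≤-reflexive (sym (length-split {A = Q} p)))
            (arith (card K) d (length Q) (card G) dG (length S) (length O))
            where
            arith : ∀ K d q G D s o → K +ℕ d +ℕ (suc s +ℕ (G +ℕ (D +ℕ (q +ℕ o)))) +ℕ 0 ≡ q +ℕ (G +ℕ D +ℕ (o +ℕ K +ℕ (suc d +ℕ s)))
            arith = solve-∀
        ... | inj₁ f = record
            { K = K ; K≤G = K≤G ; β₀ = β₀ ; β₀-β∈G = mem-resp G (abel (λ x y z → x ⊝ y ⊕ (y ⊝ z) ≐ x ⊝ z) (β₀ ∷ β₁ ∷ β ∷ []) refl)
                (+-closed G (K≤G β₀-β∈K) m)
            ; P = P ; Q = rest ; O = O ; S-split = ↭-trans (++⁺ʳ O P-split) p
            ; inside = All-resp-↭ (↭-sym P-split) (All.map (Inside-recenter K β₀-β∈K) ins) ; few = few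
            ; dK = suc d ; isDavK = davK , minK ; P-length = trans (cong suc P-length) (sym (ℕₚ.+-suc (card K) d)) ; P-full = P-full }
          where open Filled f
        ... | inj₂ c = core n M (ℕₚ.≤-pred (ℕₚ.≤-trans (ℕₚ.≤-trans (s≤s (ℕₚ.m≤n+m (card M) (length O′))) c-few) le))
            (λ x∈ → K≤G (M≤K x∈)) {β} {β₀} {Q′} {O′ ++ O}
            (mem-resp G (abel (λ x y z → x ⊝ y ⊕ (y ⊝ z) ≐ x ⊝ z) (β₀ ∷ β₁ ∷ β ∷ []) refl) (+-closed G (K≤G β₀-β∈K) m))
            (↭-trans (↭-reflexive (sym (List.++-assoc Q′ O′ O))) (↭-trans (++⁺ʳ O Q-split) p)) inside
            (linear 1 (few ⊞ c-few ⊞ ℕₚ.≤-reflexive (List.length-++ O′))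
              (arith (length (O′ ++ O)) (card M) (card G) (length O) (card K) (length O′)))
          where
          open Concentrated c renaming (few to c-few)
          arith : ∀ l M G o K o′ → l +ℕ M +ℕ (G +ℕ (K +ℕ (o′ +ℕ o))) +ℕ 1 ≡ G +ℕ (o +ℕ K +ℕ (suc (o′ +ℕ M) +ℕ l))
          arith = solve-∀

    -- Second descent: from the filled K to H

    module Descent (G : Subgroup) {dG : ℕ} (davG : DavProp W G (_≡ ε) dG) {S : List Carrier} (long : card G +ℕ dG ≤ suc (length S))
      (K : Subgroup) (K≤G : K ≤G G) (β : Carrier) (P Q O : List Carrier) (S-split : ((P ++ Q) ++ O) ↭ S)
      (inside : All (Inside K β) (P ++ Q)) (few : length O +ℕ card K ≤ card G) (dK : ℕ) (isDavK : IsDav W K dK)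
      (P-length : suc (length P) ≡ card K +ℕ dK) (P-full : Full K β P) where

      record Structure : Set₁ where
        field
          H         : Subgroup
          H≤G       : H ≤G G
          dH        : ℕ
          isDavH    : IsDav W H dH
          S″ T R    : List Carrier
          S-split′  : ((S″ ++ T) ++ R) ↭ S
          inside′   : All (Inside H β) (S″ ++ T)
          R-few     : Few G H (length R)
          S″-length : suc (length S″) ≡ card H +ℕ dH
          S″-full   : Full H β S″

      B : Carrier → List Carrier
      B t = ε ∷ vals β t

      davH≤ : ∀ H → H ≤G G → DavProp W H (_≡ ε) dG
      davH≤ H H≤G = DavProp-weaken {G} {H} {_≡ ε} {_≡ ε} H≤G (λ e → e) davG

      P-nonempty : 1 ≤ length P
      P-nonempty = ℕₚ.≤-pred (ℕₚ.≤-trans (ℕₚ.+-mono-≤ (card-pos K) dK-pos) (ℕₚ.≤-reflexive (sym P-length)))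
        where
        dK-pos : 1 ≤ dK
        dK-pos with DavProp-pos {K} {_≡ ε} (proj₁ isDavK)
        ... | d , refl = s≤s z≤n

      base : ∃ λ α → α ∈ P
      base = length⇒∈ {xs = P} P-nonempty

      α = proj₁ base

      α-inside : Inside K β α
      α-inside = All.lookup inside (∈-++⁺ˡ (proj₂ base))

      -- Optional sums over `R₁` reach every coset of `K` in `H`, and `P` supplies `K`. It remains
      -- to bring these sums to length |H|, using `m` further terms from `Q` and `E₁` so that `S″`
      -- has exactly |H| + D_A(H) - 1 terms.
      reached : ∀ H → K ≤G H → H ≤G G → ∀ {R R₁ E₁} → (R₁ ++ (E₁ ++ R)) ↭ O → All (Inside H β) (R₁ ++ E₁) → Few G H (length R) →
        length R₁ +ℕ card K ≤ card H → ⟪ H ⟫ ⊆ₛ sumset B ⟪ K ⟫ R₁ → Structure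
      reached H K≤H H≤G {R} {R₁} {E₁} O-split ins R-few R₁-small covers
        with davenport H (_≟ ε) dG (davH≤ H H≤G)
          | davenport H (dec K) dG (DavProp-weaken {G} {H} {_≡ ε} {mem K} H≤G (λ { refl → ε∈ K }) davG)
      ... | dH , davH , minH | dQ , davQ , minQ with DavProp-pos {H} {mem K} davQ
      ... | e , refl = build (distribute m Q E₁ m≤)
        where
        dK≤dH : dK ≤ dH
        dK≤dH = proj₂ isDavK dH (DavProp-weaken {H} {K} {_≡ ε} {_≡ ε} K≤H (λ e → e) davH)
        m = card H +ℕ dH ∸ (card K +ℕ dK +ℕ length R₁)
        m-eq : m +ℕ (card K +ℕ dK +ℕ length R₁) ≡ card H +ℕ dH
        m-eq = ℕₚ.m∸n+n≡m {card H +ℕ dH} {card K +ℕ dK +ℕ length R₁} (linear 0 (R₁-small ⊞ dK≤dH) (arith (card K) dK (length R₁) (card H) dH))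
          where
          arith : ∀ K d r H D → K +ℕ d +ℕ r +ℕ (H +ℕ D) +ℕ 0 ≡ H +ℕ D +ℕ (r +ℕ K +ℕ d)
          arith = solve-∀
        S-count : length P +ℕ length Q +ℕ length O ≡ length S
        S-count = trans (cong (_+ℕ length O) (sym (List.length-++ P))) (length-split {A = P ++ Q} S-split)
        O-count : length R₁ +ℕ (length E₁ +ℕ length R) ≡ length O
        O-count = trans (cong (length R₁ +ℕ_) (sym (List.length-++ E₁))) (length-split {A = R₁} O-split)
        m≤ : m ≤ length Q +ℕ length E₁
        m≤ = linear 0 (long ⊞ few⇒room {G} {H} H≤G R-few ⊞ minH dG (davH≤ H H≤G) ⊞ ℕₚ.≤-reflexive (sym S-count) ⊞ ℕₚ.≤-reflexive (sym O-count)
            ⊞ ℕₚ.≤-reflexive m-eq ⊞ ℕₚ.≤-reflexive P-length)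
          (arith m (length Q) (length E₁) (card G) dG (length S) (length R) (card H) dH (length P) (length O) (length R₁) (card K) dK)
          where
          arith : ∀ m q e G D s r H d p o r₁ K k →
            m +ℕ (suc s +ℕ (G +ℕ (D +ℕ (p +ℕ q +ℕ o +ℕ (r₁ +ℕ (e +ℕ r) +ℕ (H +ℕ d +ℕ (K +ℕ k))))))) +ℕ 0
            ≡ q +ℕ e +ℕ (G +ℕ D +ℕ (r +ℕ H +ℕ (d +ℕ (s +ℕ (o +ℕ (m +ℕ (K +ℕ k +ℕ r₁) +ℕ suc p))))))
          arith = solve-∀
        build : (∃ λ Q₁ → ∃ λ Q₂ → ∃ λ E′ → ∃ λ E″ → (Q₁ ++ Q₂) ↭ Q × (E′ ++ E″) ↭ E₁ × length Q₁ +ℕ length E′ ≡ m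
          × (length E′ ≡ 0 ⊎ length Q₁ ≡ length Q)) → Structure
        build (Q₁ , Q₂ , E′ , E″ , pQ , pE , V-len , extremal) = record
            { H = H ; H≤G = H≤G ; dH = dH ; isDavH = davH , minH ; S″ = P ++ (Q₁ ++ (R₁ ++ E′)) ; T = Q₂ ++ E″ ; R = R
            ; S-split′ = ↭-trans (solve 7 (λ p q₁ r e q₂ f r′ → ((p ∙ (q₁ ∙ (r ∙ e))) ∙ (q₂ ∙ f)) ∙ r′
                  ⊜ (p ∙ (q₁ ∙ q₂)) ∙ (r ∙ ((e ∙ f) ∙ r′))) ↭-refl P Q₁ R₁ E′ Q₂ E″ R)
                (↭-trans (++⁺ (++⁺ˡ P pQ) (↭-trans (++⁺ˡ R₁ (++⁺ʳ R pE)) O-split)) S-split)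
            ; inside′ = All-resp-↭ (↭-trans (++⁺ (++⁺ˡ P (↭-sym pQ)) (++⁺ˡ R₁ (↭-sym pE)))
                  (solve 6 (λ p q₁ q₂ r e f → (p ∙ (q₁ ∙ q₂)) ∙ (r ∙ (e ∙ f)) ⊜ (p ∙ (q₁ ∙ (r ∙ e))) ∙ (q₂ ∙ f)) ↭-refl P Q₁ Q₂ R₁ E′ E″))
                (Allₚ.++⁺ (All.map (λ f a a∈ → K≤H (f a a∈)) inside) ins)
            ; R-few = R-few ; S″-length = S″-len ; S″-full = filled }
          where
          open ++-Solver renaming (_⊕_ to _∙_)
          V-eq : length Q₁ +ℕ length E′ +ℕ (card K +ℕ dK +ℕ length R₁) ≡ card H +ℕ dH
          V-eq = trans (cong (_+ℕ (card K +ℕ dK +ℕ length R₁)) V-len) m-eq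
          S″-len : suc (length (P ++ (Q₁ ++ (R₁ ++ E′)))) ≡ card H +ℕ dH
          S″-len = trans (cong suc (trans (List.length-++ P) (cong (length P +ℕ_) (trans (List.length-++ Q₁) (cong (length Q₁ +ℕ_) (List.length-++ R₁))))))
            (trans (cong (_+ℕ (length Q₁ +ℕ (length R₁ +ℕ length E′))) P-length)
              (trans (arith (card K) dK (length Q₁) (length R₁) (length E′)) V-eq))
            where
            arith : ∀ K d q r e → K +ℕ d +ℕ (q +ℕ (r +ℕ e)) ≡ q +ℕ e +ℕ (K +ℕ d +ℕ r)
            arith = solve-∀
          dH≤ : dH ≤ length Q +ℕ dK
          dH≤ = linear 0 (long ⊞ few ⊞ minH dG (davH≤ H H≤G) ⊞ ℕₚ.≤-reflexive P-length
              ⊞ ℕₚ.≤-reflexive (sym S-count))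
            (arith dH (length Q) dK (card G) dG (length S) (length O) (card K) (length P))
            where
            arith : ∀ d q k G D s o K p → d +ℕ (suc s +ℕ (G +ℕ (D +ℕ (K +ℕ k +ℕ (p +ℕ q +ℕ o))))) +ℕ 0
              ≡ q +ℕ k +ℕ (G +ℕ D +ℕ (o +ℕ K +ℕ (d +ℕ (suc p +ℕ s))))
            arith = solve-∀
          -- Terms of `E₁` need not lie in β + K, so they are drawn only after `Q` is used up. In
          -- that case D_A(H) ≤ |Q| + D_A(K) limits their number.
          room : card K +ℕ length (R₁ ++ E′) ≤ card H
          room = subst (λ l → card K +ℕ l ≤ card H) (sym (List.length-++ R₁)) (cases extremal)
            where
            cases : length E′ ≡ 0 ⊎ length Q₁ ≡ length Q → card K +ℕ (length R₁ +ℕ length E′) ≤ card H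
            cases (inj₁ z) = linear 0 (R₁-small ⊞ ℕₚ.≤-reflexive z) (arith (card K) (length R₁) (length E′) (card H))
              where
              arith : ∀ K r e H → K +ℕ (r +ℕ e) +ℕ (H +ℕ 0) +ℕ 0 ≡ H +ℕ (r +ℕ K +ℕ e)
              arith = solve-∀
            cases (inj₂ z) = linear 0 (ℕₚ.≤-reflexive V-eq ⊞ dH≤ ⊞ ℕₚ.≤-reflexive (sym z))
                (arith (card K) (length R₁) (length E′) (card H) dH (length Q) dK (length Q₁))
              where
              arith : ∀ K r e H d q k q₁ → K +ℕ (r +ℕ e) +ℕ (H +ℕ d +ℕ (q +ℕ k +ℕ q₁)) +ℕ 0 ≡ H +ℕ (q₁ +ℕ e +ℕ (K +ℕ k +ℕ r) +ℕ (d +ℕ q))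
              arith = solve-∀
          enough : card H +ℕ e ≤ card K +ℕ length Q₁ +ℕ length (R₁ ++ E′)
          enough = subst (λ l → card H +ℕ e ≤ card K +ℕ length Q₁ +ℕ l) (sym (List.length-++ R₁))
            (linear 0 (davenport-quotient H K K≤H (davH , minH) isDavK (davQ , minQ) ⊞ ℕₚ.≤-reflexive (sym V-eq))
              (arith (card H) e (card K) (length Q₁) (length R₁) (length E′) dH dK))
            where
            arith : ∀ H e K q r f d k → H +ℕ e +ℕ (suc d +ℕ (q +ℕ f +ℕ (K +ℕ k +ℕ r))) +ℕ 0 ≡ K +ℕ q +ℕ (r +ℕ f) +ℕ (k +ℕ suc e +ℕ (H +ℕ d))
            arith = solve-∀
          filled : Full H β (P ++ (Q₁ ++ (R₁ ++ E′)))
          filled {y} y∈ with sumset-elim B ⟪ K ⟫ R₁ (covers y∈)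
          ... | κ , x , κ∈ , s , y≡ with Sel-ε∷⁻ s
          ... | U , C , p , s′ = sums-of-extension H K davQ α-inside {N = card H} {P = P} {Q = Q₁} {O = R₁ ++ E′} {U = U} {C = C ++ E′}
              P-full (Allₚ.++⁻ˡ Q₁ (All-resp-↭ (↭-sym pQ) (Allₚ.++⁻ʳ P inside)))
              (Allₚ.++⁻ˡ (R₁ ++ E′) (All-resp-↭ (↭-trans (++⁺ˡ R₁ (↭-sym pE)) (↭-reflexive (sym (List.++-assoc R₁ E′ E″))))
                (All.map (λ f → Inside⇒mem H f (λ a a∈ → K≤H (α-inside a a∈))) ins)))
              room enough (↭-trans (↭-reflexive (sym (List.++-assoc U C E′))) (++⁺ʳ E′ p)) s′
              (mem-resp K (trans (abel (λ κ x → κ ≐ κ ⊕ x ⊝ x) (κ ∷ x ∷ []) refl) (cong (_- x) (sym y≡))) κ∈)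

      opaque
        descend : ∀ n H → card H ≤ n → K ≤G H → H ≤G G → ∀ {L R} → (L ++ R) ↭ O → All (Inside H β) L → Few G H (length R) → Structure
        descend zero H le _ _ _ _ _ = ⊥-elim (ℕₚ.<⇒≱ (card-pos H) le)
        descend (suc n) H le K≤H H≤G {L} {R} O-split ins R-few with scan B ⟪ K ⟫ L
        ... | R₁ , E₁ , p , grow , single = cases (escapes? ⟪ H ⟫ Y)
          where
          Y : FinSet
          Y = sumset B ⟪ K ⟫ R₁
          ins′ : All (Inside H β) (R₁ ++ E₁)
          ins′ = All-resp-↭ (↭-sym p) ins
          Y⊆H : Y ⊆ₛ ⟪ H ⟫
          Y⊆H = sumset⊆ B H ⟪ K ⟫ R₁ K≤H λ
            { t∈ (here refl) → ε∈ H ; t∈ (there b∈) → vals-Inside H (All.lookup ins′ (∈-++⁺ˡ t∈)) b∈ }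
          M : Subgroup
          M = stab Y
          K≤M : K ≤G M
          K≤M = stab-sumset-subgroup B (λ _ → here refl) K R₁
          ε∈Y : ε ∈ₛ Y
          ε∈Y = subst (_∈ₛ Y) (trans (identityˡ _) (zeros R₁)) (sumset-intro B ⟪ K ⟫ R₁ (ε∈ K) (sel R₁))
            where
            sel : ∀ T → Sel B T (total (λ _ → ε) T)
            sel [] = []
            sel (t ∷ T) = here refl ∷ sel T
            zeros : ∀ T → total (λ _ → ε) T ≡ ε
            zeros [] = refl
            zeros (t ∷ T) = trans (identityˡ _) (zeros T)
          M≤H : M ≤G H
          M≤H = stab≤ Y H ε∈Y Y⊆H
          In? : Decidable (Inside M β)
          In? = Inside? M β
          cases : (∃ λ z → z ∈ₛ ⟪ H ⟫ × ¬ z ∈ₛ Y) ⊎ (⟪ H ⟫ ⊆ₛ Y) → Structure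
          cases (inj₂ covers) = reached H K≤H H≤G {R} {R₁} {E₁}
            (↭-trans (↭-reflexive (sym (List.++-assoc R₁ E₁ R))) (↭-trans (++⁺ʳ R p) O-split)) ins′ R-few
            (ℕₚ.≤-trans grow (size-mono Y ⟪ H ⟫ Y⊆H)) covers
          -- Terms kept by the scan are sorted once more: those inside β + M rejoin the rejected
          -- ones, and only the others become exceptional.
          cases (inj₁ (z , z∈ , z∉)) = descend n M
              (ℕₚ.≤-pred (ℕₚ.≤-trans (ℕₚ.≤-trans (ℕₚ.≤-reflexive (ℕₚ.+-comm 1 (card M))) (ℕₚ.≤-trans (ℕₚ.+-monoʳ-≤ (card M) (size-nonempty Y ε∈Y)) M+Y≤H)) le))
              K≤M (λ x∈ → H≤G (M≤H x∈)) {E₁ ++ filter In? R₁} {filter (∁? In?) R₁ ++ R}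
              (↭-trans (solve 4 (λ e i o r → (e ∙ i) ∙ (o ∙ r) ⊜ ((i ∙ o) ∙ e) ∙ r) ↭-refl E₁ (filter In? R₁) (filter (∁? In?) R₁) R)
                (↭-trans (++⁺ʳ R (↭-trans (++⁺ʳ E₁ (filter-∁-↭ In? R₁)) p)) O-split))
              (Allₚ.++⁺ (All.tabulate λ {s} s∈ a a∈ → mem-resp M (abel (λ u → u ⊝ 𝟘 ≐ u) ((a · s) - β ∷ []) refl)
                  (single s∈ (there (∈-vals a∈)) (here refl))) (Allₚ.all-filter In? R₁))
              (subst (Few G M) (sym (List.length-++ (filter (∁? In?) R₁)))
                (few-step {G} {H} {M} {o = length (filter (∁? In?) R₁)} H≤G M≤H R-few
                  (linear 0 (outside ⊞ M+Y≤H) (arith (length (filter (∁? In?) R₁) *ℕ card M) (card M) (card H) (size Y)))))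
            where
            open ++-Solver renaming (_⊕_ to _∙_)
            M+Y≤H : card M +ℕ size Y ≤ card H
            M+Y≤H = size-coset M Y ⟪ H ⟫ Y⊆H (stab-+ Y) (λ h∈ x∈ → +-closed H x∈ (M≤H h∈)) z∈ z∉
            outside : length (filter (∁? In?) R₁) *ℕ card M +ℕ card M ≤ size Y
            outside = count-outside-stab B (λ _ → here refl) K R₁ In? λ t f a a∈ → f (there (∈-vals a∈))
            arith : ∀ o m h y → o +ℕ m +ℕ m +ℕ (y +ℕ h) +ℕ 0 ≡ h +ℕ (o +ℕ m +ℕ (m +ℕ y))
            arith = solve-∀

    -- Reduction modulo H and the final bounds

    module Assembly (G : Subgroup) (γ : Carrier) (n : ℕ) (G≤n : card G ≤ n)
      {dG : ℕ} (isDavG : IsDav W G dG) {S : List Carrier} (S⊆γ+G : All (InCoset γ G) S) (long : n +ℕ dG ≤ suc (length S))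
      (β : Carrier) (H : Subgroup) (H≤G : H ≤G G) {dH : ℕ} (isDavH : IsDav W H dH) (S″ T R : List Carrier)
      (S-split : ((S″ ++ T) ++ R) ↭ S)
      (inside : All (Inside H β) (S″ ++ T)) (R-few : Few G H (length R))
      (S″-length : suc (length S″) ≡ card H +ℕ dH) (S″-full : Full H β S″) {e : ℕ} (isDavQ : IsDavQ W G H (suc e)) where

      r = length R

      S-count : length S″ +ℕ length T +ℕ r ≡ length S
      S-count = trans (cong (_+ℕ r) (sym (List.length-++ S″))) (length-split {A = S″ ++ T} S-split)

      quotient-bound : dH +ℕ suc e ≤ suc dG
      quotient-bound = davenport-quotient G H H≤G isDavG isDavH isDavQ

      room : card H +ℕ r ≤ n
      room = ℕₚ.≤-trans (ℕₚ.≤-reflexive (ℕₚ.+-comm (card H) r)) (ℕₚ.≤-trans (few⇒room {G} {H} H≤G R-few) G≤n)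

      enough : n +ℕ e ≤ card H +ℕ length T +ℕ r
      enough = linear 0 (long ⊞ quotient-bound ⊞ ℕₚ.≤-reflexive S″-length ⊞ ℕₚ.≤-reflexive (sym S-count))
        (arith n e (card H) (length T) r dG (length S) dH (length S″))
        where
        arith : ∀ n e H t r D s d p → n +ℕ e +ℕ (suc s +ℕ (suc D +ℕ (H +ℕ d +ℕ (p +ℕ t +ℕ r)))) +ℕ 0
          ≡ H +ℕ t +ℕ r +ℕ (n +ℕ D +ℕ (d +ℕ suc e +ℕ (suc p +ℕ s)))
        arith = solve-∀

      e≤T : e ≤ length T
      e≤T = linear 0 (enough ⊞ room) (arith n e (card H) (length T) r)
        where
        arith : ∀ n e H t r → e +ℕ (H +ℕ t +ℕ r +ℕ n) +ℕ 0 ≡ t +ℕ (n +ℕ e +ℕ (H +ℕ r))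
        arith = solve-∀

      S₀ : List Carrier
      S₀ = S″ ++ (take e T ++ R)

      S₀⊑S : S₀ ⊑ S
      S₀⊑S = ⊑-trans (⊑-++⁺ {A = S″} {S″} ⊑-refl (⊑-++⁺ {A = take e T} {T} {R} {R} (take-⊑ e T) ⊑-refl))
        (⊑-reflexive (↭-trans (↭-reflexive (sym (List.++-assoc S″ T R))) S-split))

      S₀-length : suc (length S₀) ≡ card H +ℕ dH +ℕ (e +ℕ r)
      S₀-length = trans (cong suc (trans (List.length-++ S″) (cong (length S″ +ℕ_) (trans (List.length-++ (take e T)) (cong (_+ℕ r) (length-take-≤ T e≤T))))))
        (cong (_+ℕ (e +ℕ r)) S″-length)

      RS″⊑S₀ : (R ++ S″) ⊑ S₀
      RS″⊑S₀ = take e T , solve 3 (λ r s t → (r ∙ s) ∙ t ⊜ s ∙ (t ∙ r)) ↭-refl R S″ (take e T)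
        where open ++-Solver renaming (_⊕_ to _∙_)

      S″-nonempty : 1 ≤ length S″
      S″-nonempty = ℕₚ.≤-pred (ℕₚ.≤-trans (ℕₚ.+-mono-≤ (card-pos H) dH-pos) (ℕₚ.≤-reflexive (sym S″-length)))
        where
        dH-pos : 1 ≤ dH
        dH-pos with DavProp-pos {H} {_≡ ε} (proj₁ isDavH)
        ... | d , refl = s≤s z≤n

      α : Carrier
      α = proj₁ (length⇒∈ {xs = S″} S″-nonempty)
      α∈S″ : α ∈ S″
      α∈S″ = proj₂ (length⇒∈ {xs = S″} S″-nonempty)
      α-inside : Inside H β α
      α-inside = All.lookup inside (∈-++⁺ˡ α∈S″)
      α∈γ+G : mem G (α - γ)
      α∈γ+G = All.lookup S⊆γ+G (∈-resp-↭ S-split (∈-++⁺ˡ (∈-++⁺ˡ α∈S″)))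

      S′⊆α+H : All (InCoset α H) (S″ ++ T)
      S′⊆α+H = All.map (λ f → Inside⇒mem H f α-inside) inside

      R⊆α+G : All (λ s → mem G (s - α)) R
      R⊆α+G = All.tabulate λ {s} s∈ → mem-resp G (abel (λ s α γ → s ⊝ γ ⊝ (α ⊝ γ) ≐ s ⊝ α) (s ∷ α ∷ γ ∷ []) refl)
        (mem-- G (All.lookup S⊆γ+G (∈-resp-↭ S-split (∈-++⁺ʳ (S″ ++ T) s∈))) α∈γ+G)

      -- Modulo H, sums over S and over S₀ are both just the sums over subsequences of R.
      ModH : Carrier → Set
      ModH z = ∃ λ U → ∃ λ C → ∃ λ u → (U ++ C) ↭ R × Sel (vals β) U u × mem H (z - u)

      S⇒ModH : ∀ {z} → Sums β n S z → ModH z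
      S⇒ModH s = sums-mod H inside (Sums-mono (⊑-reflexive (↭-sym S-split)) s)

      ModH⇒S : ∀ {z} → ModH z → Sums β n S z
      ModH⇒S (U , C , u , p , s , m) = Sums-mono (⊑-reflexive (↭-trans (↭-reflexive (sym (List.++-assoc S″ T R))) S-split))
        (sums-of-extension G H (proj₁ isDavQ) α-inside {N = n} {P = S″} {Q = T} {O = R} {U = U} {C = C}
          S″-full (Allₚ.++⁻ʳ S″ inside) R⊆α+G room enough p s m)

      S₀⇒ModH : ∀ {z} → Sums β (card H +ℕ r) S₀ z → ModH z
      S₀⇒ModH s = sums-mod H {S = S″ ++ take e T} (Allₚ.++⁺ (Allₚ.++⁻ˡ S″ inside) (Allₚ.take⁺ e (Allₚ.++⁻ʳ S″ inside)))
        (Sums-mono (⊑-reflexive (↭-reflexive (sym (List.++-assoc S″ (take e T) R)))) s)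

      ModH⇒S₀ : ∀ {z} → ModH z → Sums β (card H +ℕ r) S₀ z
      ModH⇒S₀ (U , C , u , p , s , m) = sums-of-extension G H (proj₁ isDavQ) α-inside {N = card H +ℕ r} {P = S″} {Q = take e T} {O = R} {U = U} {C = C}
        S″-full (Allₚ.take⁺ e (Allₚ.++⁻ʳ S″ inside)) R⊆α+G ℕₚ.≤-refl
        (ℕₚ.≤-reflexive (trans (arith (card H) r e) (cong (λ l → card H +ℕ l +ℕ r) (sym (length-take-≤ T e≤T))))) p s m
        where
        arith : ∀ h r e → h +ℕ r +ℕ e ≡ h +ℕ e +ℕ r
        arith = solve-∀

      Σₖ⇒Sums : ∀ {k L x} → Σₖ k W L x → Sums β k L (x - k ×ℕ β)
      Σₖ⇒Sums (U , U⊑ , refl , w) = U , U⊑ , refl , WSum⇒Sel β w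

      Sums⇒Σₖ : ∀ {k L x} → Sums β k L (x - k ×ℕ β) → Σₖ k W L x
      Sums⇒Σₖ {x = x} (U , U⊑ , refl , s) = U , U⊑ , refl , subst (WSum W U)
        (abel (λ x k → x ⊝ k ⊕ k ≐ x) (x ∷ length U ×ℕ β ∷ []) refl) (Sel⇒WSum β s)

      full-coset : ∀ x → (InCoset ((ℤ.+ card H) · β) H x → Σₖ (card H) W S″ x) × (Σₖ (card H) W S″ x → InCoset ((ℤ.+ card H) · β) H x)
      full-coset x = (λ m → Sums⇒Σₖ (S″-full m)) , λ s → back (Σₖ⇒Sums s)
        where
        back : Sums β (card H) S″ (x - card H ×ℕ β) → mem H (x - card H ×ℕ β)
        back (U , U⊑ , _ , s) = Sel-mem H (λ t∈ → vals-Inside H (All.lookup inside (∈-++⁺ˡ (⊑-∈ U⊑ t∈)))) s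

      c : Carrier
      c = (ℤ.+ n ℤ.- ℤ.+ card H ℤ.- ℤ.+ r) · β

      -- By `room` the integer coefficient in `c` is a natural number, so ordinary multiples add up.
      c-eq : c + (card H +ℕ r) ×ℕ β ≡ n ×ℕ β
      c-eq = trans (cong (λ i → i · β + (card H +ℕ r) ×ℕ β) int-eq)
        (trans (sym (×ℕ-homo-+ (n ∸ (card H +ℕ r)) (card H +ℕ r) β)) (cong (_×ℕ β) (ℕₚ.m∸n+n≡m room)))
        where
        reassoc : ∀ i j k → i ℤ.- j ℤ.- k ≡ i ℤ.- (j ℤ.+ k)
        reassoc = ℤ-Solver.solve-∀
        int-eq : ℤ.+ n ℤ.- ℤ.+ card H ℤ.- ℤ.+ r ≡ ℤ.+ (n ∸ (card H +ℕ r))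
        int-eq = trans (reassoc (ℤ.+ n) (ℤ.+ card H) (ℤ.+ r)) (ℤ-minus (n ∸ (card H +ℕ r)) (card H +ℕ r) (sym (ℕₚ.m∸n+n≡m room)))

      shift-eq : ∀ {x y} → x ≡ c + y → y - (card H +ℕ r) ×ℕ β ≡ x - n ×ℕ β
      shift-eq {y = y} refl = trans (abel (λ c y k → y ⊝ k ≐ c ⊕ y ⊝ (c ⊕ k)) (c ∷ y ∷ (card H +ℕ r) ×ℕ β ∷ []) refl)
        (cong (λ u → c + y - u) c-eq)

      reduction : ∀ x → (Σₖ n W S x → ∃ λ y → Σₖ (card H +ℕ r) W S₀ y × x ≡ c + y)
        × (∀ y → Σₖ (card H +ℕ r) W S₀ y → x ≡ c + y → Σₖ n W S x)
      reduction x = to , from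
        where
        x≡ : x ≡ c + (x - c)
        x≡ = abel (λ x c → x ≐ c ⊕ (x ⊝ c)) (x ∷ c ∷ []) refl
        to : Σₖ n W S x → ∃ λ y → Σₖ (card H +ℕ r) W S₀ y × x ≡ c + y
        to s = x - c , Sums⇒Σₖ (subst (Sums β (card H +ℕ r) S₀) (sym (shift-eq x≡)) (ModH⇒S₀ (S⇒ModH (Σₖ⇒Sums s)))) , x≡
        from : ∀ y → Σₖ (card H +ℕ r) W S₀ y → x ≡ c + y → Σₖ n W S x
        from y s e = Sums⇒Σₖ (subst (Sums β n S) (shift-eq e) (ModH⇒S (S₀⇒ModH (Σₖ⇒Sums s))))

      periodic : Periodic H (Σₖ n W S)
      periodic {x} {h} h∈ s = Sums⇒Σₖ (ModH⇒S (move (S⇒ModH (Σₖ⇒Sums s))))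
        where
        move : ModH (x - n ×ℕ β) → ModH (x + h - n ×ℕ β)
        move (U , C , u , p , s , m) = U , C , u , p , s
          , mem-resp H (abel (λ x h b u → x ⊝ b ⊝ u ⊕ h ≐ x ⊕ h ⊝ b ⊝ u) (x ∷ h ∷ n ×ℕ β ∷ u ∷ []) refl) (+-closed H m h∈)

      nβ∈ : Σₖ n W S ((ℤ.+ n) · β)
      nβ∈ = Sums⇒Σₖ (ModH⇒S ([] , R , ε , ↭-refl , [] , mem-resp H (abel (λ b → 𝟘 ≐ b ⊝ b ⊝ 𝟘) (n ×ℕ β ∷ []) refl) (ε∈ H)))

      -- Integers matter here: |G/H| - 2 is -1 when `H = G`. For r = 0 the first entry of the
      -- minimum is used, otherwise the second.
      S′-bound : (ℤ.+ length S) ℤ.⊓ ((ℤ.+ length S) ℤ.- ((ℤ.+ index G H) ℤ.- (ℤ.+ 2))) ℤ.≤ ℤ.+ length (S″ ++ T)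
      S′-bound = cases R-few
        where
        count : length (S″ ++ T) +ℕ r ≡ length S
        count = length-split {A = S″ ++ T} S-split
        cases : Few G H r → (ℤ.+ length S) ℤ.⊓ ((ℤ.+ length S) ℤ.- ((ℤ.+ index G H) ℤ.- (ℤ.+ 2))) ℤ.≤ ℤ.+ length (S″ ++ T)
        cases (inj₁ z) = ℤₚ.≤-trans (ℤₚ.i⊓j≤i (ℤ.+ length S) _)
          (ℤₚ.≤-reflexive (cong ℤ.+_ (trans (sym count) (trans (cong (length (S″ ++ T) +ℕ_) z) (ℕₚ.+-identityʳ _)))))
        cases (inj₂ le) = ℤₚ.≤-trans (ℤₚ.i⊓j≤j (ℤ.+ length S) _) (ℤₚ.≤-trans (ℤₚ.≤-reflexive eq) (ℤₚ.i-j≤i (ℤ.+ length (S″ ++ T)) (ℤ.+ t)))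
          where
          t = proj₁ (index-slack G H {r} le)
          idx : index G H ≡ r +ℕ t +ℕ 2
          idx = proj₂ (index-slack G H {r} le)
          cancel : ∀ s r t → s ℤ.+ r ℤ.- (r ℤ.+ t) ≡ s ℤ.- t
          cancel = ℤ-Solver.solve-∀
          eq : ℤ.+ length S ℤ.- (ℤ.+ index G H ℤ.- ℤ.+ 2) ≡ ℤ.+ length (S″ ++ T) ℤ.- ℤ.+ t
          eq = trans (cong₂ ℤ._-_ (cong ℤ.+_ (sym count)) (ℤ-minus (r +ℕ t) 2 idx)) (cancel (ℤ.+ length (S″ ++ T)) (ℤ.+ r) (ℤ.+ t))

      R-bound : ℤ.+ r ℤ.≤ (ℤ.+ 0) ℤ.⊔ ((ℤ.+ index G H) ℤ.- (ℤ.+ 2))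
      R-bound = cases R-few
        where
        cases : Few G H r → ℤ.+ r ℤ.≤ (ℤ.+ 0) ℤ.⊔ ((ℤ.+ index G H) ℤ.- (ℤ.+ 2))
        cases (inj₁ z) = ℤₚ.≤-trans (ℤₚ.≤-reflexive (cong ℤ.+_ z)) (ℤₚ.i≤i⊔j (ℤ.+ 0) _)
        cases (inj₂ le) = ℤₚ.≤-trans (ℤₚ.≤-trans (ℤ.+≤+ (ℕₚ.m≤m+n r t)) (ℤₚ.≤-reflexive (sym (ℤ-minus (r +ℕ t) 2 idx)))) (ℤₚ.i≤j⊔i (ℤ.+ 0) _)
          where
          t = proj₁ (index-slack G H {r} le)
          idx : index G H ≡ r +ℕ t +ℕ 2
          idx = proj₂ (index-slack G H {r} le)

      S″-length-ℤ : ℤ.+ length S″ ≡ ℤ.+ card H ℤ.+ ℤ.+ dH ℤ.- ℤ.+ 1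
      S″-length-ℤ = sym (ℤ-minus (length S″) 1 (trans (sym S″-length) (ℕₚ.+-comm 1 (length S″))))

      S₀-length-ℤ : ℤ.+ length S₀ ≡ ℤ.+ card H ℤ.+ ℤ.+ r ℤ.+ ℤ.+ dH ℤ.+ ℤ.+ suc e ℤ.- ℤ.+ 2
      S₀-length-ℤ = sym (ℤ-minus (length S₀) 2 (trans (arith (card H) r dH e) (trans (cong suc (sym S₀-length)) (ℕₚ.+-comm 2 (length S₀)))))
        where
        arith : ∀ h r d e → h +ℕ r +ℕ d +ℕ suc e ≡ suc (h +ℕ d +ℕ (e +ℕ r))
        arith = solve-∀

      S₀-bound : ℤ.+ card H ℤ.+ ℤ.+ r ℤ.+ ℤ.+ dH ℤ.+ ℤ.+ suc e ℤ.- ℤ.+ 2 ℤ.≤ ℤ.+ card H ℤ.+ ℤ.+ r ℤ.+ ℤ.+ dG ℤ.- ℤ.+ 1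
      S₀-bound = ℤₚ.≤-trans (ℤₚ.≤-reflexive (sym S₀-length-ℤ)) (bound (DavProp-pos {G} {_≡ ε} (proj₁ isDavG)))
        where
        bound : (∃ λ d → dG ≡ suc d) → ℤ.+ length S₀ ℤ.≤ ℤ.+ card H ℤ.+ ℤ.+ r ℤ.+ ℤ.+ dG ℤ.- ℤ.+ 1
        bound (d , eq) = ℤₚ.≤-trans
          (ℤ.+≤+ (linear 0 (quotient-bound ⊞ ℕₚ.≤-reflexive S₀-length ⊞ ℕₚ.≤-reflexive eq) (arith (length S₀) (card H) r d dH e dG)))
          (ℤₚ.≤-reflexive (sym (ℤ-minus (card H +ℕ r +ℕ d) 1 (trans (cong (card H +ℕ r +ℕ_) eq) (arith′ (card H) r d)))))
          where
          arith : ∀ s h r d k e D → s +ℕ (suc D +ℕ (h +ℕ k +ℕ (e +ℕ r) +ℕ suc d)) +ℕ 0 ≡ h +ℕ r +ℕ d +ℕ (k +ℕ suc e +ℕ (suc s +ℕ D))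
          arith = solve-∀
          arith′ : ∀ h r d → h +ℕ r +ℕ suc d ≡ h +ℕ r +ℕ d +ℕ 1
          arith′ = solve-∀

    Conclusion : (G : Subgroup) (γ δ : Carrier) (n dG : ℕ) (S : List Carrier) → Set₁
    Conclusion G γ δ n dG S =
      Σ Subgroup λ H → H ≤G G ×
      Σ Carrier λ α → InCoset γ G α × Σ Carrier λ β → InCoset δ G β ×
      Σ (List Carrier) λ S′ → Σ (List Carrier) λ R → (S′ ++ R) ↭ S ×
      Σ (List Carrier) λ S″ → S″ ⊑ S′ ×
      Σ (List Carrier) λ S₀ → S₀ ⊑ S ×
      Σ ℕ λ dH → IsDav W H dH × Σ ℕ λ dQ → IsDavQ W G H dQ ×
      (All (InCoset α H) S′ × All (InCoset α H) S″
      × (∀ {s a} → s ∈ S′ → a ∈ W → InCoset β H (a · s)))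
      × ((ℤ.+ length S) ℤ.⊓ ((ℤ.+ length S) ℤ.- ((ℤ.+ index G H) ℤ.- (ℤ.+ 2))) ℤ.≤ ℤ.+ length S′)
      × (ℤ.+ length S″ ≡ (ℤ.+ card H) ℤ.+ (ℤ.+ dH) ℤ.- (ℤ.+ 1))
      × (∀ x → (InCoset ((ℤ.+ card H) · β) H x → Σₖ (card H) W S″ x)
      × (Σₖ (card H) W S″ x → InCoset ((ℤ.+ card H) · β) H x))
      × (∀ x → (Σₖ n W S x → ∃ λ y → Σₖ (card H +ℕ length R) W S₀ y
      × x ≡ (((ℤ.+ n) ℤ.- (ℤ.+ card H) ℤ.- (ℤ.+ length R)) · β) + y)
      × (∀ y → Σₖ (card H +ℕ length R) W S₀ y
      → x ≡ (((ℤ.+ n) ℤ.- (ℤ.+ card H) ℤ.- (ℤ.+ length R)) · β) + y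
      → Σₖ n W S x))
      × Periodic H (Σₖ n W S) × Σₖ n W S ((ℤ.+ n) · β)
      × (R ++ S″) ⊑ S₀
      × (ℤ.+ length S₀ ≡ (ℤ.+ card H) ℤ.+ (ℤ.+ length R) ℤ.+ (ℤ.+ dH) ℤ.+ (ℤ.+ dQ) ℤ.- (ℤ.+ 2))
      × ((ℤ.+ card H) ℤ.+ (ℤ.+ length R) ℤ.+ (ℤ.+ dH) ℤ.+ (ℤ.+ dQ) ℤ.- (ℤ.+ 2)
      ℤ.≤ (ℤ.+ card H) ℤ.+ (ℤ.+ length R) ℤ.+ (ℤ.+ dG) ℤ.- (ℤ.+ 1))
      × ((ℤ.+ length R) ℤ.≤ (ℤ.+ 0) ℤ.⊔ ((ℤ.+ index G H) ℤ.- (ℤ.+ 2)))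

    module _ (G : Subgroup) (γ δ : Carrier) (n : ℕ) (G≤n : card G ≤ n) {dG : ℕ} (isDavG : IsDav W G dG) {S : List Carrier}
      (S⊆γ+G : All (InCoset γ G) S) (A·S⊆δ+G : All (Inside G δ) S) (long : n +ℕ dG ≤ suc (length S)) where

      long-G : card G +ℕ dG ≤ suc (length S)
      long-G = ℕₚ.≤-trans (ℕₚ.+-monoˡ-≤ dG G≤n) long

      fromCore : Concentration.Core G {dG} (proj₁ isDavG) {S} long-G δ → Conclusion G γ δ n dG S
      fromCore core = fromStructure (descend (card G) G ℕₚ.≤-refl K≤G (λ x∈ → x∈) {O} {[]} (↭-reflexive (List.++-identityʳ O)) insideO (inj₁ refl))
        where
        open Concentration.Core core
        open Descent G {dG} (proj₁ isDavG) {S} long-G K K≤G β₀ P Q O S-split inside few dK isDavK P-length P-full using (Structure; descend)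
        insideO : All (Inside G β₀) O
        insideO = All.tabulate λ s∈ → Inside-recenter G β₀-β∈G (All.lookup A·S⊆δ+G (∈-resp-↭ S-split (∈-++⁺ʳ (P ++ Q) s∈)))
        fromStructure : Structure → Conclusion G γ δ n dG S
        fromStructure s with davenport G (dec (Structure.H s)) dG
          (DavProp-weaken {G} {G} {_≡ ε} {mem (Structure.H s)} (λ x∈ → x∈) (λ { refl → ε∈ (Structure.H s) }) (proj₁ isDavG))
        ... | dQ , davQ , minQ with DavProp-pos {G} {mem (Structure.H s)} davQ
        ... | e , refl = H , H≤G , α , α∈γ+G , β₀ , β₀-β∈G , S″ ++ T , R , S-split′ , S″ , ⊑-++ˡ S″ T , S₀ , S₀⊑S
            , dH , isDavH , suc e , (davQ , minQ)
            , (S′⊆α+H , Allₚ.++⁻ˡ S″ S′⊆α+H , λ {s} {a} s∈ a∈ → All.lookup inside′ s∈ a a∈)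
            , S′-bound , S″-length-ℤ , full-coset , reduction , periodic , nβ∈ , RS″⊑S₀ , S₀-length-ℤ , S₀-bound , R-bound
          where
          open Structure s
          open Assembly G γ n G≤n {dG} isDavG {S} S⊆γ+G long β₀ H H≤G {dH} isDavH S″ T R S-split′
            inside′ R-few S″-length S″-full {e} (davQ , minQ)

      conclusion : Conclusion G γ δ n dG S
      conclusion = fromCore (Concentration.core G {dG} (proj₁ isDavG) {S} long-G (card G) G ℕₚ.≤-refl (λ x∈ → x∈) {δ} {δ} {S} {[]}
        (mem-resp G (sym (inverseʳ δ)) (ε∈ G)) (↭-reflexive (List.++-identityʳ S)) A·S⊆δ+G ℕₚ.≤-refl)

open import Data.Integer using (+_)

theorem1p1 : (𝔾 : FinAbGroup) → let open FAG 𝔾 in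
    (G : Subgroup) (γ δ : Carrier) (n : ℕ) → card G ℕ.≤ n →
    (W : List ℤ) → ¬ (W ≡ []) → gcdList W ≡ 1 →
    (dG : ℕ) → IsDav W G dG →
    (S : List Carrier) → All (InCoset γ G) S →
    (∀ {s a} → s ∈ S → a ∈ W → InCoset δ G (a · s)) →
    (+ n) ℤ.+ (+ dG) ℤ.- (+ 1) ℤ.≤ + length S →
    Σ Subgroup λ H → H ≤G G ×
    Σ Carrier λ α → InCoset γ G α × Σ Carrier λ β → InCoset δ G β ×
    Σ (List Carrier) λ S′ → Σ (List Carrier) λ R → (S′ ++ R) ↭ S ×
    Σ (List Carrier) λ S″ → S″ ⊑ S′ ×
    Σ (List Carrier) λ S₀ → S₀ ⊑ S ×
    Σ ℕ λ dH → IsDav W H dH × Σ ℕ λ dQ → IsDavQ W G H dQ ×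
    (All (InCoset α H) S′ × All (InCoset α H) S″
    × (∀ {s a} → s ∈ S′ → a ∈ W → InCoset β H (a · s)))
    × ((+ length S) ℤ.⊓ ((+ length S) ℤ.- ((+ index G H) ℤ.- (+ 2))) ℤ.≤ + length S′)
    × (+ length S″ ≡ (+ card H) ℤ.+ (+ dH) ℤ.- (+ 1))
    × (∀ x → (InCoset ((+ card H) · β) H x → Σₖ (card H) W S″ x)
    × (Σₖ (card H) W S″ x → InCoset ((+ card H) · β) H x))
    × (∀ x → (Σₖ n W S x → ∃ λ y → Σₖ (card H ℕ.+ length R) W S₀ y
    × x ≡ (((+ n) ℤ.- (+ card H) ℤ.- (+ length R)) · β) + y)
    × (∀ y → Σₖ (card H ℕ.+ length R) W S₀ y
    → x ≡ (((+ n) ℤ.- (+ card H) ℤ.- (+ length R)) · β) + y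
    → Σₖ n W S x))
    × Periodic H (Σₖ n W S) × Σₖ n W S ((+ n) · β)
    × (R ++ S″) ⊑ S₀
    × (+ length S₀ ≡ (+ card H) ℤ.+ (+ length R) ℤ.+ (+ dH) ℤ.+ (+ dQ) ℤ.- (+ 2))
    × ((+ card H) ℤ.+ (+ length R) ℤ.+ (+ dH) ℤ.+ (+ dQ) ℤ.- (+ 2)
    ℤ.≤ (+ card H) ℤ.+ (+ length R) ℤ.+ (+ dG) ℤ.- (+ 1))
    × ((+ length R) ℤ.≤ (+ 0) ℤ.⊔ ((+ index G H) ℤ.- (+ 2)))
theorem1p1 𝔾 G γ δ n G≤n [] W≢[] gcd≡1 dG isDavG S S⊆γ+G A·S⊆δ+G long = ⊥-elim (W≢[] refl)
theorem1p1 𝔾 G γ δ n G≤n W@(a₀ ∷ _) W≢[] gcd≡1 dG isDavG S S⊆γ+G A·S⊆δ+G long =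
  conclusion G γ δ n G≤n isDavG S⊆γ+G (All.tabulate λ s∈ a a∈ → A·S⊆δ+G s∈ a∈) long′
  where
  open Proof 𝔾
  open WeightedSums W a₀ (here refl) gcd≡1
  long′ : n +ℕ dG ≤ suc (length S)
  long′ with DavProp-pos {G} {_≡ ε} (proj₁ isDavG)
  ... | d , refl = ℕₚ.≤-trans (ℕₚ.≤-reflexive (ℕₚ.+-suc n d)) (s≤s (ℤₚ.drop‿+≤+
      (ℤₚ.≤-trans (ℤₚ.≤-reflexive (sym (ℤ-minus (n +ℕ d) 1 (trans (ℕₚ.+-suc n d) (ℕₚ.+-comm 1 (n +ℕ d)))))) long)))
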